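{- There exists $\bar n_2$ such that for every $n\ge\bar n_2$ and every integer $m$ with $n^2/8-\frac n5\le m\le n^2/8$, each $3$-graph in $\mathcal G(n,m)$ is quasi-bipartite. Moreover, there exists $\tilde n_2$ such that for every $n\ge\tilde n_2$ and every $m$ with $n^2/8<m\le\binom{n-1}{2}$, each $3$-graph in $\mathcal G(n,m)$ has maximum degree at least $n^2/32$, and one can delete from it at most $144$ edges to obtain a union of at most four stars and some number of isolated vertices.
   Context: A $3$-graph is a family of distinct $3$-element subsets (edges) of a finite vertex set; $\Delta(H)$ is the maximum degree (degree = number of edges containing a vertex). $P^3_3$ is the loose path with three edges $e_1,e_2,e_3$, $|e_1\cap e_2|=|e_2\cap e_3|=1$, $e_1\cap e_3=\emptyset$; $H$ is $P^3_3$-free if it contains no copy of it. Let $\hat f(n,m)=\min\{\Delta(H): H$ is a $P^3_3$-free $3$-graph with $n$ vertices and $m$ edges$\}$ and let $\mathcal G(n,m)$ be the family of $P^3_3$-free $3$-graphs on $n$ vertices with $m$ edges and $\Delta(H)=\hat f(n,m)$. A $3$-graph is quasi-bipartite if its vertex set can be partitioned into $X=\{x_1,\dots,x_s\}$, $Y=\{y_1,\dots,y_s\}$, $Z=\{z_1,\dots,z_t\}$ so that every edge is of the form $\{x_i,y_i,z_j\}$ for some $1\le i\le s$, $1\le j\le t$. A star with center $v$ is a $3$-graph in which every edge contains $v$. -}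

module Defs where

open import Data.Nat using (ℕ; _≤_; _⊔_; _+_)
open import Data.Fin using (Fin)
open import Data.Fin.Subset using (Subset; _∈_; _∩_; _∪_; ∣_∣; ⁅_⁆)
open import Data.Fin.Subset.Properties using (_∈?_)
open import Data.List using (List; length; filter; map; foldr; allFin)
open import Data.List.Relation.Unary.All using (All)
open import Data.List.Relation.Unary.Unique.Propositional using (Unique)
open import Data.List.Membership.Propositional renaming (_∈_ to _∈ₗ_)
open import Data.List.Relation.Binary.Sublist.Propositional using (_⊆_)
open import Data.Product using (Σ; ∃; ∃-syntax; _×_)
open import Data.Sum using (_⊎_; inj₁; inj₂)
open import Relation.Binary.PropositionalEquality using (_≡_)
open import Relation.Nullary using (¬_)
open import Function.Bundles using (_↔_; Inverse)

record Graph3 (n : ℕ) : Set where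
  field
    edges    : List (Subset n)
    size3    : All (λ e → ∣ e ∣ ≡ 3) edges
    distinct : Unique edges
open Graph3 public

∥_∥ : ∀ {n} → Graph3 n → ℕ
∥ H ∥ = length (edges H)

deg : ∀ {n} → Graph3 n → Fin n → ℕ
deg H v = length (filter (v ∈?_) (edges H))

Δ : ∀ {n} → Graph3 n → ℕ
Δ {n} H = foldr _⊔_ 0 (map (deg H) (allFin n))

HasP33 : ∀ {n} → Graph3 n → Set
HasP33 H = ∃[ e₁ ] ∃[ e₂ ] ∃[ e₃ ]
  (e₁ ∈ₗ edges H × e₂ ∈ₗ edges H × e₃ ∈ₗ edges H ×
   ∣ e₁ ∩ e₂ ∣ ≡ 1 × ∣ e₂ ∩ e₃ ∣ ≡ 1 × ∣ e₁ ∩ e₃ ∣ ≡ 0)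

P33Free : ∀ {n} → Graph3 n → Set
P33Free H = ¬ HasP33 H

InG : (n m : ℕ) → Graph3 n → Set
InG n m H = P33Free H × ∥ H ∥ ≡ m ×
  ((H' : Graph3 n) → P33Free H' → ∥ H' ∥ ≡ m → Δ H ≤ Δ H')

-- Quasi-bipartite: a bijection Fin s ⊎ Fin s ⊎ Fin t ↔ Fin n giving the
-- partition X = {x_i}, Y = {y_i}, Z = {z_j}; every edge is {x_i, y_i, z_j}.
QuasiBipartite : ∀ {n} → Graph3 n → Set
QuasiBipartite {n} H = ∃[ s ] ∃[ t ] Σ ((Fin s ⊎ (Fin s ⊎ Fin t)) ↔ Fin n) λ φ →
  let f = Inverse.to φ in
  All (λ e → ∃[ i ] ∃[ j ] e ≡ (⁅ f (inj₁ i) ⁆ ∪ ⁅ f (inj₂ (inj₁ i)) ⁆) ∪ ⁅ f (inj₂ (inj₂ j)) ⁆)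
      (edges H)

-- A list of edges is a vertex-disjoint union of at most four stars (plus
-- isolated vertices): there are k ≤ 4 centers c_0..c_{k-1} and a colouring of
-- the vertices by Fin k such that each edge contains some center c_i and all
-- its vertices have colour i (so distinct stars are vertex-disjoint).
UnionOfAtMost4Stars : ∀ {n} → List (Subset n) → Set
UnionOfAtMost4Stars {n} es = ∃[ k ] (k ≤ 4 × Σ (Fin k → Fin n) λ c → Σ (Fin n → Fin k) λ col →
  All (λ e → ∃[ i ] (c i ∈ e × ((v : Fin n) → v ∈ e → col v ≡ i))) es)

NearStars : ∀ {n} → ℕ → Graph3 n → Set
NearStars d H = ∃[ es ] (es ⊆ edges H × length (edges H) ≤ length es + d ×
  UnionOfAtMost4Stars es)

{-# OPTIONS --safe #-}
-- Vertices of degree at most 7 are deleted repeatedly, and so are the at most 20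
-- edges on the six vertices of a loose triangle, which form a component once all
-- degrees are at least 8. In the remaining core, call v central if no edge at v
-- meets an edge avoiding v in exactly one vertex. All edges at a noncentral v share
-- a further vertex u, which is central (v is a leaf of u) or has all its edges
-- through v (u and v are twins); hence every edge of the core consists of two twins
-- and a central vertex, or of a center and two of its leaves. If there are s pairs of
-- twins, t central vertices, k deleted vertices, and σ_z ≤ C(ℓ_z, 2) edges in the star
-- of z with ℓ_z leaves, then m ≤ s t + Σ σ_z + 7 k and n = 2 s + t + Σ ℓ_z + k.
-- Just below n²/8 quasi-bipartite graphs show Δ ≤ 2 n, so that leaves and deleted
-- vertices are too expensive: there are none. Above n²/8 the inequality yields
-- Δ ≥ n²/32 and a star with more than n/4 leaves. Distributing all vertices outside
-- the four largest stars over these stars, each kept below Δ edges, would decrease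
-- the maximum degree unless at most 144 edges lie outside these stars.
module Submission where

open import Data.Nat as ℕ using (ℕ; zero; suc; _≤_; _<_; _+_; _*_; _∸_; z≤n; s≤s; _⊔_)
open import Data.Nat.Properties as ℕₚ using
  (≤-trans; ≤-refl; ≤-reflexive; m≤m+n; m≤n+m; +-mono-≤; +-comm; +-assoc; ≰⇒>; <⇒≱)
open import Data.Nat.Tactic.RingSolver using (solve)
open import Data.List using ([]; _∷_)
open import Data.Sum using (_⊎_; inj₁; inj₂; [_,_]′)
open import Data.Product using (∃-syntax; _×_; _,_; proj₁; proj₂)
open import Data.Empty using (⊥; ⊥-elim)
open import Relation.Nullary using (¬_; Dec; yes; no; contradiction)
open import Relation.Binary.PropositionalEquality using
  (_≡_; _≢_; refl; sym; trans; cong; cong₂; subst; ≢-sym)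

-- Inequalities

-- Why four stars: if `Δ ≥ n²/32`, then four complete stars with fewer than `Δ` edges each have room
-- for all n vertices. This is what makes the exchange possible. The obstacle is that a star of the
-- extremal graph may have exactly `Δ` edges, one too many for the comparison graph. Each of the
-- four stars may therefore lose an edge, and the comparison carries a constant error of 3. Just
-- below n²/8, where a vertex is worth about n/4 edges, the term `7 * k` is harmless; against a
-- constant error it is not. What helps is that a star with leaves has at least 8 of them: a deleted
-- vertex that joins such a star gains more than the 7 edges it accounted for. If the fourth star is
-- empty, a new star has to be opened instead. That pays off only for more than 20 outside vertices;
-- up to 20 of them carry at most 7 * 20 = 140 edges. The structural claims rest on minimum degree
-- 8: a forbidden configuration yields a loose path, a loose triangle, or a vertex whose link is
-- covered by at most six pairs.

infixl 6 _⊕_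
infixl 7 _⊛_

_⊕_ : ∀ {a b c d} → a ≤ b → c ≤ d → a + c ≤ b + d
_⊕_ = +-mono-≤

_⊛_ : ∀ k {a b} → a ≤ b → k * a ≤ k * b
k ⊛ h = ℕₚ.*-monoʳ-≤ k h

-- The certificate of a linear (or polynomial) inequality: P ≤ Q is the weighted
-- sum of the hypotheses, k the slack, and eq a semiring identity.
linear : ∀ {P Q a b} k → P ≤ Q → a + Q + k ≡ b + P → a ≤ b
linear {P} {Q} {a} {b} k h eq = ℕₚ.+-cancelʳ-≤ P a b
  (≤-trans (ℕₚ.+-monoʳ-≤ a h) (≤-trans (m≤m+n (a + Q) k) (≤-reflexive eq)))

-- The potential "edges minus 7 times nonisolated vertices" does not decrease when p ≤ 7 t edges go
-- and t vertices become isolated; written without subtraction.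
reduction-step : ∀ {p e e′ e″ a a′ a″ t} → p + e′ ≡ e → p ≤ 7 * t → a′ + t ≤ a → e′ + 7 * a″ ≤ e″ + 7 * a′ →
                 e + 7 * a″ ≤ e″ + 7 * a
reduction-step {p} {_} {e′} {e″} {a} {a′} {a″} {t} refl h₁ h₂ h₃ = linear 0 (h₁ ⊕ 7 ⊛ h₂ ⊕ h₃)
  (solve (p ∷ e′ ∷ e″ ∷ a ∷ a′ ∷ a″ ∷ t ∷ []))

choose₂ : ℕ → ℕ
choose₂ zero = 0
choose₂ (suc k) = k + choose₂ k

decomposition-bound : ∀ {m c a v t n} → m + 7 * a ≤ c + 7 * t → v ≤ a → t ≤ n → m + 7 * v ≤ c + 7 * n
decomposition-bound {m} {c} {a} {v} {t} {n} h₁ h₂ h₃ = linear 0 (h₁ ⊕ 7 ⊛ h₂ ⊕ 7 ⊛ h₃)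
  (solve (m ∷ c ∷ a ∷ v ∷ t ∷ n ∷ []))

double-choose₂ : ∀ k → 2 * choose₂ k + k ≡ k * k
double-choose₂ zero = refl
double-choose₂ (suc k) = trans (regroup k (choose₂ k)) (trans (cong (λ x → x + suc (2 * k)) (double-choose₂ k)) (square k))
  where
  regroup : ∀ k c → 2 * (k + c) + suc k ≡ (2 * c + k) + suc (2 * k)
  regroup k c = solve (k ∷ c ∷ [])
  square : ∀ k → k * k + suc (2 * k) ≡ suc k * suc k
  square k = solve (k ∷ [])

2xy≤x²+y² : ∀ x y → 2 * (x * y) ≤ x * x + y * y
2xy≤x²+y² x y with ℕₚ.≤-total x y
... | inj₁ x≤y with ℕₚ.m≤n⇒∃[o]m+o≡n x≤y
...   | d , refl = linear (d * d) (≤-refl {x = 0}) (solve (x ∷ d ∷ []))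
2xy≤x²+y² x y | inj₂ y≤x with ℕₚ.m≤n⇒∃[o]m+o≡n y≤x
...   | d , refl = linear (d * d) (≤-refl {x = 0}) (solve (y ∷ d ∷ []))

1≰0 : ¬ 1 ≤ 0
1≰0 ()

-- Put N = 2s + t and d = L + k. Then 8st ≤ N², and each of the d other vertices adds at most n to
-- 8m (for the last k this is 56 ≤ n), so 8m ≤ N² + nd ≤ (N + d) n. It is applied by contraposition,
-- to find large degrees and large stars.
quadratic-bound : ∀ s t L k {m S n} → n ≡ 2 * s + t + L + k → 56 ≤ n →
  m ≤ s * t + S + 7 * k → 8 * S ≤ n * L → 8 * m ≤ n * n
quadratic-bound s t L k {m} {S} refl h₀ h₁ h₂ = linear ((2 * s + t) * (L + k))
  (8 ⊛ h₁ ⊕ h₂ ⊕ k ⊛ h₀ ⊕ 2xy≤x²+y² (2 * s) t) (solve (m ∷ s ∷ t ∷ S ∷ L ∷ k ∷ []))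

-- For d = 1 the hypothesis reads 3N ≤ 17, against N ≥ 6; larger d only make it worse.
deficit-zero : ∀ N d → 35 * (N * d) + 15 * (d * d) ≤ 32 * (N + d) → 7 ≤ N + d → d ≡ 0
deficit-zero N zero _ _ = refl
deficit-zero N (suc zero) h h₇ = ⊥-elim (1≰0 (linear 0 (h ⊕ 3 ⊛ h₇) (solve (N ∷ []))))
deficit-zero N (suc (suc g)) h h₇ = ⊥-elim (1≰0 (linear (37 * N + 35 * (N * g) + 27 * g + 15 * (g * g)) (h ⊕ h₇) (solve (N ∷ g ∷ []))))

-- A leaf or a deleted vertex contributes at most n/32 edges (7 ≤ n/32 is the hypothesis 224 ≤ n),
-- whereas a vertex of the quasi-bipartite part is worth about n/4. The loss of 7n/32 by a single
-- such vertex already exceeds the permitted n/5: this is 35 against 32 in `deficit-zero`.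
twin-cover-deficit : ∀ s t L k {m S n} → n ≡ 2 * s + t + L + k → 224 ≤ n →
  m ≤ s * t + S + 7 * k → 32 * S ≤ n * L → 5 * (n * n) ≤ 40 * m + 8 * n → L + k ≡ 0
twin-cover-deficit s t L k {m} {S} refl h₀ h₁ h₂ h₃ = deficit-zero (2 * s + t) (L + k)
  (linear 0 (160 ⊛ h₁ ⊕ 5 ⊛ h₂ ⊕ (5 * k) ⊛ h₀ ⊕ 20 ⊛ 2xy≤x²+y² (2 * s) t ⊕ 4 ⊛ h₃)
    (solve (m ∷ s ∷ t ∷ S ∷ L ∷ k ∷ [])))
  (≤-trans (ℕₚ.m≤m+n 7 217) (≤-trans h₀ (≤-reflexive (solve (s ∷ t ∷ L ∷ k ∷ [])))))

edges-bound : ∀ {m c v S} s t L k {n} → n ≡ 2 * s + t + L + k → v ≡ t + (s + (s + L)) →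
  m + 7 * v ≤ c + 7 * n → c ≤ s * t + S → m ≤ s * t + S + 7 * k
edges-bound {m} {c} {_} {S} s t L k refl refl h₁ h₂ = linear 0 (h₁ ⊕ h₂) (solve (m ∷ c ∷ S ∷ s ∷ t ∷ L ∷ k ∷ []))

vertex-sum : ∀ s t L k {v n} → v ≡ t + (s + (s + L)) → v + k ≡ n → n ≡ 2 * s + t + L + k
vertex-sum s t L k refl refl = solve (s ∷ t ∷ L ∷ k ∷ [])

scale-sum : ∀ A B {x y u v} → A * x ≤ B * y → A * u ≤ B * v → A * (x + u) ≤ B * (y + v)
scale-sum A B {x} {y} {u} {v} h₁ h₂ = linear 0 (h₁ ⊕ h₂) (solve (A ∷ B ∷ x ∷ y ∷ u ∷ v ∷ []))

mod4 : ∀ n → ∃[ q ] (n ≡ 4 * q ⊎ n ≡ 4 * q + 1 ⊎ n ≡ 4 * q + 2 ⊎ n ≡ 4 * q + 3)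
mod4 zero = 0 , inj₁ refl
mod4 (suc n) with mod4 n
... | q , inj₁ refl = q , inj₂ (inj₁ (+-comm 1 (4 * q)))
... | q , inj₂ (inj₁ refl) = q , inj₂ (inj₂ (inj₁ (solve (q ∷ []))))
... | q , inj₂ (inj₂ (inj₁ refl)) = q , inj₂ (inj₂ (inj₂ (solve (q ∷ []))))
... | q , inj₂ (inj₂ (inj₂ refl)) = suc q , inj₁ (solve (q ∷ []))

-- Meant for x = st: according to n mod 4, 5n² exceeds 40st by 0, 5, 20 or 5, always less than 40,
-- so rounding down costs nothing.
cancel-40 : ∀ {m x} → suc (40 * m) ≤ 40 * (x + 1) → m ≤ x
cancel-40 {m} {x} h = ℕₚ.≤-pred (≤-trans (ℕₚ.*-cancelˡ-< 40 m (x + 1) h) (≤-reflexive (+-comm x 1)))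

-- The maximum of s t subject to 2 s + t ≤ n is ⌊n²/8⌋.
balanced-split : ∀ n m → 40 * m ≤ 5 * (n * n) → ∃[ s ] ∃[ t ] (s + (s + t) ≤ n × m ≤ s * t)
balanced-split n m h with mod4 n
... | q , inj₁ refl = q , 2 * q , ≤-reflexive (solve (q ∷ [])) ,
      cancel-40 (linear 39 h (solve (m ∷ q ∷ [])))
... | q , inj₂ (inj₁ refl) = q , 2 * q + 1 , ≤-reflexive (solve (q ∷ [])) ,
      cancel-40 (linear 34 h (solve (m ∷ q ∷ [])))
... | q , inj₂ (inj₂ (inj₁ refl)) = q , 2 * q + 2 , ≤-reflexive (solve (q ∷ [])) ,
      cancel-40 (linear 19 h (solve (m ∷ q ∷ [])))
... | q , inj₂ (inj₂ (inj₂ refl)) = suc q , 2 * q + 1 , ≤-reflexive (solve (q ∷ [])) ,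
      cancel-40 (linear 34 h (solve (m ∷ q ∷ [])))

-- From 64 leaves on, σ ≤ 2n suffices. With at most 63 leaves, 32σ ≤ 16ℓ(ℓ - 1) ≤ 16 * 63 * ℓ, which
-- is where 1008 comes from.
sparse-star-ratio : ∀ {n ℓ σ} → 1008 ≤ n → σ ≤ 2 * n → σ ≤ choose₂ ℓ → 32 * σ ≤ n * ℓ
sparse-star-ratio {n} {ℓ} {σ} hn h₁ h₂ with 64 ℕ.≤? ℓ
... | yes 64≤ℓ = linear 0 (32 ⊛ h₁ ⊕ n ⊛ 64≤ℓ) (solve (n ∷ ℓ ∷ σ ∷ []))
... | no ℓ≱64 = go (choose₂ ℓ) h₂ (≤-reflexive (double-choose₂ ℓ)) (ℕₚ.≤-pred (≰⇒> ℓ≱64))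
  where
  go : ∀ c → σ ≤ c → 2 * c + ℓ ≤ ℓ * ℓ → ℓ ≤ 63 → 32 * σ ≤ n * ℓ
  go c h₂ h₃ h₄ = linear (16 * ℓ) (32 ⊛ h₂ ⊕ 16 ⊛ h₃ ⊕ (16 * ℓ) ⊛ h₄ ⊕ ℓ ⊛ hn) (solve (n ∷ ℓ ∷ σ ∷ c ∷ []))

full : ∀ {s t L k v n} → n ≡ 2 * s + t + L + k → v ≡ t + (s + (s + L)) → L + k ≡ 0 → v ≡ n
full {s} {t} {zero} {zero} refl refl refl = solve (s ∷ t ∷ [])

-- A star with at least n/4 leaves is controlled by D < n²/32, a smaller one by C(ℓ, 2) ≤ ℓ²/2. The
-- ratio n/8 is the one `quadratic-bound` asks for.
dense-star-ratio : ∀ {n ℓ σ D} → suc (32 * D) ≤ n * n → σ ≤ D → σ ≤ choose₂ ℓ → 8 * σ ≤ n * ℓ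
dense-star-ratio {n} {ℓ} {σ} {D} h₀ h₁ h₂ with ℕₚ.≤-total n (4 * ℓ)
... | inj₁ n≤4ℓ = ℕₚ.*-cancelˡ-≤ 4 (linear 1 (h₀ ⊕ 32 ⊛ h₁ ⊕ n ⊛ n≤4ℓ) (solve (n ∷ ℓ ∷ σ ∷ D ∷ [])))
... | inj₂ 4ℓ≤n = go (choose₂ ℓ) h₂ (≤-reflexive (double-choose₂ ℓ))
  where
  go : ∀ c → σ ≤ c → 2 * c + ℓ ≤ ℓ * ℓ → 8 * σ ≤ n * ℓ
  go c h₂ h₃ = linear (4 * ℓ) (8 ⊛ h₂ ⊕ 4 ⊛ h₃ ⊕ ℓ ⊛ 4ℓ≤n) (solve (n ∷ ℓ ∷ σ ∷ c ∷ []))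

-- Here 8 C(ℓ, 2) = ℓ (4ℓ - 4), so leaf numbers up to n/4 + 1 give the same ratio without any degree
-- bound.
small-star-ratio : ∀ {n ℓ ℓ₁ σ} → 4 * ℓ₁ ≤ n + 4 → ℓ ≤ ℓ₁ → σ ≤ choose₂ ℓ → 8 * σ ≤ n * ℓ
small-star-ratio {n} {ℓ} {ℓ₁} {σ} h₀ h₁ h₂ = go (choose₂ ℓ) h₂ (≤-reflexive (double-choose₂ ℓ))
  where
  go : ∀ c → σ ≤ c → 2 * c + ℓ ≤ ℓ * ℓ → 8 * σ ≤ n * ℓ
  go c h₂ h₃ = linear 0 (8 ⊛ h₂ ⊕ 4 ⊛ h₃ ⊕ ℓ ⊛ h₀ ⊕ (4 * ℓ) ⊛ h₁) (solve (n ∷ ℓ ∷ ℓ₁ ∷ σ ∷ c ∷ []))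

capped-star-ratio : ∀ {p ℓ σ} → ℓ ≤ suc p → σ ≤ choose₂ ℓ → 2 * σ ≤ p * ℓ
capped-star-ratio {p} {ℓ} {σ} h₁ h₂ = go (choose₂ ℓ) h₂ (≤-reflexive (double-choose₂ ℓ))
  where
  go : ∀ c → σ ≤ c → 2 * c + ℓ ≤ ℓ * ℓ → 2 * σ ≤ p * ℓ
  go c h₂ h₃ = linear 0 (2 ⊛ h₂ ⊕ h₃ ⊕ ℓ ⊛ h₁) (solve (p ∷ ℓ ∷ σ ∷ c ∷ []))

-- Leaf capacity of stars and distribution of vertices over them

choose₂-+ : ∀ a b → choose₂ (a + b) ≡ choose₂ a + b * a + choose₂ b
choose₂-+ zero b = sym (cong (_+ choose₂ b) (ℕₚ.*-zeroʳ b))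
choose₂-+ (suc a) b = trans (cong ((a + b) +_) (choose₂-+ a b)) (shuffle a b (choose₂ a) (choose₂ b))
  where
  shuffle : ∀ a b c d → (a + b) + (c + b * a + d) ≡ (a + c) + b * suc a + d
  shuffle a b c d = solve (a ∷ b ∷ c ∷ d ∷ [])

choose₂-mono : ∀ {a b} → a ≤ b → choose₂ a ≤ choose₂ b
choose₂-mono z≤n = z≤n
choose₂-mono (s≤s h) = h ⊕ choose₂-mono h

-- With B = Δ - 1, c is the largest number of leaves of a complete star that stays below the maximum
-- degree.
capacity : ∀ B → ∃[ c ] (choose₂ c ≤ B × B < choose₂ (suc c))
capacity zero = 1 , z≤n , s≤s z≤n
capacity (suc B) with capacity B
... | c , low , high with choose₂ (suc c) ℕ.≤? suc B
...   | yes h = suc c , h , ≤-trans (s≤s high) (s≤s (m≤n+m (choose₂ (suc c)) c))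
...   | no h = c , ≤-trans low (ℕₚ.n≤1+n B) , ≰⇒> h

-- If n ≥ 4(c + 1), then n² ≥ 16(c + 1)² > 16c(c + 1) = 32 C(c + 1, 2) ≥ 32D. So four stars with c
-- leaves, centers included, have more than n vertices.
capacity-large : ∀ {n D c} → n * n ≤ 32 * D → D ≤ choose₂ (suc c) → n ≤ 4 * c + 3
capacity-large {n} {D} {c} h₁ h₂ with n ℕ.≤? 4 * c + 3
... | yes h = h
... | no h with ℕₚ.m≤n⇒∃[o]m+o≡n (≰⇒> h)
...   | e , refl = ⊥-elim (go (choose₂ c) h₂ (≤-reflexive (double-choose₂ c)) h₁)
  where
  go : ∀ x → D ≤ c + x → 2 * x + c ≤ c * c → (suc (4 * c + 3) + e) * (suc (4 * c + 3) + e) ≤ 32 * D → ⊥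
  go x g₁ g₂ g₃ = 1≰0 (linear (15 + 16 * c + 8 * (c * e) + 8 * e + e * e) (g₃ ⊕ 32 ⊛ g₁ ⊕ 16 ⊛ g₂) (solve (c ∷ e ∷ x ∷ D ∷ [])))

split-sum : ∀ {r} a b → r ≤ a + b → ∃[ x ] ∃[ y ] (x ≤ a × y ≤ b × x + y ≡ r)
split-sum {r} a b h with ℕₚ.≤-total r a
... | inj₁ r≤a = r , 0 , r≤a , z≤n , ℕₚ.+-identityʳ r
... | inj₂ a≤r with ℕₚ.m≤n⇒∃[o]m+o≡n a≤r
...   | y , refl = a , y , ≤-refl , ℕₚ.+-cancelˡ-≤ a y b h , refl

split-sum₃ : ∀ {r a b c} → r ≤ a + (b + c) →
  ∃[ x₁ ] ∃[ x₂ ] ∃[ x₃ ] (x₁ ≤ a × x₂ ≤ b × x₃ ≤ c × x₁ + (x₂ + x₃) ≡ r)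
split-sum₃ {r} {a} {b} {c} h with split-sum {r} a (b + c) h
... | x₁ , y , b₁ , y≤ , eq with split-sum {y} b c y≤
...   | x₂ , x₃ , b₂ , b₃ , eq′ = x₁ , x₂ , x₃ , b₁ , b₂ , b₃ , trans (cong (x₁ +_) eq′) eq

split-sum₄ : ∀ {r a b c d} → r ≤ a + b + (c + d) →
  ∃[ x₁ ] ∃[ x₂ ] ∃[ x₃ ] ∃[ x₄ ] (x₁ ≤ a × x₂ ≤ b × x₃ ≤ c × x₄ ≤ d × x₁ + x₂ + (x₃ + x₄) ≡ r)
split-sum₄ {r} {a} {b} {c} {d} h with split-sum {r} (a + b) (c + d) h
... | y , z , y≤ , z≤ , eq with split-sum {y} a b y≤ | split-sum {z} c d z≤
...   | x₁ , x₂ , b₁ , b₂ , eq₁ | x₃ , x₄ , b₃ , b₄ , eq₂ =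
  x₁ , x₂ , x₃ , x₄ , b₁ , b₂ , b₃ , b₄ , trans (cong₂ _+_ eq₁ eq₂) eq

-- Enlarging a star of ℓ leaves and σ edges to ℓ + x ≤ c leaves gains x ℓ + C(x, 2)
-- edges; for x = 0 one edge may be lost to stay below the maximum degree.
enlarge : ∀ {B c ℓ σ x} → choose₂ c ≤ B → σ ≤ choose₂ ℓ → σ ≤ suc B → x ≤ c ∸ ℓ →
  ∃[ τ ] (τ ≤ choose₂ (ℓ + x) × τ ≤ B × σ + (x * ℓ + choose₂ x) ≤ suc τ)
enlarge {ℓ = ℓ} {σ = zero} {zero} _ _ _ _ = 0 , z≤n , z≤n , z≤n
enlarge {ℓ = ℓ} {σ = suc σ} {zero} _ h₁ (s≤s h₂) _ =
  σ , ≤-trans (≤-trans (ℕₚ.n≤1+n σ) h₁) (≤-reflexive (cong choose₂ (sym (ℕₚ.+-identityʳ ℓ)))) , h₂ ,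
  ≤-reflexive (ℕₚ.+-identityʳ (suc σ))
enlarge {B} {c} {ℓ} {σ} {suc x} h₀ h₁ _ h₃ = choose₂ (ℓ + suc x) , ≤-refl , ≤-trans (choose₂-mono ℓ+x≤c) h₀ ,
  ≤-trans (ℕₚ.+-monoˡ-≤ _ h₁) (≤-trans (≤-reflexive (sym (trans (choose₂-+ ℓ (suc x)) (+-assoc (choose₂ ℓ) _ _)))) (ℕₚ.n≤1+n _))
  where
  ℓ≤c : ℓ ≤ c
  ℓ≤c with ℕₚ.≤-total ℓ c
  ... | inj₁ h = h
  ... | inj₂ h = ⊥-elim (1≰0 (≤-trans (s≤s z≤n) (≤-trans h₃ (≤-reflexive (ℕₚ.m≤n⇒m∸n≡0 h)))))
  ℓ+x≤c : ℓ + suc x ≤ c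
  ℓ+x≤c = ≤-trans (ℕₚ.+-monoʳ-≤ ℓ h₃) (≤-reflexive (ℕₚ.m+[n∸m]≡n ℓ≤c))

-- Exchange inequalities for the four largest stars

square≤ : ∀ x → x * x ≤ 2 * choose₂ x + x
square≤ x = ≤-reflexive (sym (double-choose₂ x))

-- W counts the edges outside four stars with ℓ₁, …, ℓ₄ leaves; distributing the
-- remaining vertices over these stars must not pay off by more than 3 edges.
GainBound : (n c ℓ₁ ℓ₂ ℓ₃ ℓ₄ W : ℕ) → Set
GainBound n c ℓ₁ ℓ₂ ℓ₃ ℓ₄ W = ∀ x₁ x₂ x₃ x₄ → x₁ ≤ c ∸ ℓ₁ → x₂ ≤ c ∸ ℓ₂ → x₃ ≤ c ∸ ℓ₃ → x₄ ≤ c ∸ ℓ₄ →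
  (ℓ₁ + x₁) + (ℓ₂ + x₂) + (ℓ₃ + x₃) + (ℓ₄ + x₄) + 4 ≤ n →
  (x₁ * ℓ₁ + choose₂ x₁) + (x₂ * ℓ₂ + choose₂ x₂) + (x₃ * ℓ₃ + choose₂ x₃) + (x₄ * ℓ₄ + choose₂ x₄) ≤ W + 3

-- If u vertices are distributed, each gains at least 8 + q, and the terms C(xᵢ, 2) add at least
-- u²/8 - u/2 by Cauchy-Schwarz, which is what the six instances of `2xy≤x²+y²` amount to.
four-way-gain : ∀ {q ℓ₁ ℓ₂ ℓ₃ W d₁ d₂ d₃ d₄} x₁ x₂ x₃ x₄ → 8 + q ≤ ℓ₁ → 8 + q ≤ ℓ₂ → 8 + q ≤ ℓ₃ →
  x₁ * x₁ ≤ 2 * d₁ + x₁ → x₂ * x₂ ≤ 2 * d₂ + x₂ → x₃ * x₃ ≤ 2 * d₃ + x₃ → x₄ * x₄ ≤ 2 * d₄ + x₄ →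
  (x₁ * ℓ₁ + d₁) + (x₂ * ℓ₂ + d₂) + (x₃ * ℓ₃ + d₃) + (x₄ * (8 + q) + d₄) ≤ W + 3 →
  8 * ((8 + q) * (x₁ + x₂ + (x₃ + x₄))) + (x₁ + x₂ + (x₃ + x₄)) * (x₁ + x₂ + (x₃ + x₄)) ≤ 8 * W + 24 + 4 * (x₁ + x₂ + (x₃ + x₄))
four-way-gain {q} {ℓ₁} {ℓ₂} {ℓ₃} {W} {d₁} {d₂} {d₃} {d₄} x₁ x₂ x₃ x₄ h₁ h₂ h₃ s₁ s₂ s₃ s₄ g =
  linear 0 (8 ⊛ g ⊕ 4 ⊛ s₁ ⊕ 4 ⊛ s₂ ⊕ 4 ⊛ s₃ ⊕ 4 ⊛ s₄ ⊕ (8 * x₁) ⊛ h₁ ⊕ (8 * x₂) ⊛ h₂ ⊕ (8 * x₃) ⊛ h₃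
      ⊕ 2xy≤x²+y² x₁ x₂ ⊕ 2xy≤x²+y² x₁ x₃ ⊕ 2xy≤x²+y² x₁ x₄ ⊕ 2xy≤x²+y² x₂ x₃ ⊕ 2xy≤x²+y² x₂ x₄ ⊕ 2xy≤x²+y² x₃ x₄)
    (solve (q ∷ ℓ₁ ∷ ℓ₂ ∷ ℓ₃ ∷ W ∷ d₁ ∷ d₂ ∷ d₃ ∷ d₄ ∷ x₁ ∷ x₂ ∷ x₃ ∷ x₄ ∷ []))

-- The inequality forces s = t = L = 0, hence R = 0 and k ≤ 6.
few-others : ∀ s t L k {q R} → 88 * s + 60 * t + 32 * L + 4 * k ≤ 24 → 2 * R ≤ (7 + q) * L → s * (t + 4) + R + 7 * k ≤ 144
few-others (suc s) t L k h _ = ⊥-elim (1≰0 (linear (63 + 88 * s + 60 * t + 32 * L + 4 * k) h (solve (s ∷ t ∷ L ∷ k ∷ []))))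
few-others zero t (suc L) k h _ = ⊥-elim (1≰0 (linear (7 + 60 * t + 32 * L + 4 * k) h (solve (t ∷ L ∷ k ∷ []))))
few-others zero t zero k {q} {R} h h′ = linear (96 + 120 * t + k + R) (2 ⊛ h ⊕ h′) (solve (t ∷ k ∷ q ∷ R ∷ []))

-- All u = 2s + t + L + k outside vertices are distributed, and everything is counted eightfold. The
-- gain is at least (60 + 8q) u + u²; on the other side u² absorbs 8st, a deleted vertex accounts
-- for 56, a leaf of a further star for 4(7 + q), a twin pair for 32 besides, and the error is 24.
-- The margin 60 - 56 comes from the 8 leaves of the fourth star.
four-stars : ∀ s t L k {n c ℓ₁ ℓ₂ ℓ₃ q R} → 8 + q ≤ ℓ₁ → 8 + q ≤ ℓ₂ → 8 + q ≤ ℓ₃ → n ≤ 4 * c + 3 →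
  ℓ₁ + ℓ₂ + ℓ₃ + (8 + q) + 4 + (2 * s + t + L + k) ≤ n → 2 * R ≤ (7 + q) * L →
  GainBound n c ℓ₁ ℓ₂ ℓ₃ (8 + q) (s * (t + 4) + R + 7 * k) → s * (t + 4) + R + 7 * k ≤ 144
four-stars s t L k {n} {c} {ℓ₁} {ℓ₂} {ℓ₃} {q} {R} h₁ h₂ h₃ hc hn hR gain =
  spread (split-sum₄ (room (ℕₚ.m≤n+m∸n c ℓ₁) (ℕₚ.m≤n+m∸n c ℓ₂) (ℕₚ.m≤n+m∸n c ℓ₃) (ℕₚ.m≤n+m∸n c (8 + q))))
  where
  room : ∀ {c₁ c₂ c₃ c₄} → c ≤ ℓ₁ + c₁ → c ≤ ℓ₂ + c₂ → c ≤ ℓ₃ + c₃ → c ≤ 8 + q + c₄ →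
         2 * s + t + L + k ≤ c₁ + c₂ + (c₃ + c₄)
  room {c₁} {c₂} {c₃} {c₄} r₁ r₂ r₃ r₄ = linear 1 (hn ⊕ hc ⊕ r₁ ⊕ r₂ ⊕ r₃ ⊕ r₄)
    (solve (s ∷ t ∷ L ∷ k ∷ n ∷ c ∷ ℓ₁ ∷ ℓ₂ ∷ ℓ₃ ∷ q ∷ c₁ ∷ c₂ ∷ c₃ ∷ c₄ ∷ []))
  fits : ∀ x₁ x₂ x₃ x₄ → x₁ + x₂ + (x₃ + x₄) ≤ 2 * s + t + L + k →
         (ℓ₁ + x₁) + (ℓ₂ + x₂) + (ℓ₃ + x₃) + (8 + q + x₄) + 4 ≤ n
  fits x₁ x₂ x₃ x₄ h = linear 0 (hn ⊕ h) (solve (s ∷ t ∷ L ∷ k ∷ n ∷ ℓ₁ ∷ ℓ₂ ∷ ℓ₃ ∷ q ∷ x₁ ∷ x₂ ∷ x₃ ∷ x₄ ∷ []))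
  final : 8 * ((8 + q) * (2 * s + t + L + k)) + (2 * s + t + L + k) * (2 * s + t + L + k)
            ≤ 8 * (s * (t + 4) + R + 7 * k) + 24 + 4 * (2 * s + t + L + k) →
          88 * s + 60 * t + 32 * L + 4 * k ≤ 24
  final h = linear (L * L + 2 * (L * k) + 4 * (L * q) + 4 * (L * s) + 2 * (L * t) + k * k + 8 * (k * q)
                      + 4 * (k * s) + 2 * (k * t) + 16 * (q * s) + 8 * (q * t))
    (h ⊕ 4 ⊛ hR ⊕ 2xy≤x²+y² (2 * s) t) (solve (s ∷ t ∷ L ∷ k ∷ q ∷ R ∷ []))
  conclude : ∀ x₁ x₂ x₃ x₄ → x₁ ≤ c ∸ ℓ₁ → x₂ ≤ c ∸ ℓ₂ → x₃ ≤ c ∸ ℓ₃ → x₄ ≤ c ∸ (8 + q) →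
             x₁ + x₂ + (x₃ + x₄) ≡ 2 * s + t + L + k → s * (t + 4) + R + 7 * k ≤ 144
  conclude x₁ x₂ x₃ x₄ b₁ b₂ b₃ b₄ eq = few-others s t L k {q} (final
    (subst (λ u → 8 * ((8 + q) * u) + u * u ≤ 8 * (s * (t + 4) + R + 7 * k) + 24 + 4 * u) eq
      (four-way-gain x₁ x₂ x₃ x₄ h₁ h₂ h₃ (square≤ x₁) (square≤ x₂) (square≤ x₃) (square≤ x₄)
        (gain x₁ x₂ x₃ x₄ b₁ b₂ b₃ b₄ (fits x₁ x₂ x₃ x₄ (≤-reflexive eq)))))) hR
  spread : (∃[ x₁ ] ∃[ x₂ ] ∃[ x₃ ] ∃[ x₄ ] (x₁ ≤ c ∸ ℓ₁ × x₂ ≤ c ∸ ℓ₂ × x₃ ≤ c ∸ ℓ₃ × x₄ ≤ c ∸ (8 + q) ×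
             x₁ + x₂ + (x₃ + x₄) ≡ 2 * s + t + L + k)) → s * (t + 4) + R + 7 * k ≤ 144
  spread (x₁ , x₂ , x₃ , x₄ , b₁ , b₂ , b₃ , b₄ , eq) = conclude x₁ x₂ x₃ x₄ b₁ b₂ b₃ b₄ eq

rest-small : ∀ s t k → 2 * s + t + k ≤ 28 → s * (t + 4) + 7 * k ≤ 7 * (2 * s + t + k)
rest-small s t k h = ℕₚ.*-cancelˡ-≤ 8 (linear (2 * (k * s) + k * t + 24 * s + 28 * t)
  (2xy≤x²+y² (2 * s) t ⊕ (2 * s + t) ⊛ h) (solve (s ∷ t ∷ k ∷ [])))

rest-large : ∀ s t k → 8 * (s * (t + 4) + 7 * k) ≤ (2 * s + t + k) * (2 * s + t + k) + 56 * (2 * s + t + k)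
rest-large s t k = linear (k * k + 4 * (k * s) + 2 * (k * t) + 80 * s + 56 * t)
  (2xy≤x²+y² (2 * s) t) (solve (s ∷ t ∷ k ∷ []))

-- All the remaining vertices fit into one new star, which would be too large.
one-new-star : ∀ {W d} v → 18 ≤ v → (v + 3 ≤ 28 → W ≤ 7 * (v + 3)) → 8 * W ≤ (v + 3) * (v + 3) + 56 * (v + 3) →
               v * v ≤ 2 * d + v → d ≤ W + 3 → ⊥
one-new-star {W} {d} v h₁ h₂ h₃ h₄ h₅ = [ small , big ]′ (ℕₚ.≤-<-connex (v + 3) 28)
  where
  small : v + 3 ≤ 28 → ⊥
  small h = 1≰0 (linear 23 (8 ⊛ h₅ ⊕ 8 ⊛ h₂ h ⊕ 4 ⊛ h₄ ⊕ (4 * v + 12) ⊛ h₁) (solve (W ∷ d ∷ v ∷ [])))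
  big : 28 < v + 3 → ⊥
  big h = 1≰0 (linear 110 (8 ⊛ h₅ ⊕ h₃ ⊕ 4 ⊛ h₄ ⊕ (3 * v + 12) ⊛ ℕₚ.+-cancelʳ-≤ 3 26 v h) (solve (W ∷ d ∷ v ∷ [])))

-- One new star has c leaves, the other remaining vertices join the three
-- existing stars; below w is 56.
full-new-star : ∀ {n c ℓ₁ ℓ₂ ℓ₃ W d₁ d₂ d₃ d} w x₁ x₂ x₃ → 8 ≤ w → 4 * w ≤ c → n + 5 ≤ 4 * ℓ₁ →
  ℓ₁ + ℓ₂ + ℓ₃ + 1 + (c + (x₁ + (x₂ + x₃)) + 3) ≤ n →
  8 * W ≤ (c + (x₁ + (x₂ + x₃)) + 3) * (c + (x₁ + (x₂ + x₃)) + 3) + w * (c + (x₁ + (x₂ + x₃)) + 3) →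
  x₂ * x₂ ≤ 2 * d₂ + x₂ → x₃ * x₃ ≤ 2 * d₃ + x₃ → c * c ≤ 2 * d + c →
  (x₁ * ℓ₁ + d₁) + (x₂ * ℓ₂ + d₂) + (x₃ * ℓ₃ + d₃) + (c * 0 + d) ≤ W + 3 → ⊥
full-new-star {n} {c} {ℓ₁} {ℓ₂} {ℓ₃} {W} {d₁} {d₂} {d₃} {d} w x₁ x₂ x₃ hw hc h₂ hn hW s₂ s₃ s g = 1≰0 (linear
  (301 + 4 * c + 48 * d₁ + 16 * (ℓ₂ * x₁) + 48 * (ℓ₂ * x₂) + 16 * (ℓ₃ * x₁) + 48 * (ℓ₃ * x₃) + 6 * w + 14 * (w * w)
    + 10 * (w * x₁) + 108 * x₁ + 10 * (x₁ * x₁) + 4 * (x₁ * x₂) + 4 * (x₁ * x₃))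
  (48 ⊛ g ⊕ 6 ⊛ hW ⊕ (16 * x₁) ⊛ h₂ ⊕ (16 * x₁) ⊛ hn ⊕ 24 ⊛ s₂ ⊕ 24 ⊛ s₃ ⊕ 24 ⊛ s ⊕ 12 ⊛ 2xy≤x²+y² x₂ x₃
    ⊕ 3 ⊛ 2xy≤x²+y² (2 * c) (x₂ + x₃) ⊕ 3 ⊛ 2xy≤x²+y² (w + 10) (x₂ + x₃)
    ⊕ (6 * c + 4 * x₁ + 10 * w) ⊛ hc ⊕ (8 * c + 23 * w + 100) ⊛ hw)
  (solve (n ∷ c ∷ ℓ₁ ∷ ℓ₂ ∷ ℓ₃ ∷ W ∷ d₁ ∷ d₂ ∷ d₃ ∷ d ∷ w ∷ x₁ ∷ x₂ ∷ x₃ ∷ [])))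

-- The vertices available as leaves exceed what one new star may hold. With u = c + r + 3 the
-- hypotheses give 3ℓ₁ > u, so each vertex joining the first star gains more than u/3. The new star
-- and the additions to the second and third star gain about (c² + x₂² + x₃²)/2. Together this beats
-- u²/8, and for c ≥ 4 * 56 the surplus also covers the linear term 56u.
overflow : ∀ {n c ℓ₁ ℓ₂ ℓ₃ W} r → 224 ≤ c → n ≤ 4 * c + 3 → n + 5 ≤ 4 * ℓ₁ → ℓ₁ + ℓ₂ + ℓ₃ + 1 + (c + r + 3) ≤ n →
  8 * W ≤ (c + r + 3) * (c + r + 3) + 56 * (c + r + 3) → GainBound n c ℓ₁ ℓ₂ ℓ₃ 0 W → ⊥
overflow {n} {c} {ℓ₁} {ℓ₂} {ℓ₃} {W} r hc hn4 h₂ hn hW gain =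
  spread (split-sum₃ (room (ℕₚ.m≤n+m∸n c ℓ₁) (ℕₚ.m≤n+m∸n c ℓ₂) (ℕₚ.m≤n+m∸n c ℓ₃)))
  where
  room : ∀ {c₁ c₂ c₃} → c ≤ ℓ₁ + c₁ → c ≤ ℓ₂ + c₂ → c ≤ ℓ₃ + c₃ → r ≤ c₁ + (c₂ + c₃)
  room {c₁} {c₂} {c₃} r₁ r₂ r₃ = linear 1 (hn ⊕ hn4 ⊕ r₁ ⊕ r₂ ⊕ r₃)
    (solve (r ∷ n ∷ c ∷ ℓ₁ ∷ ℓ₂ ∷ ℓ₃ ∷ c₁ ∷ c₂ ∷ c₃ ∷ []))
  fits : ∀ x₁ x₂ x₃ → x₁ + (x₂ + x₃) ≤ r → (ℓ₁ + x₁) + (ℓ₂ + x₂) + (ℓ₃ + x₃) + (0 + c) + 4 ≤ n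
  fits x₁ x₂ x₃ h = linear 0 (hn ⊕ h) (solve (r ∷ n ∷ c ∷ ℓ₁ ∷ ℓ₂ ∷ ℓ₃ ∷ x₁ ∷ x₂ ∷ x₃ ∷ []))
  spread : (∃[ x₁ ] ∃[ x₂ ] ∃[ x₃ ] (x₁ ≤ c ∸ ℓ₁ × x₂ ≤ c ∸ ℓ₂ × x₃ ≤ c ∸ ℓ₃ × x₁ + (x₂ + x₃) ≡ r)) → ⊥
  spread (x₁ , x₂ , x₃ , b₁ , b₂ , b₃ , eq) =
    full-new-star {ℓ₂ = ℓ₂} {ℓ₃} {W} {choose₂ x₁} 56 x₁ x₂ x₃ (ℕₚ.m≤m+n 8 48) hc h₂
      (subst (λ r → ℓ₁ + ℓ₂ + ℓ₃ + 1 + (c + r + 3) ≤ n) (sym eq) hn)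
      (subst (λ r → 8 * W ≤ (c + r + 3) * (c + r + 3) + 56 * (c + r + 3)) (sym eq) hW)
      (square≤ x₂) (square≤ x₃) (square≤ c)
      (gain x₁ x₂ x₃ c b₁ b₂ b₃ ≤-refl (fits x₁ x₂ x₃ (≤-reflexive eq)))

-- The case where a fourth star is missing or empty. Only one center is certain to exist, so three
-- of the u = 2s + t + k outside vertices are reserved as centers of the comparison forest: this is
-- the 3 in `v + 3`.
three-stars : ∀ s t k {n c ℓ₁ ℓ₂ ℓ₃} → 224 ≤ c → n ≤ 4 * c + 3 → n + 5 ≤ 4 * ℓ₁ →
  ℓ₁ + ℓ₂ + ℓ₃ + 1 + (2 * s + t + k) ≤ n →
  GainBound n c ℓ₁ ℓ₂ ℓ₃ 0 (s * (t + 4) + 7 * k) → s * (t + 4) + 7 * k ≤ 144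
three-stars s t k {n} {c} {ℓ₁} {ℓ₂} {ℓ₃} hc hn4 h₂ hn gain =
  go (s * (t + 4) + 7 * k) (2 * s + t + k) hn (rest-small s t k) (rest-large s t k) gain
  where
  small-fits : ∀ v → ℓ₁ + ℓ₂ + ℓ₃ + 1 + (v + 3) ≤ n → (ℓ₁ + 0) + (ℓ₂ + 0) + (ℓ₃ + 0) + (0 + v) + 4 ≤ n
  small-fits v h = linear 0 h (solve (n ∷ ℓ₁ ∷ ℓ₂ ∷ ℓ₃ ∷ v ∷ []))
  Large : ℕ → ℕ → Set
  Large W u = 8 * W ≤ u * u + 56 * u
  large : ∀ W v → 18 ≤ v → ℓ₁ + ℓ₂ + ℓ₃ + 1 + (v + 3) ≤ n → (v + 3 ≤ 28 → W ≤ 7 * (v + 3)) →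
          Large W (v + 3) → GainBound n c ℓ₁ ℓ₂ ℓ₃ 0 W → ⊥
  large W v hv hn hs hl gain = [ fitting , overflowing ]′ (ℕₚ.≤-<-connex v c)
    where
    fitting : v ≤ c → ⊥
    fitting v≤c = one-new-star v hv hs hl (square≤ v)
      (≤-trans (m≤n+m (choose₂ v) (v * 0)) (gain 0 0 0 v z≤n z≤n z≤n v≤c (small-fits v hn)))
    overflowing : c < v → ⊥
    overflowing c<v = overflow {W = W} (v ∸ c) hc hn4 h₂ (subst (λ v → ℓ₁ + ℓ₂ + ℓ₃ + 1 + (v + 3) ≤ n) eq hn)
      (subst (λ v → Large W (v + 3)) eq hl) gain
      where
      eq : v ≡ c + (v ∸ c)
      eq = sym (ℕₚ.m+[n∸m]≡n (ℕₚ.<⇒≤ c<v))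
  go : ∀ W u → ℓ₁ + ℓ₂ + ℓ₃ + 1 + u ≤ n → (u ≤ 28 → W ≤ 7 * u) → Large W u → GainBound n c ℓ₁ ℓ₂ ℓ₃ 0 W → W ≤ 144
  -- For u ≥ 21 there remain v ≥ 18 vertices besides the reserved centers, and 18 is the least v
  -- with C(v, 2) > 7(v + 3) + 3.
  go W u hn hs hl gain = [ few , many ]′ (ℕₚ.≤-<-connex u 20)
    where
    few : u ≤ 20 → W ≤ 144
    few h = ≤-trans (hs (≤-trans h (ℕₚ.m≤m+n 20 8))) (≤-trans (7 ⊛ h) (ℕₚ.m≤m+n 140 4))
    many : 20 < u → W ≤ 144
    many h = ⊥-elim (large W (u ∸ 3) (ℕₚ.∸-monoˡ-≤ 3 h) (subst (λ u → ℓ₁ + ℓ₂ + ℓ₃ + 1 + u ≤ n) eq hn)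
      (subst (λ u → u ≤ 28 → W ≤ 7 * u) eq hs) (subst (Large W) eq hl) gain)
      where
      eq : u ≡ u ∸ 3 + 3
      eq = sym (ℕₚ.m∸n+n≡m (≤-trans (ℕₚ.m≤m+n 3 18) h))

-- In a comparison forest the leaves may have degrees up to n, and these have to stay below Δ as
-- well.
below-degree : ∀ {n B} → 900 ≤ n → n * n ≤ 32 * suc B → n ≤ B
below-degree {n} {B} h₀ h = ℕₚ.*-cancelˡ-≤ 32 (linear (868 + 867 * n) (h ⊕ (n + 1) ⊛ h₀) (solve (n ∷ B ∷ [])))

capacity-224 : ∀ {n c} → 900 ≤ n → n ≤ 4 * c + 3 → 224 ≤ c
capacity-224 {n} {c} h₀ h = ℕₚ.*-cancelˡ-≤ 4 (linear 1 (h₀ ⊕ h) (solve (n ∷ c ∷ [])))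

-- Four stars may lose an edge each, but the forest falls short of m by at least one: 4 - 1 = 3.
total-gain : ∀ {m σ₁ σ₂ σ₃ σ₄ τ₁ τ₂ τ₃ τ₄ g₁ g₂ g₃ g₄ W} → m ≤ σ₁ + σ₂ + σ₃ + σ₄ + W →
  σ₁ + g₁ ≤ suc τ₁ → σ₂ + g₂ ≤ suc τ₂ → σ₃ + g₃ ≤ suc τ₃ → σ₄ + g₄ ≤ suc τ₄ →
  suc (τ₁ + (τ₂ + (τ₃ + (τ₄ + 0)))) ≤ m → g₁ + g₂ + g₃ + g₄ ≤ W + 3
total-gain {m} {σ₁} {σ₂} {σ₃} {σ₄} {τ₁} {τ₂} {τ₃} {τ₄} {g₁} {g₂} {g₃} {g₄} {W} h h₁ h₂ h₃ h₄ h₅ =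
  linear 0 (h ⊕ h₁ ⊕ h₂ ⊕ h₃ ⊕ h₄ ⊕ h₅)
    (solve (m ∷ σ₁ ∷ σ₂ ∷ σ₃ ∷ σ₄ ∷ τ₁ ∷ τ₂ ∷ τ₃ ∷ τ₄ ∷ g₁ ∷ g₂ ∷ g₃ ∷ g₄ ∷ W ∷ []))

four-centers : ∀ a b c d → suc a + (suc b + (suc c + (suc d + 0))) ≡ a + b + c + d + 4
four-centers a b c d = solve (a ∷ b ∷ c ∷ d ∷ [])

-- The counts of a decomposition with one, two, three or 4 + r centers, restated for
-- four stars, padded by empty ones.
outside-edges₁ : ∀ s k {m σ₁} → m ≤ s * 1 + (σ₁ + 0) + 7 * k → m ≤ σ₁ + 0 + 0 + 0 + (s * (0 + 4) + 7 * k)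
outside-edges₁ s k {m} {σ₁} h = linear (3 * s) h (solve (s ∷ k ∷ m ∷ σ₁ ∷ []))

outside-edges₂ : ∀ s k {m σ₁ σ₂} → m ≤ s * 2 + (σ₁ + (σ₂ + 0)) + 7 * k → m ≤ σ₁ + σ₂ + 0 + 0 + (s * (0 + 4) + 7 * k)
outside-edges₂ s k {m} {σ₁} {σ₂} h = linear (2 * s) h (solve (s ∷ k ∷ m ∷ σ₁ ∷ σ₂ ∷ []))

outside-edges₃ : ∀ s k {m σ₁ σ₂ σ₃} → m ≤ s * 3 + (σ₁ + (σ₂ + (σ₃ + 0))) + 7 * k →
                 m ≤ σ₁ + σ₂ + σ₃ + 0 + (s * (0 + 4) + 7 * k)
outside-edges₃ s k {m} {σ₁} {σ₂} {σ₃} h = linear s h (solve (s ∷ k ∷ m ∷ σ₁ ∷ σ₂ ∷ σ₃ ∷ []))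

outside-edges₄ : ∀ s r k {m σ₁ σ₂ σ₃ σ₄ R} → m ≤ s * (4 + r) + (σ₁ + (σ₂ + (σ₃ + (σ₄ + R)))) + 7 * k →
                 m ≤ σ₁ + σ₂ + σ₃ + σ₄ + (s * (r + 4) + R + 7 * k)
outside-edges₄ s r k {m} {σ₁} {σ₂} {σ₃} {σ₄} {R} h = linear 0 h (solve (s ∷ r ∷ k ∷ m ∷ σ₁ ∷ σ₂ ∷ σ₃ ∷ σ₄ ∷ R ∷ []))

outside-vertices₁ : ∀ s k {n ℓ₁} → n ≡ 2 * s + 1 + (ℓ₁ + 0) + k → ℓ₁ + 0 + 0 + 1 + (2 * s + 0 + k) ≤ n
outside-vertices₁ s k {ℓ₁ = ℓ₁} refl = ≤-reflexive (solve (s ∷ k ∷ ℓ₁ ∷ []))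

outside-vertices₂ : ∀ s k {n ℓ₁ ℓ₂} → n ≡ 2 * s + 2 + (ℓ₁ + (ℓ₂ + 0)) + k → ℓ₁ + ℓ₂ + 0 + 1 + (2 * s + 0 + k) ≤ n
outside-vertices₂ s k {ℓ₁ = ℓ₁} {ℓ₂} refl = linear 1 (≤-refl {0}) (solve (s ∷ k ∷ ℓ₁ ∷ ℓ₂ ∷ []))

outside-vertices₃ : ∀ s k {n ℓ₁ ℓ₂ ℓ₃} → n ≡ 2 * s + 3 + (ℓ₁ + (ℓ₂ + (ℓ₃ + 0))) + k → ℓ₁ + ℓ₂ + ℓ₃ + 1 + (2 * s + 0 + k) ≤ n
outside-vertices₃ s k {ℓ₁ = ℓ₁} {ℓ₂} {ℓ₃} refl = linear 2 (≤-refl {0}) (solve (s ∷ k ∷ ℓ₁ ∷ ℓ₂ ∷ ℓ₃ ∷ []))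

outside-vertices₄ : ∀ s r k {n ℓ₁ ℓ₂ ℓ₃ ℓ₄ L} → n ≡ 2 * s + (4 + r) + (ℓ₁ + (ℓ₂ + (ℓ₃ + (ℓ₄ + L)))) + k →
                    ℓ₁ + ℓ₂ + ℓ₃ + ℓ₄ + 4 + (2 * s + r + L + k) ≤ n
outside-vertices₄ s r k {ℓ₁ = ℓ₁} {ℓ₂} {ℓ₃} {ℓ₄} {L} refl = ≤-reflexive (solve (s ∷ r ∷ k ∷ ℓ₁ ∷ ℓ₂ ∷ ℓ₃ ∷ ℓ₄ ∷ L ∷ []))

outside-vertices₄′ : ∀ s r k {n ℓ₁ ℓ₂ ℓ₃ ℓ₄ L} → n ≡ 2 * s + (4 + r) + (ℓ₁ + (ℓ₂ + (ℓ₃ + (ℓ₄ + L)))) + k →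
                     ℓ₁ + ℓ₂ + ℓ₃ + 1 + (2 * s + r + k) ≤ n
outside-vertices₄′ s r k {ℓ₁ = ℓ₁} {ℓ₂} {ℓ₃} {ℓ₄} {L} refl = linear (3 + ℓ₄ + L) (≤-refl {0})
  (solve (s ∷ r ∷ k ∷ ℓ₁ ∷ ℓ₂ ∷ ℓ₃ ∷ ℓ₄ ∷ L ∷ []))

near₁ : ∀ {m σ₁ W} → m ≤ σ₁ + 0 + 0 + 0 + W → W ≤ 144 → m ≤ (σ₁ + 0) + 144
near₁ {m} {σ₁} {W} h₁ h₂ = linear 0 (h₁ ⊕ h₂) (solve (m ∷ σ₁ ∷ W ∷ []))

near₂ : ∀ {m σ₁ σ₂ W} → m ≤ σ₁ + σ₂ + 0 + 0 + W → W ≤ 144 → m ≤ (σ₁ + (σ₂ + 0)) + 144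
near₂ {m} {σ₁} {σ₂} {W} h₁ h₂ = linear 0 (h₁ ⊕ h₂) (solve (m ∷ σ₁ ∷ σ₂ ∷ W ∷ []))

near₃ : ∀ {m σ₁ σ₂ σ₃ W} → m ≤ σ₁ + σ₂ + σ₃ + 0 + W → W ≤ 144 → m ≤ (σ₁ + (σ₂ + (σ₃ + 0))) + 144
near₃ {m} {σ₁} {σ₂} {σ₃} {W} h₁ h₂ = linear 0 (h₁ ⊕ h₂) (solve (m ∷ σ₁ ∷ σ₂ ∷ σ₃ ∷ W ∷ []))

near₄ : ∀ {m σ₁ σ₂ σ₃ σ₄ W} → m ≤ σ₁ + σ₂ + σ₃ + σ₄ + W → W ≤ 144 → m ≤ (σ₁ + (σ₂ + (σ₃ + (σ₄ + 0)))) + 144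
near₄ {m} {σ₁} {σ₂} {σ₃} {σ₄} {W} h₁ h₂ = linear 0 (h₁ ⊕ h₂) (solve (m ∷ σ₁ ∷ σ₂ ∷ σ₃ ∷ σ₄ ∷ W ∷ []))

outside-edges₄′ : ∀ s r k {m σ₁ σ₂ σ₃ σ₄ R} → m ≤ s * (4 + r) + (σ₁ + (σ₂ + (σ₃ + (σ₄ + R)))) + 7 * k → R ≤ 0 →
                  m ≤ σ₁ + σ₂ + σ₃ + σ₄ + (s * (r + 4) + 7 * k)
outside-edges₄′ s r k {m} {σ₁} {σ₂} {σ₃} {σ₄} {R} h h′ =
  linear 0 (h ⊕ h′) (solve (s ∷ r ∷ k ∷ m ∷ σ₁ ∷ σ₂ ∷ σ₃ ∷ σ₄ ∷ R ∷ []))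

open import Defs
open import Data.Bool using (true; false)
open import Data.Fin as Fin using (Fin; zero; suc; #_)
open import Data.Fin.Properties as Finₚ using (any?; all?)
open import Data.Fin.Subset as Subset using (Subset; _∈_; _∉_; _∩_; _∪_; ∣_∣; ⁅_⁆)
open import Data.Fin.Subset.Properties as Subsetₚ using
  (_∈?_; x∈⁅x⁆; x∈⁅y⁆⇒x≡y; x∈p∪q⁺; x∈p∪q⁻; x∈p∩q⁺; x∈p∩q⁻; ∪-comm; ∪-assoc; ∪-idem; ⊆-antisym;
   Empty-unique; ∣⁅x⁆∣≡1; ∣⊥∣≡0)
open import Data.List as List using
  (List; []; _∷_; _++_; length; filter; map; concatMap; foldr; allFin; take; cartesianProduct;
   cartesianProductWith)
open import Data.List.Properties as Listₚ using (length-++; length-map; length-take)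
open import Data.List.Membership.Propositional using (find) renaming (_∈_ to _∈ₗ_; _∉_ to _∉ₗ_)
open import Data.List.Membership.Propositional.Properties using
  (∈-++⁺ˡ; ∈-++⁺ʳ; ∈-++⁻; ∈-map⁺; ∈-map⁻; ∈-filter⁺; ∈-filter⁻; ∈-∃++; ∈-allFin; ∈-lookup; ∈-concatMap⁺; ∈-concatMap⁻;
   ∈-cartesianProduct⁺; ∈-cartesianProduct⁻; ∈-cartesianProductWith⁺)
open import Data.List.Relation.Unary.All as All using (All; []; _∷_)
open import Data.List.Relation.Unary.Any as Any using (Any; here; there)
open import Data.List.Relation.Unary.AllPairs as AllPairs using ([]; _∷_)
open import Data.List.Relation.Unary.Unique.Propositional using (Unique)
import Data.List.Relation.Unary.Unique.Propositional.Properties as Uniqueₚ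
open import Data.List.Relation.Binary.Sublist.Propositional as Sublist using (_⊆_)
open import Data.Vec as Vec using (Vec; []; _∷_; lookup)
import Data.Vec.Properties as Vecₚ
open import Data.Vec.Relation.Unary.All as VAll using ([]; _∷_)
import Data.Vec.Relation.Unary.AllPairs as VAllPairs
open VAllPairs using ([]; _∷_)
open import Data.Vec.Relation.Unary.Unique.Propositional using () renaming (Unique to Distinct)
import Data.Vec.Relation.Unary.Unique.Propositional.Properties as Distinctₚ
open import Data.Bool.Properties using () renaming (_≟_ to _≟ᵇ_)
open import Relation.Nullary.Decidable using (_×-dec_; _→-dec_; ¬?; True; toWitness; _⊎-dec_)
open import Relation.Unary using (Decidable)
open import Function using (_∘_; id; case_of_)
import Data.Vec.Relation.Unary.All.Properties as VAllₚ
import Data.List.Relation.Binary.Sublist.Propositional.Properties as Sublistₚ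
open import Relation.Binary.Definitions using (tri<; tri≈; tri>)
open import Data.Nat.ListAction using (sum)
open import Data.List.Relation.Unary.Any.Properties using (lookup-index)
open import Data.List.Relation.Binary.Pointwise using (Pointwise-≡⇒≡)
import Data.List.Relation.Binary.Sublist.Heterogeneous.Properties as Hetero
open import Function.Bundles using (mk⤖)
open import Function.Properties.Bijection using (⤖⇒↔)
import Data.List.Relation.Binary.Permutation.Propositional as Perm
open Perm using (_↭_; ↭-refl; ↭-sym; ↭-trans; prep; swap)
import Data.List.Relation.Binary.Permutation.Propositional.Properties as Permₚ
import Data.List.Relation.Binary.Permutation.Setoid.Properties as PermSₚ
open import Data.Nat.ListAction.Properties using (sum-↭)
import Relation.Binary.PropositionalEquality as ≡
open import Data.Nat.Combinatorics using (_C_)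

-- Edges as three-element sets

tri : ∀ {n} → Fin n → Fin n → Fin n → Subset n
tri a b c = (⁅ a ⁆ ∪ ⁅ b ⁆) ∪ ⁅ c ⁆

module _ {n : ℕ} where

  ∈tri⁻ : ∀ {a b c v : Fin n} → v ∈ tri a b c → v ≡ a ⊎ v ≡ b ⊎ v ≡ c
  ∈tri⁻ {a} {b} {c} v∈ with x∈p∪q⁻ (⁅ a ⁆ ∪ ⁅ b ⁆) ⁅ c ⁆ v∈
  ... | inj₂ q = inj₂ (inj₂ (x∈⁅y⁆⇒x≡y c q))
  ... | inj₁ q with x∈p∪q⁻ ⁅ a ⁆ ⁅ b ⁆ q
  ...   | inj₁ r = inj₁ (x∈⁅y⁆⇒x≡y a r)
  ...   | inj₂ r = inj₂ (inj₁ (x∈⁅y⁆⇒x≡y b r))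

  ∈tri₁ : ∀ {a b c : Fin n} → a ∈ tri a b c
  ∈tri₁ = x∈p∪q⁺ (inj₁ (x∈p∪q⁺ (inj₁ (x∈⁅x⁆ _))))

  ∈tri₂ : ∀ {a b c : Fin n} → b ∈ tri a b c
  ∈tri₂ = x∈p∪q⁺ (inj₁ (x∈p∪q⁺ (inj₂ (x∈⁅x⁆ _))))

  ∈tri₃ : ∀ {a b c : Fin n} → c ∈ tri a b c
  ∈tri₃ = x∈p∪q⁺ (inj₂ (x∈⁅x⁆ _))

  tri-swap₁₂ : (a b c : Fin n) → tri a b c ≡ tri b a c
  tri-swap₁₂ a b c = cong (_∪ ⁅ c ⁆) (∪-comm ⁅ a ⁆ ⁅ b ⁆)

  tri-swap₂₃ : (a b c : Fin n) → tri a b c ≡ tri a c b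
  tri-swap₂₃ a b c = trans (∪-assoc ⁅ a ⁆ ⁅ b ⁆ ⁅ c ⁆)
    (trans (cong (⁅ a ⁆ ∪_) (∪-comm ⁅ b ⁆ ⁅ c ⁆)) (sym (∪-assoc ⁅ a ⁆ ⁅ c ⁆ ⁅ b ⁆)))

  tri-rotate : (a b c : Fin n) → tri a b c ≡ tri b c a
  tri-rotate a b c = trans (tri-swap₁₂ a b c) (tri-swap₂₃ b a c)

∣∪∣≤ : ∀ {n} (p q : Subset n) → ∣ p ∪ q ∣ ≤ ∣ p ∣ + ∣ q ∣
∣∪∣≤ [] [] = z≤n
∣∪∣≤ (true ∷ p) (true ∷ q) = s≤s (≤-trans (∣∪∣≤ p q) (ℕₚ.+-monoʳ-≤ ∣ p ∣ (ℕₚ.n≤1+n _)))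
∣∪∣≤ (true ∷ p) (false ∷ q) = s≤s (∣∪∣≤ p q)
∣∪∣≤ (false ∷ p) (true ∷ q) = ≤-trans (s≤s (∣∪∣≤ p q)) (≤-reflexive (sym (ℕₚ.+-suc ∣ p ∣ ∣ q ∣)))
∣∪∣≤ (false ∷ p) (false ∷ q) = ∣∪∣≤ p q

module _ {n : ℕ} where

  tri-repeat : (a c : Fin n) → ∣ tri a a c ∣ ≢ 3
  tri-repeat a c eq = <⇒≱ (ℕₚ.≤-reflexive (sym eq))
    (≤-trans (≤-reflexive (cong (λ s → ∣ s ∪ ⁅ c ⁆ ∣) (∪-idem ⁅ a ⁆)))
      (≤-trans (∣∪∣≤ ⁅ a ⁆ ⁅ c ⁆) (≤-reflexive (cong₂ _+_ (∣⁅x⁆∣≡1 a) (∣⁅x⁆∣≡1 c)))))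

  tri-distinct : {a b c : Fin n} → ∣ tri a b c ∣ ≡ 3 → a ≢ b × a ≢ c × b ≢ c
  tri-distinct {a} {b} {c} h =
      (λ { refl → tri-repeat a c h })
    , (λ { refl → tri-repeat a b (trans (cong ∣_∣ (tri-swap₂₃ a a b)) h) })
    , (λ { refl → tri-repeat b a (trans (cong ∣_∣ (sym (tri-rotate a b b))) h) })

card-zero : ∀ {n} {p : Subset n} → ∣ p ∣ ≡ 0 → p ≡ Subset.⊥
card-zero {p = []} _ = refl
card-zero {p = false ∷ p} h = cong (false ∷_) (card-zero h)

card-one : ∀ {n} {p : Subset n} → ∣ p ∣ ≡ 1 → ∃[ x ] p ≡ ⁅ x ⁆
card-one {p = true ∷ p} h = zero , cong (true ∷_) (card-zero (ℕₚ.suc-injective h))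
card-one {p = false ∷ p} h with card-one {p = p} h
... | x , eq = suc x , cong (false ∷_) eq

⊥∪ : ∀ {n} (p : Subset n) → Subset.⊥ ∪ p ≡ p
⊥∪ [] = refl
⊥∪ (x ∷ p) = cong (x ∷_) (⊥∪ p)

card-two : ∀ {n} {p : Subset n} → ∣ p ∣ ≡ 2 → ∃[ x ] ∃[ y ] p ≡ ⁅ x ⁆ ∪ ⁅ y ⁆
card-two {p = true ∷ p} h with card-one {p = p} (ℕₚ.suc-injective h)
... | y , eq = zero , suc y , cong (true ∷_) (trans eq (sym (⊥∪ ⁅ y ⁆)))
card-two {p = false ∷ p} h with card-two {p = p} h
... | x , y , eq = suc x , suc y , cong (false ∷_) eq

card-three : ∀ {n} {p : Subset n} → ∣ p ∣ ≡ 3 → ∃[ x ] ∃[ y ] ∃[ z ] p ≡ tri x y z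
card-three {p = true ∷ p} h with card-two {p = p} (ℕₚ.suc-injective h)
... | y , z , eq = zero , suc y , suc z ,
      cong (true ∷_) (trans eq (cong (_∪ ⁅ z ⁆) (sym (⊥∪ ⁅ y ⁆))))
card-three {p = false ∷ p} h with card-three {p = p} h
... | x , y , z , eq = suc x , suc y , suc z , cong (false ∷_) eq

module _ {n : ℕ} where

  ∩-one : {e f : Subset n} {x : Fin n} → x ∈ e → x ∈ f →
          (∀ {v} → v ∈ e → v ∈ f → v ≡ x) → ∣ e ∩ f ∣ ≡ 1
  ∩-one {e} {f} {x} xe xf uniq = trans (cong ∣_∣ (⊆-antisym
      (λ {v} v∈ → let a , b = x∈p∩q⁻ e f v∈ in subst (_∈ ⁅ x ⁆) (sym (uniq a b)) (x∈⁅x⁆ x))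
      (λ {v} v∈ → subst (_∈ e ∩ f) (sym (x∈⁅y⁆⇒x≡y x v∈)) (x∈p∩q⁺ (xe , xf)))))
    (∣⁅x⁆∣≡1 x)

  ∩-zero : {e f : Subset n} → (∀ {v} → v ∈ e → v ∈ f → ⊥) → ∣ e ∩ f ∣ ≡ 0
  ∩-zero {e} {f} disj = trans (cong ∣_∣ (Empty-unique
      (λ { (v , v∈) → let a , b = x∈p∩q⁻ e f v∈ in disj a b }))) (∣⊥∣≡0 n)

  ∩-one⁻ : {e f : Subset n} → ∣ e ∩ f ∣ ≡ 1 →
           ∃[ x ] (x ∈ e × x ∈ f × (∀ {v} → v ∈ e → v ∈ f → v ≡ x))
  ∩-one⁻ {e} {f} h with card-one {p = e ∩ f} h
  ... | x , eq = let a , b = x∈p∩q⁻ e f (subst (x ∈_) (sym eq) (x∈⁅x⁆ x)) in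
    x , a , b , λ ve vf → x∈⁅y⁆⇒x≡y x (subst (_ ∈_) eq (x∈p∩q⁺ (ve , vf)))

  ∩-zero⁻ : {e f : Subset n} → ∣ e ∩ f ∣ ≡ 0 → ∀ {v} → v ∈ e → v ∈ f → ⊥
  ∩-zero⁻ {e} {f} h ve vf =
    Subsetₚ.∉⊥ (subst (_ ∈_) (card-zero {p = e ∩ f} h) (x∈p∩q⁺ (ve , vf)))

  _≟ˢ_ : (e f : Subset n) → Dec (e ≡ f)
  _≟ˢ_ = Vecₚ.≡-dec _≟ᵇ_

  open import Data.List.Membership.DecPropositional (_≟ˢ_) public using () renaming (_∈?_ to _∈ₗ?_)

-- Lists without repetition

module _ {A : Set} where

  -- The counting tool throughout: a family is bounded by exhibiting a list that covers it.
  ∈-Unique-length : {xs ys : List A} → Unique xs → (∀ {x} → x ∈ₗ xs → x ∈ₗ ys) → length xs ≤ length ys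
  ∈-Unique-length {[]} _ _ = z≤n
  ∈-Unique-length {x ∷ xs} {ys} (x∉ ∷ u) sub with ∈-∃++ (sub (here refl))
  ... | ys₁ , ys₂ , refl = ≤-trans (s≤s (∈-Unique-length u sub′)) (≤-reflexive eq)
    where
    sub′ : ∀ {z} → z ∈ₗ xs → z ∈ₗ ys₁ ++ ys₂
    sub′ {z} z∈ with ∈-++⁻ ys₁ (sub (there z∈))
    ... | inj₁ p = ∈-++⁺ˡ p
    ... | inj₂ (here refl) = contradiction refl (All.lookup x∉ z∈)
    ... | inj₂ (there p) = ∈-++⁺ʳ ys₁ p
    eq : suc (length (ys₁ ++ ys₂)) ≡ length (ys₁ ++ x ∷ ys₂)
    eq = trans (cong suc (length-++ ys₁)) (trans (sym (ℕₚ.+-suc (length ys₁) (length ys₂))) (sym (length-++ ys₁)))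

  length-filter-split : {P : A → Set} (P? : Decidable P) (xs : List A) →
    length (filter P? xs) + length (filter (¬? ∘ P?) xs) ≡ length xs
  length-filter-split P? [] = refl
  length-filter-split P? (x ∷ xs) with P? x
  ... | yes _ = cong suc (length-filter-split P? xs)
  ... | no _ = trans (ℕₚ.+-suc _ _) (cong suc (length-filter-split P? xs))

-- Loose paths and two-paths

-- `HasP33` for bare edge lists, to which it unfolds; the reduction works with sublists of the
-- edges.
HasPath : ∀ {n} → List (Subset n) → Set
HasPath es = ∃[ e₁ ] ∃[ e₂ ] ∃[ e₃ ]
  (e₁ ∈ₗ es × e₂ ∈ₗ es × e₃ ∈ₗ es ×
   ∣ e₁ ∩ e₂ ∣ ≡ 1 × ∣ e₂ ∩ e₃ ∣ ≡ 1 × ∣ e₁ ∩ e₃ ∣ ≡ 0)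

degree : ∀ {n} → List (Subset n) → Fin n → ℕ
degree es v = length (filter (v ∈?_) es)

module _ {A : Set} where

  distinct-≢ : ∀ {k} {us : Vec A k} → Distinct us → (i j : Fin k) →
               {True (¬? (i Fin.≟ j))} → lookup us i ≢ lookup us j
  distinct-≢ d i j {t} eq = toWitness t (Distinctₚ.lookup-injective d i j eq)

  allFresh : ∀ {k j} {us : Vec A k} → Distinct us → (i : Fin k) (is : Vec (Fin k) j) →
             VAll.All (i ≢_) is → VAll.All (lookup us i ≢_) (Vec.map (lookup us) is)
  allFresh d i [] [] = []
  allFresh d i (j ∷ is) (p ∷ ps) = (λ eq → p (Distinctₚ.lookup-injective d i j eq)) ∷ allFresh d i is ps

  -- Passes to any rearranged selection of distinct vertices. The indices are literals, so their
  -- distinctness is settled by evaluation.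
  reindex : ∀ {k j} {us : Vec A k} → Distinct us → (is : Vec (Fin k) j) →
            {True (VAllPairs.allPairs? (λ i j → ¬? (i Fin.≟ j)) is)} →
            Distinct (Vec.map (lookup us) is)
  reindex {us = us} d is {t} = go is (toWitness t)
    where
    go : ∀ {j} (is : Vec (Fin _) j) → Distinct is → Distinct (Vec.map (lookup us) is)
    go [] [] = []
    go (i ∷ is) (p ∷ ps) = allFresh d i is p ∷ go is ps

module _ {n : ℕ} where

  locate : ∀ {k} (p : Fin n) (us : Vec (Fin n) k) →
           (∃[ i ] p ≡ lookup us i) ⊎ VAll.All (p ≢_) us
  locate p [] = inj₂ []
  locate p (u ∷ us) with p Fin.≟ u
  ... | yes eq = inj₁ (zero , eq)
  ... | no p≢u with locate p us
  ...   | inj₁ (i , eq) = inj₁ (suc i , eq)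
  ...   | inj₂ ps = inj₂ (p≢u ∷ ps)

  fresh? : ∀ {k} (p : Fin n) (us : Vec (Fin n) k) → Dec (VAll.All (p ≢_) us)
  fresh? p us = VAll.all? (λ u → ¬? (p Fin.≟ u)) us

-- In statements about an edge `E v p q` the vertices p and q form an unordered pair of the link of
-- v: `In` says that the pair contains x, `Two` that it equals {a, b}.
In : {A : Set} → A → A → A → Set
In x p q = p ≡ x ⊎ q ≡ x

Two : {A : Set} → A → A → A → A → Set
Two a b p q = (p ≡ a × q ≡ b) ⊎ (p ≡ b × q ≡ a)

module Hyper {n : ℕ} (es : List (Subset n)) (size : All (λ e → ∣ e ∣ ≡ 3) es) where

  E : Fin n → Fin n → Fin n → Set
  E a b c = tri a b c ∈ₗ es

  E? : ∀ a b c → Dec (E a b c)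
  E? a b c = tri a b c ∈ₗ? es

  E-swap₁₂ : ∀ {a b c} → E a b c → E b a c
  E-swap₁₂ {a} {b} {c} = subst (_∈ₗ es) (tri-swap₁₂ a b c)

  E-swap₂₃ : ∀ {a b c} → E a b c → E a c b
  E-swap₂₃ {a} {b} {c} = subst (_∈ₗ es) (tri-swap₂₃ a b c)

  E-rotate : ∀ {a b c} → E a b c → E b c a
  E-rotate = E-swap₂₃ ∘ E-swap₁₂

  E-reverse : ∀ {a b c} → E a b c → E c b a
  E-reverse = E-swap₁₂ ∘ E-rotate

  E-distinct : ∀ {a b c} → E a b c → a ≢ b × a ≢ c × b ≢ c
  E-distinct h = tri-distinct (All.lookup size h)

  E-≢₁₂ : ∀ {a b c} → E a b c → a ≢ b
  E-≢₁₂ h = proj₁ (E-distinct h)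

  E-≢₁₃ : ∀ {a b c} → E a b c → a ≢ c
  E-≢₁₃ h = proj₁ (proj₂ (E-distinct h))

  E-≢₂₃ : ∀ {a b c} → E a b c → b ≢ c
  E-≢₂₃ h = proj₂ (proj₂ (E-distinct h))

  edge-form : ∀ {e} → e ∈ₗ es → ∃[ a ] ∃[ b ] ∃[ c ] e ≡ tri a b c
  edge-form h = card-three (All.lookup size h)

  edge-at : ∀ {e v} → e ∈ₗ es → v ∈ e → ∃[ p ] ∃[ q ] e ≡ tri v p q
  edge-at {e} {v} h v∈ with edge-form h
  ... | a , b , c , refl with ∈tri⁻ {c = c} v∈
  ...   | inj₁ refl = b , c , refl
  ...   | inj₂ (inj₁ refl) = a , c , tri-swap₁₂ a b c
  ...   | inj₂ (inj₂ refl) = a , b , trans (tri-rotate a b c) (tri-rotate b c a)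

  E-pull : ∀ {x v p q} → In x p q → E v p q → ∃[ r ] (E v x r × Two x r p q)
  E-pull {q = q} (inj₁ refl) h = q , h , inj₁ (refl , refl)
  E-pull {p = p} (inj₂ refl) h = p , E-swap₂₃ h , inj₂ (refl , refl)

  degree-≤ : ∀ {v} (prs : List (Fin n × Fin n)) →
             (∀ {p q} → E v p q → Any (λ ab → Two (proj₁ ab) (proj₂ ab) p q) prs) →
             Unique es → degree es v ≤ length prs
  degree-≤ {v} prs cl uniq = ≤-trans
      (∈-Unique-length (Uniqueₚ.filter⁺ (v ∈?_) uniq) covered)
      (≤-reflexive (length-map _ prs))
    where
    covered : ∀ {e} → e ∈ₗ filter (v ∈?_) es → e ∈ₗ map (λ ab → tri v (proj₁ ab) (proj₂ ab)) prs
    covered e∈ with ∈-filter⁻ (v ∈?_) e∈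
    ... | e∈es , v∈e with edge-at e∈es v∈e
    ...   | p , q , refl = go (cl e∈es)
      where
      go : ∀ {prs} → Any (λ ab → Two (proj₁ ab) (proj₂ ab) p q) prs →
           tri v p q ∈ₗ map (λ ab → tri v (proj₁ ab) (proj₂ ab)) prs
      go (here (inj₁ (refl , refl))) = here refl
      go (here (inj₂ (refl , refl))) = here (tri-swap₂₃ v p q)
      go (there h) = there (go h)

  E⇒degree : ∀ {v p q} → E v p q → 1 ≤ degree es v
  E⇒degree {v} h with filter (v ∈?_) es | ∈-filter⁺ (v ∈?_) h ∈tri₁
  ... | _ ∷ _ | _ = s≤s z≤n

  degree⇒E : ∀ {v} → 1 ≤ degree es v → ∃[ p ] ∃[ q ] E v p q
  degree⇒E {v} h with filter (v ∈?_) es in eq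
  ... | e ∷ _ with ∈-filter⁻ (v ∈?_) {xs = es} (subst (e ∈ₗ_) (sym eq) (here refl))
  ...   | e∈ , v∈ with edge-at e∈ v∈
  ...     | p , q , refl = p , q , e∈

  TwoPath : Fin n → Fin n → Fin n → Fin n → Fin n → Set
  TwoPath v w x a b = Distinct (v ∷ w ∷ x ∷ a ∷ b ∷ []) × E v w x × E x a b

  -- The central vertices are the vertices z_j of a quasi-bipartite part and the
  -- centers of stars.
  NonCentral : Fin n → Set
  NonCentral v = ∃[ w ] ∃[ x ] ∃[ a ] ∃[ b ] TwoPath v w x a b

  nonCentral? : Decidable NonCentral
  nonCentral? v = any? λ w → any? λ x → any? λ a → any? λ b →
    VAllPairs.allPairs? (λ i j → ¬? (i Fin.≟ j)) _ ×-dec E? v w x ×-dec E? x a b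

  swap-end : ∀ {v w x a b} → TwoPath v w x a b → TwoPath v w x b a
  swap-end (d , e , f) = reindex d (# 0 ∷ # 1 ∷ # 2 ∷ # 4 ∷ # 3 ∷ []) , e , E-swap₂₃ f

  swap-start : ∀ {v w x a b} → TwoPath v w x a b → TwoPath w v x a b
  swap-start (d , e , f) = reindex d (# 1 ∷ # 0 ∷ # 2 ∷ # 3 ∷ # 4 ∷ []) , E-swap₁₂ e , f

  -- Otherwise the edges vqp and pab would form a two-path starting at v.
  central-meets : ∀ {v p q a b} → ¬ NonCentral v → E v p q → E p a b → v ≢ a → v ≢ b → q ≡ a ⊎ q ≡ b
  central-meets {v} {p} {q} {a} {b} c e f v≢a v≢b with q Fin.≟ a | q Fin.≟ b
  ... | yes eq | _ = inj₁ eq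
  ... | no _ | yes eq = inj₂ eq
  ... | no q≢a | no q≢b = contradiction (q , p , a , b , d , E-swap₂₃ e , f) c
    where
    d : Distinct (v ∷ q ∷ p ∷ a ∷ b ∷ [])
    d with E-distinct e | E-distinct f
    ... | v≢p , v≢q , p≢q | p≢a , p≢b , a≢b =
      (v≢q ∷ v≢p ∷ v≢a ∷ v≢b ∷ []) ∷ (≢-sym p≢q ∷ q≢a ∷ q≢b ∷ []) ∷ (p≢a ∷ p≢b ∷ []) ∷ (a≢b ∷ []) ∷ [] ∷ []

  module PathFree (free : ¬ HasPath es) where

    no-path : ∀ {p q v w x a b} → Distinct (p ∷ q ∷ v ∷ w ∷ x ∷ a ∷ b ∷ []) →
              E p q v → E v w x → E x a b → ⊥
    no-path {p} {q} {v} {w} {x} {a} {b} d e f g = free (_ , _ , _ , e , f , g ,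
        ∩-one ∈tri₃ ∈tri₁ (λ h k → one₁ (∈tri⁻ h) (∈tri⁻ k)) ,
        ∩-one ∈tri₃ ∈tri₁ (λ h k → one₂ (∈tri⁻ h) (∈tri⁻ k)) ,
        ∩-zero (λ h k → zero′ (∈tri⁻ h) (∈tri⁻ k)))
      where
      one₁ : ∀ {z} → z ≡ p ⊎ z ≡ q ⊎ z ≡ v → z ≡ v ⊎ z ≡ w ⊎ z ≡ x → z ≡ v
      one₁ (inj₂ (inj₂ eq)) _ = eq
      one₁ _ (inj₁ eq) = eq
      one₁ (inj₁ refl) (inj₂ (inj₁ eq)) = contradiction eq (distinct-≢ d (# 0) (# 3))
      one₁ (inj₁ refl) (inj₂ (inj₂ eq)) = contradiction eq (distinct-≢ d (# 0) (# 4))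
      one₁ (inj₂ (inj₁ refl)) (inj₂ (inj₁ eq)) = contradiction eq (distinct-≢ d (# 1) (# 3))
      one₁ (inj₂ (inj₁ refl)) (inj₂ (inj₂ eq)) = contradiction eq (distinct-≢ d (# 1) (# 4))
      one₂ : ∀ {z} → z ≡ v ⊎ z ≡ w ⊎ z ≡ x → z ≡ x ⊎ z ≡ a ⊎ z ≡ b → z ≡ x
      one₂ (inj₂ (inj₂ eq)) _ = eq
      one₂ _ (inj₁ eq) = eq
      one₂ (inj₁ refl) (inj₂ (inj₁ eq)) = contradiction eq (distinct-≢ d (# 2) (# 5))
      one₂ (inj₁ refl) (inj₂ (inj₂ eq)) = contradiction eq (distinct-≢ d (# 2) (# 6))
      one₂ (inj₂ (inj₁ refl)) (inj₂ (inj₁ eq)) = contradiction eq (distinct-≢ d (# 3) (# 5))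
      one₂ (inj₂ (inj₁ refl)) (inj₂ (inj₂ eq)) = contradiction eq (distinct-≢ d (# 3) (# 6))
      zero′ : ∀ {z} → z ≡ p ⊎ z ≡ q ⊎ z ≡ v → z ≡ x ⊎ z ≡ a ⊎ z ≡ b → ⊥
      zero′ (inj₁ refl) (inj₁ eq) = distinct-≢ d (# 0) (# 4) eq
      zero′ (inj₁ refl) (inj₂ (inj₁ eq)) = distinct-≢ d (# 0) (# 5) eq
      zero′ (inj₁ refl) (inj₂ (inj₂ eq)) = distinct-≢ d (# 0) (# 6) eq
      zero′ (inj₂ (inj₁ refl)) (inj₁ eq) = distinct-≢ d (# 1) (# 4) eq
      zero′ (inj₂ (inj₁ refl)) (inj₂ (inj₁ eq)) = distinct-≢ d (# 1) (# 5) eq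
      zero′ (inj₂ (inj₁ refl)) (inj₂ (inj₂ eq)) = distinct-≢ d (# 1) (# 6) eq
      zero′ (inj₂ (inj₂ refl)) (inj₁ eq) = distinct-≢ d (# 2) (# 4) eq
      zero′ (inj₂ (inj₂ refl)) (inj₂ (inj₁ eq)) = distinct-≢ d (# 2) (# 5) eq
      zero′ (inj₂ (inj₂ refl)) (inj₂ (inj₂ eq)) = distinct-≢ d (# 2) (# 6) eq

    -- Otherwise the edge at v, the first and the second edge of the two-path
    -- would form a loose path.
    two-path-cover : ∀ {v w x a b p q} → TwoPath v w x a b → E v p q →
      (∃[ i ] p ≡ lookup (w ∷ x ∷ a ∷ b ∷ []) i) ⊎ (∃[ i ] q ≡ lookup (w ∷ x ∷ a ∷ b ∷ []) i)
    two-path-cover {v} {w} {x} {a} {b} {p} {q} (d , e , f) g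
      with locate p (w ∷ x ∷ a ∷ b ∷ []) | locate q (w ∷ x ∷ a ∷ b ∷ [])
    ... | inj₁ h | _ = inj₁ h
    ... | inj₂ _ | inj₁ h = inj₂ h
    ... | inj₂ hp | inj₂ hq with E-distinct g
    ...   | v≢p , v≢q , p≢q =
      ⊥-elim (no-path ((p≢q ∷ ≢-sym v≢p ∷ hp) ∷ (≢-sym v≢q ∷ hq) ∷ d) (E-rotate g) e f)

-- The structure of the core

In-swap : {A : Set} {x p q : A} → In x p q → In x q p
In-swap (inj₁ h) = inj₂ h
In-swap (inj₂ h) = inj₁ h

Two-swap : {A : Set} {a b p q : A} → Two a b p q → Two a b q p
Two-swap (inj₁ (h , k)) = inj₂ (k , h)
Two-swap (inj₂ (h , k)) = inj₁ (k , h)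

Two-flip : {A : Set} {a b p q : A} → Two a b p q → Two b a p q
Two-flip (inj₁ h) = inj₂ h
Two-flip (inj₂ h) = inj₁ h

any-at : {A : Set} {P : A → Set} {xs : List A} (i : Fin (length xs)) → P (List.lookup xs i) → Any P xs
any-at {xs = _ ∷ _} zero p = here p
any-at {xs = _ ∷ _} (suc i) p = there (any-at i p)

module Triangles {n : ℕ} (es : List (Subset n)) (size : All (λ e → ∣ e ∣ ≡ 3) es) where
  open Hyper es size

  -- The corners are x, v, a; the third vertices of the sides xv, xa, va are w, b, y.
  Triangle : Fin n → Fin n → Fin n → Fin n → Fin n → Fin n → Set
  Triangle x v a w b y = Distinct (x ∷ v ∷ a ∷ w ∷ b ∷ y ∷ []) × E x v w × E x a b × E v a y

  HasTriangle : Set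
  HasTriangle = ∃[ x ] ∃[ v ] ∃[ a ] ∃[ w ] ∃[ b ] ∃[ y ] Triangle x v a w b y

  hasTriangle? : Dec HasTriangle
  hasTriangle? = any? λ x → any? λ v → any? λ a → any? λ w → any? λ b → any? λ y →
    VAllPairs.allPairs? (λ i j → ¬? (i Fin.≟ j)) _ ×-dec E? x v w ×-dec E? x a b ×-dec E? v a y

  MinDegree8 : Set
  MinDegree8 = ∀ v → 1 ≤ degree es v → 8 ≤ degree es v

  -- The edge `E v p q` certifies that v is not isolated, so that its degree is at least 8; the
  -- length of the explicit list `prs` is compared with 8 by evaluation.
  too-few-edges : Unique es → MinDegree8 → ∀ {v p q} → E v p q →
    (prs : List (Fin n × Fin n)) → {True (length prs ℕ.<? 8)} →
    (∀ {p q} → E v p q → Any (λ ab → Two (proj₁ ab) (proj₂ ab) p q) prs) → ⊥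
  too-few-edges uniq min8 {v} e prs {t} cl =
    <⇒≱ (toWitness t) (≤-trans (min8 v (E⇒degree e)) (degree-≤ prs cl uniq))

module Core {n : ℕ} (es : List (Subset n)) (size : All (λ e → ∣ e ∣ ≡ 3) es)
            (uniq : Unique es) (free : ¬ HasPath es)
            (min8 : Triangles.MinDegree8 es size) (noTriangle : ¬ Triangles.HasTriangle es size) where
  open Triangles es size
  open Hyper es size
  open PathFree free

  few-edges : ∀ {v p q} → E v p q → (prs : List (Fin n × Fin n)) → {True (length prs ℕ.<? 8)} →
              (∀ {p q} → E v p q → Any (λ ab → Two (proj₁ ab) (proj₂ ab) p q) prs) → ⊥
  few-edges e prs {t} = too-few-edges uniq min8 e prs {t}

  Outside : Fin n → Fin n → Fin n → Fin n → Fin n → Fin n → Set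
  Outside v w x a b y = VAll.All (y ≢_) (v ∷ w ∷ x ∷ a ∷ b ∷ [])

  View : (w x a b p q : Fin n) → Set
  View w x a b p q = In x p q ⊎ In w p q ⊎ Two a b p q

  -- A vertex q outside the two-path would close a loose triangle with corners x, v, a.
  two-path-view-a : ∀ {v w x a b q} → TwoPath v w x a b → E v a q → View w x a b a q
  two-path-view-a {v} {w} {x} {a} {b} {q} (d , e , f) g with locate q (v ∷ w ∷ x ∷ a ∷ b ∷ [])
  ... | inj₁ (zero , refl) = contradiction refl (E-≢₁₃ g)
  ... | inj₁ (suc zero , refl) = inj₂ (inj₁ (inj₂ refl))
  ... | inj₁ (suc (suc zero) , refl) = inj₁ (inj₂ refl)
  ... | inj₁ (suc (suc (suc zero)) , refl) = contradiction refl (E-≢₂₃ g)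
  ... | inj₁ (suc (suc (suc (suc zero))) , refl) = inj₂ (inj₂ (inj₁ (refl , refl)))
  ... | inj₂ out = contradiction
    (x , v , a , w , b , q , reindex (out ∷ d) (# 3 ∷ # 1 ∷ # 4 ∷ # 2 ∷ # 5 ∷ # 0 ∷ []) ,
      E-rotate (E-rotate e) , f , g) noTriangle

  two-path-view : ∀ {v w x a b p q} → TwoPath v w x a b → E v p q → View w x a b p q
  two-path-view {v} {w} {x} {a} {b} P g with two-path-cover P g
  ... | inj₁ (i , eq) = first i eq g
    where
    first : ∀ {p q} (i : Fin 4) → p ≡ lookup (w ∷ x ∷ a ∷ b ∷ []) i →
            E v p q → View w x a b p q
    first zero eq g = inj₂ (inj₁ (inj₁ eq))
    first (suc zero) eq g = inj₁ (inj₁ eq)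
    first (suc (suc zero)) refl g = two-path-view-a P g
    first (suc (suc (suc zero))) refl g with two-path-view-a (swap-end P) g
    ... | inj₁ h = inj₁ h
    ... | inj₂ (inj₁ h) = inj₂ (inj₁ h)
    ... | inj₂ (inj₂ h) = inj₂ (inj₂ (Two-flip h))
  ... | inj₂ (zero , eq) = inj₂ (inj₁ (inj₂ eq))
  ... | inj₂ (suc zero , eq) = inj₁ (inj₂ eq)
  ... | inj₂ (suc (suc zero) , refl) with two-path-view-a P (E-swap₂₃ g)
  ...   | inj₁ h = inj₁ (In-swap h)
  ...   | inj₂ (inj₁ h) = inj₂ (inj₁ (In-swap h))
  ...   | inj₂ (inj₂ h) = inj₂ (inj₂ (Two-swap h))
  two-path-view P g | inj₂ (suc (suc (suc zero)) , refl) with two-path-view-a (swap-end P) (E-swap₂₃ g)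
  ...   | inj₁ h = inj₁ (In-swap h)
  ...   | inj₂ (inj₁ h) = inj₂ (inj₁ (In-swap h))
  ...   | inj₂ (inj₂ h) = inj₂ (inj₂ (Two-flip (Two-swap h)))

  -- The edges vwa, vxy and xab would form a loose triangle with corners v, a, x.
  edge-vwa : ∀ {v w x a b y} → TwoPath v w x a b → Outside v w x a b y → E v x y → ¬ E v w a
  edge-vwa {v} {w} {x} {a} {b} {y} (d , e , f) out g h = noTriangle
    (v , a , x , w , y , b , reindex (out ∷ d) (# 1 ∷ # 4 ∷ # 3 ∷ # 2 ∷ # 0 ∷ # 5 ∷ []) ,
      E-swap₂₃ h , g , E-swap₁₂ f)

  edge-vw : ∀ {v w x a b y r} → TwoPath v w x a b → Outside v w x a b y → E v x y → E v w r → r ≡ x ⊎ r ≡ y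
  edge-vw {v} {w} {x} {a} {b} {y} {r} P@(d , e , f) out g h with locate r (v ∷ w ∷ x ∷ a ∷ b ∷ [])
  ... | inj₁ (zero , refl) = contradiction refl (E-≢₁₃ h)
  ... | inj₁ (suc zero , refl) = contradiction refl (E-≢₂₃ h)
  ... | inj₁ (suc (suc zero) , eq) = inj₁ eq
  ... | inj₁ (suc (suc (suc zero)) , refl) = contradiction h (edge-vwa P out g)
  ... | inj₁ (suc (suc (suc (suc zero))) , refl) = contradiction h
      (edge-vwa (swap-end P) (reswap out) g)
    where
    reswap : Outside v w x a b y → Outside v w x b a y
    reswap (h₁ ∷ h₂ ∷ h₃ ∷ h₄ ∷ h₅ ∷ []) = h₁ ∷ h₂ ∷ h₃ ∷ h₅ ∷ h₄ ∷ []
  ... | inj₂ outʳ with r Fin.≟ y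
  ...   | yes eq = inj₂ eq
  -- The loose path abx, xyv, vwr.
  ...   | no r≢y = ⊥-elim (no-path
      (reindex ((r≢y ∷ outʳ) ∷ out ∷ d) (# 5 ∷ # 6 ∷ # 4 ∷ # 1 ∷ # 2 ∷ # 3 ∷ # 0 ∷ []))
      (E-rotate f) (E-rotate g) h)

  -- What has to be excluded is an edge vwy. Then `edge-vw`, applied to any outside vertex s with an
  -- edge vxs, gives s = y, and the link of v is covered by six pairs.
  edges-vx : ∀ {v w x a b y p q} → TwoPath v w x a b → Outside v w x a b y → E v x y →
             E v p q → In x p q ⊎ Two a b p q
  edges-vx {v} {w} {x} {a} {b} {y} P@(d , e , f) out g h with two-path-view P h
  ... | inj₁ k = inj₁ k
  ... | inj₂ (inj₂ k) = inj₂ k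
  ... | inj₂ (inj₁ k) with E-pull k h
  ...   | r , h′ , two with edge-vw P out g h′
  ...     | inj₁ refl = inj₁ ([ inj₂ ∘ proj₂ , inj₁ ∘ proj₁ ]′ two)
  ...     | inj₂ refl = ⊥-elim (few-edges e
      ((w , x) ∷ (x , a) ∷ (x , b) ∷ (a , b) ∷ (w , y) ∷ (x , y) ∷ []) classify)
    where
    classify : ∀ {p q} → E v p q → Any (λ ab → Two (proj₁ ab) (proj₂ ab) p q)
      ((w , x) ∷ (x , a) ∷ (x , b) ∷ (a , b) ∷ (w , y) ∷ (x , y) ∷ [])
    classify k with two-path-view P k
    ... | inj₂ (inj₂ t) = any-at (# 3) t
    ... | inj₂ (inj₁ i) with E-pull i k
    ...   | s , k′ , t with edge-vw P out g k′
    ...     | inj₁ refl = any-at (# 0) t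
    ...     | inj₂ refl = any-at (# 4) t
    classify k | inj₁ i with E-pull i k
    ... | s , k′ , t with locate s (v ∷ w ∷ x ∷ a ∷ b ∷ [])
    ...   | inj₁ (zero , refl) = contradiction refl (E-≢₁₃ k′)
    ...   | inj₁ (suc zero , refl) = any-at (# 0) (Two-flip t)
    ...   | inj₁ (suc (suc zero) , refl) = contradiction refl (E-≢₂₃ k′)
    ...   | inj₁ (suc (suc (suc zero)) , refl) = any-at (# 1) t
    ...   | inj₁ (suc (suc (suc (suc zero))) , refl) = any-at (# 2) t
    ...   | inj₂ outˢ with edge-vw P outˢ k′ h′
    ...     | inj₁ refl = contradiction refl (VAll.head (VAll.tail (VAll.tail out)))
    ...     | inj₂ refl = any-at (# 5) t

  -- Otherwise y has degree at most 2. Since v has degree at least 8, there is a spare edge vxz; an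
  -- edge yxs with s ≠ v completes vxz and vab to a loose path, or to a loose triangle if s is a or
  -- b.
  edge-vab : ∀ {v w x a b y} → TwoPath v w x a b → Outside v w x a b y → E v x y → ¬ E v a b
  edge-vab {v} {w} {x} {a} {b} {y} P@(d , e , f) out@(y≢v ∷ y≢w ∷ y≢x ∷ y≢a ∷ y≢b ∷ []) g k =
    few-edges (E-reverse g) ((v , x) ∷ (a , b) ∷ []) classify
    where
    D : Distinct (y ∷ v ∷ x ∷ a ∷ b ∷ [])
    D = reindex (out ∷ d) (# 0 ∷ # 1 ∷ # 3 ∷ # 4 ∷ # 5 ∷ [])
    P′ : TwoPath y x v a b
    P′ = reindex D (# 0 ∷ # 2 ∷ # 1 ∷ # 3 ∷ # 4 ∷ []) , E-reverse g , k
    Spare : Fin n → Fin n → Set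
    Spare r z = E v x z × VAll.All (z ≢_) (y ∷ v ∷ x ∷ a ∷ b ∷ r ∷ [])
    spare : ∀ r → ∃[ z ] Spare r z
    spare r with any? (λ z → E? v x z ×-dec fresh? z (y ∷ v ∷ x ∷ a ∷ b ∷ r ∷ []))
    ... | yes h = h
    ... | no none = ⊥-elim (few-edges e ((a , b) ∷ (x , a) ∷ (x , b) ∷ (x , y) ∷ (x , r) ∷ []) cl)
      where
      cl : ∀ {p q} → E v p q → Any (λ ab → Two (proj₁ ab) (proj₂ ab) p q)
        ((a , b) ∷ (x , a) ∷ (x , b) ∷ (x , y) ∷ (x , r) ∷ [])
      cl h with edges-vx P out g h
      ... | inj₂ t = any-at (# 0) t
      ... | inj₁ i with E-pull i h
      ...   | s , h′ , t with locate s (y ∷ v ∷ x ∷ a ∷ b ∷ r ∷ [])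
      ...     | inj₁ (zero , refl) = any-at (# 3) t
      ...     | inj₁ (suc zero , refl) = contradiction refl (E-≢₁₃ h′)
      ...     | inj₁ (suc (suc zero) , refl) = contradiction refl (E-≢₂₃ h′)
      ...     | inj₁ (suc (suc (suc zero)) , refl) = any-at (# 1) t
      ...     | inj₁ (suc (suc (suc (suc zero))) , refl) = any-at (# 2) t
      ...     | inj₁ (suc (suc (suc (suc (suc zero)))) , refl) = any-at (# 4) t
      ...     | inj₂ o = contradiction (s , h′ , o) none
    no-xya : ∀ {a b z} → Distinct (y ∷ v ∷ x ∷ a ∷ b ∷ []) → VAll.All (z ≢_) (y ∷ v ∷ x ∷ a ∷ b ∷ []) →
             E v x z → E v a b → ¬ E x a y
    no-xya {a} {b} {z} D o h k m = noTriangle (x , a , v , y , z , b ,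
      reindex (o ∷ D) (# 3 ∷ # 4 ∷ # 2 ∷ # 1 ∷ # 0 ∷ # 5 ∷ []) , m , E-swap₁₂ h , E-swap₁₂ k)
    classify : ∀ {p q} → E y p q → Any (λ ab → Two (proj₁ ab) (proj₂ ab) p q) ((v , x) ∷ (a , b) ∷ [])
    classify h with two-path-view P′ h
    ... | inj₂ (inj₂ t) = any-at (# 1) t
    ... | inj₁ i with E-pull i h
    ...   | s , h′ , t with edges-vx P out g (E-swap₁₂ h′)
    ...     | inj₁ (inj₁ refl) = contradiction refl y≢x
    ...     | inj₁ (inj₂ refl) = any-at (# 0) t
    ...     | inj₂ (inj₁ (eq , _)) = contradiction eq y≢a
    ...     | inj₂ (inj₂ (eq , _)) = contradiction eq y≢b
    classify h | inj₂ (inj₁ i) with E-pull i h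
    ... | s , h′ , t with spare s
    ...   | z , vxz , (z≢y ∷ z≢v ∷ z≢x ∷ z≢a ∷ z≢b ∷ z≢s ∷ []) with locate s (y ∷ v ∷ x ∷ a ∷ b ∷ [])
    ...     | inj₁ (zero , refl) = contradiction refl (E-≢₁₃ h′)
    ...     | inj₁ (suc zero , refl) = any-at (# 0) (Two-flip t)
    ...     | inj₁ (suc (suc zero) , refl) = contradiction refl (E-≢₂₃ h′)
    ...     | inj₁ (suc (suc (suc zero)) , refl) = contradiction (E-rotate h′)
        (no-xya D (z≢y ∷ z≢v ∷ z≢x ∷ z≢a ∷ z≢b ∷ []) vxz k)
    ...     | inj₁ (suc (suc (suc (suc zero))) , refl) = contradiction (E-rotate h′)
        (no-xya (reindex D (# 0 ∷ # 1 ∷ # 2 ∷ # 4 ∷ # 3 ∷ [])) (z≢y ∷ z≢v ∷ z≢x ∷ z≢b ∷ z≢a ∷ []) vxz (E-swap₂₃ k))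
    ...     | inj₂ o = ⊥-elim (no-path
        (reindex ((z≢s ∷ z≢y ∷ z≢v ∷ z≢x ∷ z≢a ∷ z≢b ∷ []) ∷ o ∷ D)
          (# 1 ∷ # 2 ∷ # 4 ∷ # 0 ∷ # 3 ∷ # 5 ∷ # 6 ∷ []))
        (E-rotate (E-rotate h′)) (E-rotate vxz) k)

  all-through-x : ∀ {v w x a b y p q} → TwoPath v w x a b → Outside v w x a b y → E v x y →
                  E v p q → In x p q
  all-through-x P out g h with edges-vx P out g h
  ... | inj₁ i = i
  ... | inj₂ (inj₁ (refl , refl)) = contradiction h (edge-vab P out g)
  ... | inj₂ (inj₂ (refl , refl)) = contradiction (E-swap₂₃ h) (edge-vab P out g)

  Through : Fin n → Fin n → Set
  Through u v = ∀ p q → E v p q → In u p q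

  Leaf : Fin n → Fin n → Set
  Leaf z v = NonCentral v × ¬ NonCentral z × Through z v

  Twin : Fin n → Fin n → Set
  Twin v w = NonCentral v × NonCentral w × Through w v × Through v w

  NoOutside : Fin n → Fin n → Fin n → Fin n → Fin n → Set
  NoOutside v w x a b = ∀ y → Outside v w x a b y → ¬ E v x y

  outside-vw : ∀ {v w x a b} → TwoPath v w x a b → NoOutside v w x a b →
               ∃[ y ] (Outside v w x a b y × E v w y)
  outside-vw {v} {w} {x} {a} {b} P@(d , e , f) no-out
    with any? (λ y → fresh? y (v ∷ w ∷ x ∷ a ∷ b ∷ []) ×-dec E? v w y)
  ... | yes h = h
  ... | no none = ⊥-elim (few-edges e ((w , x) ∷ (x , a) ∷ (x , b) ∷ (a , b) ∷ (w , a) ∷ (w , b) ∷ []) classify)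
    where
    classify : ∀ {p q} → E v p q → Any (λ ab → Two (proj₁ ab) (proj₂ ab) p q)
      ((w , x) ∷ (x , a) ∷ (x , b) ∷ (a , b) ∷ (w , a) ∷ (w , b) ∷ [])
    classify h with two-path-view P h
    ... | inj₂ (inj₂ t) = any-at (# 3) t
    ... | inj₁ i with E-pull i h
    ...   | s , h′ , t with locate s (v ∷ w ∷ x ∷ a ∷ b ∷ [])
    ...     | inj₁ (zero , refl) = contradiction refl (E-≢₁₃ h′)
    ...     | inj₁ (suc zero , refl) = any-at (# 0) (Two-flip t)
    ...     | inj₁ (suc (suc zero) , refl) = contradiction refl (E-≢₂₃ h′)
    ...     | inj₁ (suc (suc (suc zero)) , refl) = any-at (# 1) t
    ...     | inj₁ (suc (suc (suc (suc zero))) , refl) = any-at (# 2) t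
    ...     | inj₂ o = contradiction h′ (no-out s o)
    classify h | inj₂ (inj₁ i) with E-pull i h
    ... | s , h′ , t with locate s (v ∷ w ∷ x ∷ a ∷ b ∷ [])
    ...   | inj₁ (zero , refl) = contradiction refl (E-≢₁₃ h′)
    ...   | inj₁ (suc zero , refl) = contradiction refl (E-≢₂₃ h′)
    ...   | inj₁ (suc (suc zero) , refl) = any-at (# 0) t
    ...   | inj₁ (suc (suc (suc zero)) , refl) = any-at (# 4) t
    ...   | inj₁ (suc (suc (suc (suc zero))) , refl) = any-at (# 5) t
    ...   | inj₂ o = contradiction (s , o , h′) none

  -- Again y would have degree at most 2. By the two-path ywv, vg₁g₂, an edge at y other than yg₁g₂
  -- contains v or w; unless it contains both, it contains x, against one of the two `NoOutside`
  -- hypotheses.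
  edge-v-avoiding-w : ∀ {v w x a b y g₁ g₂} → TwoPath v w x a b → NoOutside v w x a b → NoOutside w v x a b →
    Outside v w x a b y → E v w y → Distinct (y ∷ w ∷ v ∷ g₁ ∷ g₂ ∷ []) → ¬ E v g₁ g₂
  edge-v-avoiding-w {v} {w} {x} {a} {b} {y} {g₁} {g₂} P no-v no-w
    out@(y≢v ∷ y≢w ∷ y≢x ∷ y≢a ∷ y≢b ∷ []) g D k =
    few-edges (E-rotate (E-rotate g)) ((v , w) ∷ (g₁ , g₂) ∷ []) classify
    where
    classify : ∀ {p q} → E y p q → Any (λ ab → Two (proj₁ ab) (proj₂ ab) p q) ((v , w) ∷ (g₁ , g₂) ∷ [])
    classify h with two-path-view (D , E-reverse g , k) h
    ... | inj₂ (inj₂ t) = any-at (# 1) t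
    ... | inj₁ i with E-pull i h
    ...   | s , h′ , t with two-path-view P (E-swap₁₂ h′)
    ...     | inj₁ (inj₁ eq) = contradiction eq y≢x
    ...     | inj₁ (inj₂ refl) = ⊥-elim (no-v y out (E-swap₂₃ (E-swap₁₂ h′)))
    ...     | inj₂ (inj₁ (inj₁ eq)) = contradiction eq y≢w
    ...     | inj₂ (inj₁ (inj₂ refl)) = any-at (# 0) t
    ...     | inj₂ (inj₂ (inj₁ (eq , _))) = contradiction eq y≢a
    ...     | inj₂ (inj₂ (inj₂ (eq , _))) = contradiction eq y≢b
    classify h | inj₂ (inj₁ i) with E-pull i h
    ... | s , h′ , t with two-path-view (swap-start P) (E-swap₁₂ h′)
    ...   | inj₁ (inj₁ eq) = contradiction eq y≢x
    ...   | inj₁ (inj₂ refl) = ⊥-elim (no-w y (y≢w ∷ y≢v ∷ y≢x ∷ y≢a ∷ y≢b ∷ []) (E-swap₂₃ (E-swap₁₂ h′)))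
    ...   | inj₂ (inj₁ (inj₁ eq)) = contradiction eq y≢v
    ...   | inj₂ (inj₁ (inj₂ refl)) = any-at (# 0) (Two-flip t)
    ...   | inj₂ (inj₂ (inj₁ (eq , _))) = contradiction eq y≢a
    ...   | inj₂ (inj₂ (inj₂ (eq , _))) = contradiction eq y≢b

  all-through-w : ∀ {v w x a b y} → TwoPath v w x a b → NoOutside v w x a b → NoOutside w v x a b →
                  Outside v w x a b y → E v w y → Through w v
  all-through-w {v} {w} {x} {a} {b} {y} P@(d , e , f) no-v no-w out g p q h with two-path-view P h
  ... | inj₂ (inj₁ i) = i
  ... | inj₂ (inj₂ (inj₁ (refl , refl))) = contradiction h (edge-v-avoiding-w P no-v no-w out g
      (reindex (out ∷ d) (# 0 ∷ # 2 ∷ # 1 ∷ # 4 ∷ # 5 ∷ [])))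
  ... | inj₂ (inj₂ (inj₂ (refl , refl))) = contradiction h (edge-v-avoiding-w P no-v no-w out g
      (reindex (out ∷ d) (# 0 ∷ # 2 ∷ # 1 ∷ # 5 ∷ # 4 ∷ [])))
  ... | inj₁ i with E-pull i h
  ...   | s , h′ , t with locate s (v ∷ w ∷ x ∷ a ∷ b ∷ [])
  ...     | inj₁ (zero , refl) = contradiction refl (E-≢₁₃ h′)
  ...     | inj₁ (suc zero , refl) = [ inj₂ ∘ proj₂ , inj₁ ∘ proj₁ ]′ t
  ...     | inj₁ (suc (suc zero) , refl) = contradiction refl (E-≢₂₃ h′)
  ...     | inj₁ (suc (suc (suc zero)) , refl) = contradiction h′ (edge-v-avoiding-w P no-v no-w out g
      (reindex (out ∷ d) (# 0 ∷ # 2 ∷ # 1 ∷ # 3 ∷ # 4 ∷ [])))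
  ...     | inj₁ (suc (suc (suc (suc zero))) , refl) = contradiction h′ (edge-v-avoiding-w P no-v no-w out g
      (reindex (out ∷ d) (# 0 ∷ # 2 ∷ # 1 ∷ # 3 ∷ # 5 ∷ [])))
  ...     | inj₂ o = contradiction h′ (no-v s o)

  -- The cases are told apart by an edge vxy with y outside the two-path. If there is one, x lies on
  -- all edges at v; if not, the degree of v forces an edge vwy with y outside, which ties v and w
  -- together.
  through-or-twin : ∀ {v} → NonCentral v →
    (∃[ w ] ∃[ x ] ∃[ a ] ∃[ b ] (TwoPath v w x a b × Through x v)) ⊎ (∃[ w ] Twin v w)
  through-or-twin {v} nc@(w , x , a , b , P@(d , e , f))
    with any? (λ y → fresh? y (v ∷ w ∷ x ∷ a ∷ b ∷ []) ×-dec E? v x y)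
  ... | yes (y , out , g) = inj₁ (w , x , a , b , P , λ _ _ → all-through-x P out g)
  ... | no none = inj₂ (w , nc , (v , x , a , b , swap-start P) ,
        all-through-w P no-v no-w out g ,
        all-through-w (swap-start P) no-w no-v (flip out) (E-swap₁₂ g))
    where
    flip : ∀ {v w y} → Outside v w x a b y → Outside w v x a b y
    flip (y≢v ∷ y≢w ∷ o) = y≢w ∷ y≢v ∷ o
    no-v : NoOutside v w x a b
    no-v y out h = none (y , out , h)
    found : ∃[ y ] (Outside v w x a b y × E v w y)
    found = outside-vw P no-v
    y = proj₁ found
    out = proj₁ (proj₂ found)
    g = proj₂ (proj₂ found)
    -- Otherwise all edges at w would contain x, which the edge vwy does not.
    no-w : NoOutside w v x a b
    no-w z o h with all-through-x (swap-start P) o h (E-swap₁₂ g)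
    ... | inj₁ eq = distinct-≢ d (# 0) (# 2) eq
    ... | inj₂ eq = VAll.head (VAll.tail (VAll.tail out)) eq

  -- The middle vertex x of a two-path is on two edges with nothing else in common, so no further
  -- vertex lies on all its edges; hence x cannot be noncentral.
  partner : ∀ {v} → NonCentral v → ∃[ u ] (Leaf u v ⊎ Twin v u)
  partner {v} nc with through-or-twin nc
  ... | inj₂ (w , t) = w , inj₂ t
  ... | inj₁ (w , x , a , b , (d , e , f) , thr) = x , inj₁ (nc , central , thr)
    where
    disjoint : ∀ {u} → Through u x → ⊥
    disjoint thr′ with thr′ v w (E-rotate (E-rotate e)) | thr′ a b f
    ... | inj₁ p | inj₁ q = distinct-≢ d (# 0) (# 3) (trans p (sym q))
    ... | inj₁ p | inj₂ q = distinct-≢ d (# 0) (# 4) (trans p (sym q))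
    ... | inj₂ p | inj₁ q = distinct-≢ d (# 1) (# 3) (trans p (sym q))
    ... | inj₂ p | inj₂ q = distinct-≢ d (# 1) (# 4) (trans p (sym q))
    central : ¬ NonCentral x
    central nx with through-or-twin nx
    ... | inj₁ (_ , _ , _ , _ , _ , thr′) = disjoint thr′
    ... | inj₂ (_ , _ , _ , thr′ , _) = disjoint thr′

  EdgeClass : Fin n → Fin n → Fin n → Set
  EdgeClass p q r = (Twin p q × ¬ NonCentral r) ⊎ (Leaf p q × Leaf p r)

  Classified : Subset n → Set
  Classified e = ∃[ p ] ∃[ q ] ∃[ r ] (e ≡ tri p q r × EdgeClass p q r)

  -- All edges at s contain v, hence u, so s has degree one.
  no-chain : ∀ {v u s} → E v u s → Through u v → ¬ Through v s
  no-chain {v} {u} {s} e thr thr′ = few-edges (E-rotate (E-rotate e)) ((v , u) ∷ []) classify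
    where
    classify : ∀ {p q} → E s p q → Any (λ ab → Two (proj₁ ab) (proj₂ ab) p q) ((v , u) ∷ [])
    classify {p} {q} h with E-pull (thr′ p q h) h
    ... | k , h′ , t with thr s k (E-swap₁₂ h′)
    ...   | inj₁ eq = contradiction (sym eq) (E-≢₂₃ e)
    ...   | inj₂ refl = any-at (# 0) t

  -- If s is central, every edge at s contains u. An edge suy with y ≠ v would meet some vuz in u
  -- only, as v has enough edges to choose z; hence suv is the only edge at s.
  leaf-third : ∀ {v u s} → E v u s → Leaf u v → NonCentral s
  leaf-third {v} {u} {s} e (_ , cu , thr) with nonCentral? s
  ... | yes ns = ns
  ... | no cs = ⊥-elim (few-edges (E-rotate (E-rotate e)) ((v , u) ∷ []) classify)
    where
    contains-u : ∀ {p q} → E s p q → In u p q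
    contains-u {p} {q} h with u Fin.≟ p | u Fin.≟ q
    ... | yes eq | _ = inj₁ (sym eq)
    ... | no _ | yes eq = inj₂ (sym eq)
    ... | no u≢p | no u≢q with central-meets cu (E-rotate e) h u≢p u≢q
    ...   | v∈ with E-pull ([ inj₁ ∘ sym , inj₂ ∘ sym ]′ v∈) h
    ...     | k , h′ , t with thr s k (E-swap₁₂ h′)
    ...       | inj₁ eq = contradiction (sym eq) (E-≢₂₃ e)
    ...       | inj₂ refl = [ inj₂ ∘ proj₂ , inj₁ ∘ proj₁ ]′ t
    classify : ∀ {p q} → E s p q → Any (λ ab → Two (proj₁ ab) (proj₂ ab) p q) ((v , u) ∷ [])
    classify h with E-pull (contains-u h) h
    ... | y , h′ , t with y Fin.≟ v
    ...   | yes refl = any-at (# 0) (Two-flip t)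
    ...   | no y≢v with any? (λ z → E? v u z ×-dec fresh? z (s ∷ y ∷ []))
    ...     | yes (z , k , (z≢s ∷ z≢y ∷ [])) with central-meets cs h′ (E-swap₁₂ k) (≢-sym (E-≢₁₃ e)) (≢-sym z≢s)
    ...       | inj₁ eq = contradiction eq y≢v
    ...       | inj₂ eq = contradiction (sym eq) z≢y
    classify h | y , h′ , t | no y≢v | no none = ⊥-elim (few-edges e ((u , s) ∷ (u , y) ∷ []) cl)
      where
      cl : ∀ {p q} → E v p q → Any (λ ab → Two (proj₁ ab) (proj₂ ab) p q) ((u , s) ∷ (u , y) ∷ [])
      cl {p} {q} k with E-pull (thr p q k) k
      ... | z , k′ , t with locate z (s ∷ y ∷ [])
      ...   | inj₁ (zero , refl) = any-at (# 0) t
      ...   | inj₁ (suc zero , refl) = any-at (# 1) t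
      ...   | inj₂ o = contradiction (z , k′ , o) none

  -- Let u be the partner of v and s the third vertex. If s is noncentral, its partner is v or u, as
  -- it lies on this edge. By `no-chain` s is not attached to a vertex that is itself bound to the
  -- remaining one, which leaves only two leaves of a common center.
  classify-nonCentral : ∀ {v q r} → NonCentral v → E v q r → Classified (tri v q r)
  classify-nonCentral {v} {q} {r} nc h with partner nc
  ... | u , inj₂ tw@(_ , nu , thr , _) with E-pull (thr q r h) h
  ...   | s , e , t with nonCentral? s
  ...     | no cs = v , u , s , as-tri t , inj₁ (tw , cs)
    where
    as-tri : ∀ {q r s} → Two u s q r → tri v q r ≡ tri v u s
    as-tri (inj₁ (refl , refl)) = refl
    as-tri (inj₂ (refl , refl)) = tri-swap₂₃ v _ u
  ...     | yes ns with partner ns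
  ...       | t′ , inj₁ (_ , ct , thr′) with thr′ v u (E-rotate (E-rotate e))
  ...         | inj₁ refl = contradiction nc ct
  ...         | inj₂ refl = contradiction nu ct
  classify-nonCentral {v} nc h | u , inj₂ (_ , nu , thr , thr-v) | s , e , t | yes ns | t′ , inj₂ (_ , _ , thr′ , _)
    with thr′ v u (E-rotate (E-rotate e))
  ... | inj₁ refl = contradiction thr′ (no-chain e thr)
  ... | inj₂ refl = contradiction thr′ (no-chain (E-swap₁₂ e) thr-v)
  classify-nonCentral {v} {q} {r} nc h | u , inj₁ lf@(_ , cu , thr) with E-pull (thr q r h) h
  ... | s , e , t with partner (leaf-third e lf)
  ...   | t′ , inj₁ lf′@(_ , ct , thr′) with thr′ v u (E-rotate (E-rotate e))
  ...     | inj₁ refl = contradiction nc ct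
  ...     | inj₂ refl = u , v , s , as-tri t , inj₂ (lf , lf′)
    where
    as-tri : ∀ {q r s} → Two u s q r → tri v q r ≡ tri u v s
    as-tri (inj₁ (refl , refl)) = tri-swap₁₂ v u _
    as-tri (inj₂ (refl , refl)) = trans (tri-swap₂₃ v _ u) (tri-swap₁₂ v u _)
  classify-nonCentral {v} nc h | u , inj₁ (_ , cu , thr) | s , e , t | t′ , inj₂ (_ , nt , thr′ , _)
    with thr′ v u (E-rotate (E-rotate e))
  ... | inj₁ refl = contradiction thr′ (no-chain e thr)
  ... | inj₂ refl = contradiction nt cu

  -- If all three are central, every edge at one of them contains a second one. A further edge aby
  -- leaves at most three pairs in the link of c, a further edge acy at most two in that of b;
  -- without either, abc is the only edge at a.
  not-all-central : ∀ {a b c} → E a b c → ¬ NonCentral a → ¬ NonCentral b → ¬ ¬ NonCentral c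
  not-all-central {a} {b} {c} e ca cb cc = split
    where
    meets : ∀ {a b c p q} → ¬ NonCentral b → E a b c → E a p q → In b p q ⊎ In c p q
    meets {b = b} {p = p} {q} cb e h with b Fin.≟ p | b Fin.≟ q
    ... | yes eq | _ = inj₁ (inj₁ (sym eq))
    ... | no _ | yes eq = inj₁ (inj₂ (sym eq))
    ... | no b≢p | no b≢q = inj₂ ([ inj₁ ∘ sym , inj₂ ∘ sym ]′ (central-meets cb (E-swap₁₂ e) h b≢p b≢q))
    e-c : E c a b
    e-c = E-rotate (E-rotate e)
    split : ⊥
    split with any? (λ y → E? a b y ×-dec ¬? (y Fin.≟ c))
    ... | yes (y , h , y≢c) = few-edges e-c ((a , b) ∷ (a , y) ∷ (b , y) ∷ []) classify
      where
      classify : ∀ {p q} → E c p q → Any (λ ab → Two (proj₁ ab) (proj₂ ab) p q) ((a , b) ∷ (a , y) ∷ (b , y) ∷ [])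
      classify k with meets ca e-c k
      ... | inj₁ i with E-pull i k
      ...   | s , k′ , t with b Fin.≟ s
      ...     | yes refl = any-at (# 0) t
      ...     | no b≢s with central-meets cb (E-swap₁₂ h) (E-swap₁₂ k′) (E-≢₂₃ e) b≢s
      ...       | inj₁ eq = contradiction eq y≢c
      ...       | inj₂ refl = any-at (# 1) t
      classify k | inj₂ i with E-pull i k
      ... | s , k′ , t with a Fin.≟ s
      ...   | yes refl = any-at (# 0) (Two-flip t)
      ...   | no a≢s with central-meets ca h (E-swap₁₂ k′) (E-≢₁₃ e) a≢s
      ...     | inj₁ eq = contradiction eq y≢c
      ...     | inj₂ refl = any-at (# 2) t
    ... | no no-ab with any? (λ y → E? a c y ×-dec ¬? (y Fin.≟ b))
    ...   | yes (y , h , y≢b) = few-edges (E-swap₁₂ e) ((a , c) ∷ (c , y) ∷ []) classify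
      where
      classify : ∀ {p q} → E b p q → Any (λ ab → Two (proj₁ ab) (proj₂ ab) p q) ((a , c) ∷ (c , y) ∷ [])
      classify k with meets ca (E-swap₁₂ e) k
      ... | inj₁ i with E-pull i k
      ...   | s , k′ , t with s Fin.≟ c
      ...     | yes refl = any-at (# 0) t
      ...     | no s≢c = contradiction (s , E-swap₁₂ k′ , s≢c) no-ab
      classify k | inj₂ i with E-pull i k
      ... | s , k′ , t with a Fin.≟ s
      ...   | yes refl = any-at (# 0) (Two-flip t)
      ...   | no a≢s with central-meets ca h (E-swap₁₂ k′) (E-≢₁₂ e) a≢s
      ...     | inj₁ eq = contradiction eq y≢b
      ...     | inj₂ refl = any-at (# 1) t
    split | no no-ab | no no-ac = few-edges e ((b , c) ∷ []) classify
      where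
      classify : ∀ {p q} → E a p q → Any (λ ab → Two (proj₁ ab) (proj₂ ab) p q) ((b , c) ∷ [])
      classify k with meets cb e k
      ... | inj₁ i with E-pull i k
      ...   | s , k′ , t with s Fin.≟ c
      ...     | yes refl = any-at (# 0) t
      ...     | no s≢c = contradiction (s , k′ , s≢c) no-ab
      classify k | inj₂ i with E-pull i k
      ... | s , k′ , t with s Fin.≟ b
      ...   | yes refl = any-at (# 0) (Two-flip t)
      ...   | no s≢b = contradiction (s , k′ , s≢b) no-ac

  classify : ∀ {e} → e ∈ₗ es → Classified e
  classify e∈ with edge-form e∈
  ... | a , b , c , refl with nonCentral? a | nonCentral? b | nonCentral? c
  ...   | yes na | _ | _ = classify-nonCentral na e∈
  ...   | no _ | yes nb | _ = subst Classified (sym (tri-rotate a b c)) (classify-nonCentral nb (E-rotate e∈))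
  ...   | no _ | no _ | yes nc = subst Classified (tri-rotate c a b) (classify-nonCentral nc (E-rotate (E-rotate e∈)))
  ...   | no ca | no cb | no cc = contradiction cc (not-all-central e∈ ca cb)

-- Components containing a loose triangle

pairs : {A : Set} → List A → List (A × A)
pairs [] = []
pairs (x ∷ xs) = map (x ,_) xs ++ pairs xs

∈-pairs : {A : Set} {xs : List A} {a b : A} → a ∈ₗ xs → b ∈ₗ xs → a ≢ b →
          (a , b) ∈ₗ pairs xs ⊎ (b , a) ∈ₗ pairs xs
∈-pairs (here refl) (here refl) a≢b = contradiction refl a≢b
∈-pairs (here refl) (there b∈) _ = inj₁ (∈-++⁺ˡ (∈-map⁺ _ b∈))
∈-pairs (there a∈) (here refl) _ = inj₂ (∈-++⁺ˡ (∈-map⁺ _ a∈))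
∈-pairs {xs = x ∷ xs} (there a∈) (there b∈) a≢b with ∈-pairs a∈ b∈ a≢b
... | inj₁ h = inj₁ (∈-++⁺ʳ (map (x ,_) xs) h)
... | inj₂ h = inj₂ (∈-++⁺ʳ (map (x ,_) xs) h)

module _ {n : ℕ} where

  fan : Fin n → List (Fin n) → List (Subset n)
  fan z xs = map (λ ab → tri z (proj₁ ab) (proj₂ ab)) (pairs xs)

  ∈-fan : ∀ {z a b xs} → a ∈ₗ xs → b ∈ₗ xs → a ≢ b → tri z a b ∈ₗ fan z xs
  ∈-fan {z} {a} {b} a∈ b∈ a≢b with ∈-pairs a∈ b∈ a≢b
  ... | inj₁ h = ∈-map⁺ (λ ab → tri z (proj₁ ab) (proj₂ ab)) h
  ... | inj₂ h = subst (_∈ₗ _) (tri-swap₂₃ z b a) (∈-map⁺ (λ ab → tri z (proj₁ ab) (proj₂ ab)) h)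

  triples : List (Fin n) → List (Subset n)
  triples [] = []
  triples (x ∷ xs) = fan x xs ++ triples xs

  ∈-triples : ∀ {xs a b c} → a ∈ₗ xs → b ∈ₗ xs → c ∈ₗ xs → a ≢ b × a ≢ c × b ≢ c → tri a b c ∈ₗ triples xs
  ∈-triples (here refl) (here refl) _ (h , _) = contradiction refl h
  ∈-triples (here refl) _ (here refl) (_ , h , _) = contradiction refl h
  ∈-triples _ (here refl) (here refl) (_ , _ , h) = contradiction refl h
  ∈-triples (here refl) (there b∈) (there c∈) (_ , _ , h) = ∈-++⁺ˡ (∈-fan b∈ c∈ h)
  ∈-triples {a = a} {b} {c} (there a∈) (here refl) (there c∈) (_ , h , _) =
    ∈-++⁺ˡ (subst (_∈ₗ _) (tri-swap₁₂ b a c) (∈-fan a∈ c∈ h))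
  ∈-triples {a = a} {b} {c} (there a∈) (there b∈) (here refl) (h , _) =
    ∈-++⁺ˡ (subst (_∈ₗ _) (tri-rotate c a b) (∈-fan a∈ b∈ h))
  ∈-triples {x ∷ xs} (there a∈) (there b∈) (there c∈) h = ∈-++⁺ʳ (fan x xs) (∈-triples a∈ b∈ c∈ h)

module TriangleComponent {n : ℕ} (es : List (Subset n)) (size : All (λ e → ∣ e ∣ ≡ 3) es)
       (uniq : Unique es) (free : ¬ HasPath es) (min8 : Triangles.MinDegree8 es size) where
  open Triangles es size
  open Hyper es size
  open PathFree free

  rotate : ∀ {x v a w b y} → Triangle x v a w b y → Triangle v a x y w b
  rotate (d , e , f , g) = reindex d (# 1 ∷ # 2 ∷ # 0 ∷ # 5 ∷ # 3 ∷ # 4 ∷ []) , g , E-swap₁₂ e , E-swap₁₂ f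

  reflect : ∀ {x v a w b y} → Triangle x v a w b y → Triangle x a v b w y
  reflect (d , e , f , g) = reindex d (# 0 ∷ # 2 ∷ # 1 ∷ # 4 ∷ # 3 ∷ # 5 ∷ []) , f , e , E-swap₁₂ g

  Off : Fin n → Fin n → Fin n → Fin n → Fin n → Fin n → Fin n → Set
  Off x v a w b y z = VAll.All (z ≢_) (x ∷ v ∷ a ∷ w ∷ b ∷ y ∷ [])

  off-rotate : ∀ {x v a w b y z} → Off x v a w b y z → Off v a x y w b z
  off-rotate (x ∷ v ∷ a ∷ w ∷ b ∷ y ∷ []) = v ∷ a ∷ x ∷ y ∷ w ∷ b ∷ []

  off-reflect : ∀ {x v a w b y z} → Off x v a w b y z → Off x a v b w y z
  off-reflect (x ∷ v ∷ a ∷ w ∷ b ∷ y ∷ []) = x ∷ a ∷ v ∷ b ∷ w ∷ y ∷ []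

  -- Two two-paths start at x and run around the triangle: xwv, vay and xba, avy. Since z is on
  -- neither, p is on both.
  from-corner : ∀ {x v a w b y z p} → Triangle x v a w b y → Off x v a w b y z → E x p z → p ≡ v ⊎ p ≡ a ⊎ p ≡ y
  from-corner {x} {v} {a} {w} {b} {y} (d , e , f , g) (_ ∷ z≢v ∷ z≢a ∷ z≢w ∷ z≢b ∷ z≢y ∷ []) h
    with two-path-cover (reindex d (# 0 ∷ # 3 ∷ # 1 ∷ # 2 ∷ # 5 ∷ []) , E-swap₂₃ e , g) h
       | two-path-cover (reindex d (# 0 ∷ # 4 ∷ # 2 ∷ # 1 ∷ # 5 ∷ []) , E-swap₂₃ f , E-swap₁₂ g) h
  ... | inj₂ (zero , eq) | _ = contradiction eq z≢w
  ... | inj₂ (suc zero , eq) | _ = contradiction eq z≢v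
  ... | inj₂ (suc (suc zero) , eq) | _ = contradiction eq z≢a
  ... | inj₂ (suc (suc (suc zero)) , eq) | _ = contradiction eq z≢y
  ... | inj₁ (suc zero , eq) | _ = inj₁ eq
  ... | inj₁ (suc (suc zero) , eq) | _ = inj₂ (inj₁ eq)
  ... | inj₁ (suc (suc (suc zero)) , eq) | _ = inj₂ (inj₂ eq)
  ... | inj₁ (zero , _) | inj₁ (suc zero , eq) = inj₂ (inj₁ eq)
  ... | inj₁ (zero , _) | inj₁ (suc (suc zero) , eq) = inj₁ eq
  ... | inj₁ (zero , _) | inj₁ (suc (suc (suc zero)) , eq) = inj₂ (inj₂ eq)
  ... | inj₁ (zero , p≡w) | inj₁ (zero , p≡b) = contradiction (trans (sym p≡w) p≡b) (distinct-≢ d (# 3) (# 4))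
  ... | inj₁ (zero , _) | inj₂ (zero , eq) = contradiction eq z≢b
  ... | inj₁ (zero , _) | inj₂ (suc zero , eq) = contradiction eq z≢a
  ... | inj₁ (zero , _) | inj₂ (suc (suc zero) , eq) = contradiction eq z≢v
  ... | inj₁ (zero , _) | inj₂ (suc (suc (suc zero)) , eq) = contradiction eq z≢y

  corner-not-mid : ∀ {x v a w b y z} → Triangle x v a w b y → Off x v a w b y z → ¬ E x w z
  corner-not-mid T@(d , _) o h with from-corner T o h
  ... | inj₁ eq = distinct-≢ d (# 3) (# 1) eq
  ... | inj₂ (inj₁ eq) = distinct-≢ d (# 3) (# 2) eq
  ... | inj₂ (inj₂ eq) = distinct-≢ d (# 3) (# 5) eq

  -- As for a corner, with the two-paths wvx, xab and wxv, vay from w; `corner-not-mid` removes x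
  -- and v.
  from-mid : ∀ {x v a w b y z p} → Triangle x v a w b y → Off x v a w b y z → E w p z → p ≡ a
  from-mid T@(d , e , f , g) o@(z≢x ∷ z≢v ∷ z≢a ∷ z≢w ∷ z≢b ∷ z≢y ∷ []) h
    with two-path-cover (reindex d (# 3 ∷ # 1 ∷ # 0 ∷ # 2 ∷ # 4 ∷ []) , E-reverse e , f) h
       | two-path-cover (reindex d (# 3 ∷ # 0 ∷ # 1 ∷ # 2 ∷ # 5 ∷ []) , E-rotate (E-rotate e) , g) h
  ... | inj₂ (zero , eq) | _ = contradiction eq z≢v
  ... | inj₂ (suc zero , eq) | _ = contradiction eq z≢x
  ... | inj₂ (suc (suc zero) , eq) | _ = contradiction eq z≢a
  ... | inj₂ (suc (suc (suc zero)) , eq) | _ = contradiction eq z≢b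
  ... | inj₁ (zero , refl) | _ = contradiction (E-swap₁₂ h) (corner-not-mid (reflect (rotate T)) (off-reflect (off-rotate o)))
  ... | inj₁ (suc zero , refl) | _ = contradiction (E-swap₁₂ h) (corner-not-mid T o)
  ... | inj₁ (suc (suc zero) , eq) | _ = eq
  ... | inj₁ (suc (suc (suc zero)) , p≡b) | inj₁ (zero , p≡x) = contradiction (trans (sym p≡b) p≡x) (distinct-≢ d (# 4) (# 0))
  ... | inj₁ (suc (suc (suc zero)) , p≡b) | inj₁ (suc zero , p≡v) = contradiction (trans (sym p≡b) p≡v) (distinct-≢ d (# 4) (# 1))
  ... | inj₁ (suc (suc (suc zero)) , p≡b) | inj₁ (suc (suc zero) , eq) = eq
  ... | inj₁ (suc (suc (suc zero)) , p≡b) | inj₁ (suc (suc (suc zero)) , p≡y) = contradiction (trans (sym p≡b) p≡y) (distinct-≢ d (# 4) (# 5))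
  ... | inj₁ (suc (suc (suc zero)) , _) | inj₂ (zero , eq) = contradiction eq z≢x
  ... | inj₁ (suc (suc (suc zero)) , _) | inj₂ (suc zero , eq) = contradiction eq z≢v
  ... | inj₁ (suc (suc (suc zero)) , _) | inj₂ (suc (suc zero) , eq) = contradiction eq z≢a
  ... | inj₁ (suc (suc (suc zero)) , _) | inj₂ (suc (suc (suc zero)) , eq) = contradiction eq z≢y

  -- The pairs through which an edge may leave the triangle: two corners, or a corner and the third
  -- vertex of the opposite side.
  allowed : (x v a w b y : Fin n) → List (Fin n × Fin n)
  allowed x v a w b y = (x , v) ∷ (x , a) ∷ (v , a) ∷ (x , y) ∷ (v , b) ∷ (a , w) ∷ []

  Allowed : (x v a w b y p q : Fin n) → Set
  Allowed x v a w b y p q = Any (λ ab → Two (proj₁ ab) (proj₂ ab) p q) (allowed x v a w b y)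

  module _ {x v a w b y : Fin n} (T : Triangle x v a w b y) where

    K : Vec (Fin n) 6
    K = x ∷ v ∷ a ∷ w ∷ b ∷ y ∷ []

    leaving : ∀ {z p} (i : Fin 6) → Off x v a w b y z → E (lookup K i) p z → Allowed x v a w b y (lookup K i) p
    leaving zero o h with from-corner T o h
    ... | inj₁ eq = any-at (# 0) (inj₁ (refl , eq))
    ... | inj₂ (inj₁ eq) = any-at (# 1) (inj₁ (refl , eq))
    ... | inj₂ (inj₂ eq) = any-at (# 3) (inj₁ (refl , eq))
    leaving (suc zero) o h with from-corner (rotate T) (off-rotate o) h
    ... | inj₁ eq = any-at (# 2) (inj₁ (refl , eq))
    ... | inj₂ (inj₁ eq) = any-at (# 0) (inj₂ (refl , eq))
    ... | inj₂ (inj₂ eq) = any-at (# 4) (inj₁ (refl , eq))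
    leaving (suc (suc zero)) o h with from-corner (rotate (rotate T)) (off-rotate (off-rotate o)) h
    ... | inj₁ eq = any-at (# 1) (inj₂ (refl , eq))
    ... | inj₂ (inj₁ eq) = any-at (# 2) (inj₂ (refl , eq))
    ... | inj₂ (inj₂ eq) = any-at (# 5) (inj₁ (refl , eq))
    leaving (suc (suc (suc zero))) o h = any-at (# 5) (inj₂ (refl , from-mid T o h))
    leaving (suc (suc (suc (suc zero)))) o h =
      any-at (# 4) (inj₂ (refl , from-mid (reflect T) (off-reflect o) h))
    leaving (suc (suc (suc (suc (suc zero))))) o h =
      any-at (# 3) (inj₂ (refl , from-mid (rotate T) (off-rotate o) h))

  -- The loose path abx, xvz, zpq; in `escape-opposite` it is vwx, xyz, zpq.
  escape-corners : ∀ {x v a w b y z p q} → Triangle x v a w b y → Off x v a w b y z → Off x v a w b y p → Off x v a w b y q →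
    E z p q → ¬ E z x v
  escape-corners (d , e , f , g) oz op oq h k =
    no-path (reindex ((E-≢₁₂ h ∷ E-≢₁₃ h ∷ oz) ∷ (E-≢₂₃ h ∷ op) ∷ oq ∷ d)
              (# 5 ∷ # 7 ∷ # 3 ∷ # 4 ∷ # 0 ∷ # 1 ∷ # 2 ∷ []))
      (E-rotate f) (E-rotate k) h

  escape-opposite : ∀ {x v a w b y z p q} → Triangle x v a w b y → Off x v a w b y z → Off x v a w b y p → Off x v a w b y q →
    E z p q → ¬ E z x y
  escape-opposite (d , e , f , g) oz op oq h k =
    no-path (reindex ((E-≢₁₂ h ∷ E-≢₁₃ h ∷ oz) ∷ (E-≢₂₃ h ∷ op) ∷ oq ∷ d)
              (# 4 ∷ # 6 ∷ # 3 ∷ # 8 ∷ # 0 ∷ # 1 ∷ # 2 ∷ []))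
      (E-rotate e) (E-rotate k) h

  module _ {x v a w b y : Fin n} (T : Triangle x v a w b y) where

    escape : ∀ {z p q s t} → Off x v a w b y z → Off x v a w b y p → Off x v a w b y q →
             E z p q → Allowed x v a w b y s t → ¬ E z s t
    escape {z} oz op oq h al k = go al
      where
      as : ∀ {c d s t} → Two c d s t → E z s t → E z c d
      as (inj₁ (refl , refl)) k = k
      as (inj₂ (refl , refl)) k = E-swap₂₃ k
      r : ∀ {u} → Off x v a w b y u → Off v a x y w b u
      r = off-rotate
      go : Allowed x v a w b y _ _ → ⊥
      go (here t) = escape-corners T oz op oq h (as t k)
      go (there (here t)) = escape-corners (reflect T) (off-reflect oz) (off-reflect op) (off-reflect oq) h (as t k)
      go (there (there (here t))) = escape-corners (rotate T) (r oz) (r op) (r oq) h (as t k)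
      go (there (there (there (here t)))) = escape-opposite T oz op oq h (as t k)
      go (there (there (there (there (here t))))) = escape-opposite (rotate T) (r oz) (r op) (r oq) h (as t k)
      go (there (there (there (there (there (here t)))))) =
        escape-opposite (rotate (rotate T)) (off-rotate (r oz)) (off-rotate (r op)) (off-rotate (r oq)) h (as t k)

    -- Once z is reached by an edge from the triangle, `escape` forbids edges at z that avoid the
    -- triangle. All edges at z then use one of the six allowed pairs, too few for degree 8.
    no-leaving : ∀ {z p} (i : Fin 6) → Off x v a w b y z → ¬ E (lookup (K T) i) p z
    no-leaving {z} {p} i oz h = too-few-edges uniq min8 k (allowed x v a w b y) cl
      where
      k : E z (lookup (K T) i) p
      k = E-rotate (E-rotate h)
      swapped : ∀ {p q} → Allowed x v a w b y p q → Allowed x v a w b y q p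
      swapped = Any.map Two-swap
      cl : ∀ {p q} → E z p q → Allowed x v a w b y p q
      cl {p} {q} m with locate p (K T) | locate q (K T)
      ... | inj₁ (j , refl) | _ = leaving T j oz (E-rotate m)
      ... | inj₂ _ | inj₁ (j , refl) = swapped (leaving T j oz (E-rotate (E-swap₂₃ m)))
      ... | inj₂ op | inj₂ oq = contradiction k (escape oz op oq m (leaving T i oz h))

    component-edge : ∀ {p q} (i : Fin 6) → E (lookup (K T) i) p q →
      (∃[ j ] p ≡ lookup (K T) j) × (∃[ j ] q ≡ lookup (K T) j)
    component-edge {p} {q} i h with locate p (K T) | locate q (K T)
    ... | inj₁ hp | inj₁ hq = hp , hq
    ... | _ | inj₂ oq = contradiction h (no-leaving i oq)
    ... | inj₂ op | inj₁ _ = contradiction (E-swap₂₃ h) (no-leaving i op)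

-- Reduction to the core

path-⊆ : ∀ {n} {es fs : List (Subset n)} → (∀ {e} → e ∈ₗ es → e ∈ₗ fs) → HasPath es → HasPath fs
path-⊆ sub (e , f , g , e∈ , f∈ , g∈ , h) = e , f , g , sub e∈ , sub f∈ , sub g∈ , h

record Good {n : ℕ} (es : List (Subset n)) : Set where
  field
    size : All (λ e → ∣ e ∣ ≡ 3) es
    uniq : Unique es
    free : ¬ HasPath es

  open Hyper es size public
  open Triangles es size public

module _ {n : ℕ} where

  good-filter : {P : Subset n → Set} (P? : Decidable P) {es : List (Subset n)} → Good es → Good (filter P? es)
  good-filter P? {es} g = record
    { size = All.tabulate (λ e∈ → All.lookup size (proj₁ (∈-filter⁻ P? e∈)))
    ; uniq = Uniqueₚ.filter⁺ P? uniq
    ; free = free ∘ path-⊆ (λ e∈ → proj₁ (∈-filter⁻ P? e∈)) }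
    where open Good g

  active? : (es : List (Subset n)) → Decidable (λ v → 1 ≤ degree es v)
  active? es v = 1 ℕ.≤? degree es v

  active : List (Subset n) → List (Fin n)
  active es = filter (active? es) (allFin n)

  degree-mono : ∀ {es fs : List (Subset n)} → es ⊆ fs → ∀ v → degree es v ≤ degree fs v
  degree-mono sub v = Sublistₚ.length-mono-≤ (Sublistₚ.filter⁺ (v ∈?_) (v ∈?_) (λ { refl h → h }) sub)

  filter-⊆ : {P : Subset n → Set} (P? : Decidable P) (es : List (Subset n)) → filter P? es ⊆ es
  filter-⊆ P? es = Sublistₚ.filter-⊆ P? es

  -- Every step of the reduction isolates the vertices of a set T at the price of
  -- at most 7 |T| edges.
  record CoreOf (es : List (Subset n)) : Set where
    field
      core    : List (Subset n)
      core⊆   : core ⊆ es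
      good    : Good core
      min8    : Good.MinDegree8 good
      noTri   : ¬ Good.HasTriangle good
      bound   : length es + 7 * length (active core) ≤ length core + 7 * length (active es)

  active-mono : ∀ {es fs} → es ⊆ fs → ∀ {v} → v ∈ₗ active es → v ∈ₗ active fs
  active-mono {es} {fs} sub {v} v∈ = ∈-filter⁺ (active? fs) (∈-allFin v)
    (≤-trans (proj₂ (∈-filter⁻ (active? es) {xs = allFin n} v∈)) (degree-mono sub v))

  isolate : ∀ {es} → Good es → {P : Subset n → Set} (P? : Decidable P) (T : List (Fin n)) → Unique T →
    (∀ {v} → v ∈ₗ T → 1 ≤ degree es v) →
    (∀ {v e} → v ∈ₗ T → v ∈ e → P e) →
    length (filter P? es) ≤ 7 * length T →
    CoreOf (filter (¬? ∘ P?) es) → CoreOf es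
  isolate {es} g {P} P? T uT act touch few c = record
    { core = core ; core⊆ = Sublist.⊆-trans core⊆ (filter-⊆ (¬? ∘ P?) es) ; good = good ; min8 = min8 ; noTri = noTri
    ; bound = reduction-step {p = length (filter P? es)} {e″ = length core} {a″ = length (active core)} {t = length T}
        (length-filter-split P? es) few
        (subst (_≤ length (active es)) (trans (length-++ T) (+-comm (length T) _)) disjoint) bound }
    where
    open CoreOf c
    es′ = filter (¬? ∘ P?) es
    inactive : ∀ {v} → v ∈ₗ T → v ∉ₗ active es′
    inactive {v} v∈T v∈ with Good.degree⇒E (good-filter (¬? ∘ P?) g) (proj₂ (∈-filter⁻ (active? es′) {xs = allFin n} v∈))
    ... | p , q , h = proj₂ (∈-filter⁻ (¬? ∘ P?) {xs = es} h) (touch v∈T ∈tri₁)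
    disjoint : length (T ++ active es′) ≤ length (active es)
    disjoint = ∈-Unique-length
      (Uniqueₚ.++⁺ uT (Uniqueₚ.filter⁺ (active? es′) (Uniqueₚ.allFin⁺ n)) (λ (p , q) → inactive p q))
      (λ v∈ → [ (λ v∈T → ∈-filter⁺ (active? es) (∈-allFin _) (act v∈T)) , active-mono (filter-⊆ (¬? ∘ P?) es) ]′ (∈-++⁻ T v∈))

  filter-shrinks : {P : Subset n → Set} (P? : Decidable P) {es : List (Subset n)} {e : Subset n} →
                   e ∈ₗ es → P e → length (filter (¬? ∘ P?) es) < length es
  filter-shrinks P? {es} e∈ pe = ≤-trans (ℕₚ.+-monoˡ-≤ _ (nonempty (∈-filter⁺ P? e∈ pe)))
    (≤-reflexive (length-filter-split P? es))
    where
    nonempty : ∀ {x} {xs : List (Subset n)} → x ∈ₗ xs → 1 ≤ length xs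
    nonempty (here _) = s≤s z≤n
    nonempty (there _) = s≤s z≤n

  -- Every step deletes an edge, so the number of edges serves as fuel. Triangles are removed only
  -- when no vertex has a degree from 1 to 7, since only then are they confined to a component.
  reduce : ∀ k (es : List (Subset n)) → length es ≤ k → Good es → CoreOf es
  reduce k es len g
    with any? (λ v → (1 ℕ.≤? degree es v) ×-dec (degree es v ℕ.<? 8))
  ... | yes (v , d≥1 , s≤s d≤7) with Good.degree⇒E g d≥1 | k
  ...   | p , q , h | zero = contradiction (≤-trans (filter-shrinks (v ∈?_) h ∈tri₁) len) λ ()
  ...   | p , q , h | suc k′ = isolate g (v ∈?_) (v ∷ []) ([] ∷ [])
      (λ { (here refl) → d≥1 }) (λ { (here refl) v∈ → v∈ }) d≤7
      (reduce k′ _ (ℕₚ.≤-pred (≤-trans (filter-shrinks (v ∈?_) h ∈tri₁) len)) (good-filter (¬? ∘ (v ∈?_)) g))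
  reduce k es len g | no min with Good.hasTriangle? g
  ... | no noT = record { core = es ; core⊆ = Sublist.⊆-refl ; good = g
      ; min8 = λ v d≥1 → ℕₚ.≮⇒≥ (λ d<8 → min (v , d≥1 , d<8)) ; noTri = noT ; bound = ≤-refl }
  ... | yes (x , v , a , w , b , y , T@(d , e , f , h)) = split k len
    where
    open Good g
    min8 : MinDegree8
    min8 v d≥1 = ℕₚ.≮⇒≥ (λ d<8 → min (v , d≥1 , d<8))
    open TriangleComponent es size uniq free min8 hiding (K)
    K : Vec (Fin n) 6
    K = x ∷ v ∷ a ∷ w ∷ b ∷ y ∷ []
    L : List (Fin n)
    L = Vec.toList K
    touches? : (e : Subset n) → Dec (Any (_∈ e) L)
    touches? e = Any.any? (_∈? e) L
    lookup∈ : ∀ {k} (us : Vec (Fin n) k) (i : Fin k) → lookup us i ∈ₗ Vec.toList us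
    lookup∈ (u ∷ us) zero = here refl
    lookup∈ (u ∷ us) (suc i) = there (lookup∈ us i)
    index : ∀ {k u} (us : Vec (Fin n) k) → u ∈ₗ Vec.toList us → ∃[ i ] u ≡ lookup us i
    index (u ∷ us) (here eq) = zero , eq
    index (u ∷ us) (there u∈) with index us u∈
    ... | i , eq = suc i , eq
    uniqueL : ∀ {k} {us : Vec (Fin n) k} → Distinct us → Unique (Vec.toList us)
    uniqueL [] = []
    uniqueL {us = u ∷ us} (p ∷ ps) = All.tabulate (λ {z} z∈ eq → let i , eq′ = index us z∈ in
      VAllₚ.lookup⁺ p i (trans eq eq′)) ∷ uniqueL ps
    acts : ∀ (i : Fin 6) → 1 ≤ degree es (lookup K i)
    acts zero = E⇒degree e
    acts (suc zero) = E⇒degree h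
    acts (suc (suc zero)) = E⇒degree (E-rotate f)
    acts (suc (suc (suc zero))) = E⇒degree (E-rotate (E-rotate e))
    acts (suc (suc (suc (suc zero)))) = E⇒degree (E-rotate (E-rotate f))
    acts (suc (suc (suc (suc (suc zero))))) = E⇒degree (E-rotate (E-rotate h))
    inside-L : ∀ {s} → s ∈ₗ filter touches? es → s ∈ₗ triples L
    inside-L {s} s∈ with ∈-filter⁻ touches? {xs = es} s∈
    ... | s∈es , any with find any
    ...   | u , u∈L , u∈s with index K u∈L | edge-at s∈es u∈s
    ...     | i , refl | p , q , refl with component-edge T i s∈es
    ...       | (j , refl) , (l , refl) =
      ∈-triples (lookup∈ K i) (lookup∈ K j) (lookup∈ K l) (E-distinct s∈es)
    split : ∀ k → length es ≤ k → CoreOf es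
    split zero len = contradiction (≤-trans (filter-shrinks touches? e (here ∈tri₁)) len) λ ()
    split (suc k′) len = isolate g touches? L (uniqueL d)
      (λ u∈ → let i , eq = index K u∈ in subst (λ u → 1 ≤ degree es u) (sym eq) (acts i))
      (λ u∈ u∈e → Any.map (λ { refl → u∈e }) u∈)
      -- C(6, 3) = 20 edges at most, within the allowance 7 * 6 = 42.
      (≤-trans (∈-Unique-length (Uniqueₚ.filter⁺ touches? uniq) inside-L) (ℕₚ.m≤m+n 20 22))
      (reduce k′ _ (ℕₚ.≤-pred (≤-trans (filter-shrinks touches? e (here ∈tri₁)) len)) (good-filter (¬? ∘ touches?) g))

-- Repetition and length in lists of pairs and fans

module _ {A B : Set} where

  Unique-map : (f : A → B) {xs : List A} → (∀ {x y} → x ∈ₗ xs → y ∈ₗ xs → f x ≡ f y → x ≡ y) →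
               Unique xs → Unique (map f xs)
  Unique-map f {[]} _ _ = []
  Unique-map f {x ∷ xs} inj (x∉ ∷ u) =
    All.tabulate (λ y∈ eq → let z , z∈ , eq′ = ∈-map⁻ f y∈ in
      contradiction (inj (here refl) (there z∈) (trans eq eq′)) (All.lookup x∉ z∈))
    ∷ Unique-map f (λ p q → inj (there p) (there q)) u

  Unique-concatMap : (f : A → List B) {xs : List A} → (∀ {x} → x ∈ₗ xs → Unique (f x)) →
    (∀ {x y z} → x ∈ₗ xs → y ∈ₗ xs → z ∈ₗ f x → z ∈ₗ f y → x ≡ y) → Unique xs → Unique (concatMap f xs)
  Unique-concatMap f {[]} _ _ _ = []
  Unique-concatMap f {x ∷ xs} uf inj (x∉ ∷ u) = Uniqueₚ.++⁺ (uf (here refl))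
    (Unique-concatMap f (uf ∘ there) (λ p q → inj (there p) (there q)) u)
    (λ (p , q) → let y , y∈ , z∈ = find (∈-concatMap⁻ f {xs = xs} q) in
      All.lookup x∉ y∈ (inj (here refl) (there y∈) p z∈))

  length-concatMap : (f : A → List B) (xs : List A) → length (concatMap f xs) ≡ sum (map (length ∘ f) xs)
  length-concatMap f [] = refl
  length-concatMap f (x ∷ xs) = trans (length-++ (f x)) (cong (length (f x) +_) (length-concatMap f xs))

length-cartesianProductWith : {A B C : Set} (f : A → B → C) (xs : List A) (ys : List B) →
  length (cartesianProductWith f xs ys) ≡ length xs * length ys
length-cartesianProductWith f [] ys = refl
length-cartesianProductWith f (x ∷ xs) ys =
  trans (length-++ (map (f x) ys)) (cong₂ _+_ (length-map (f x) ys) (length-cartesianProductWith f xs ys))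

length-pairs : {A : Set} (xs : List A) → length (pairs xs) ≡ choose₂ (length xs)
length-pairs [] = refl
length-pairs (x ∷ xs) = trans (length-++ (map (x ,_) xs)) (cong₂ _+_ (length-map (x ,_) xs) (length-pairs xs))

length-fan : ∀ {n} (z : Fin n) xs → length (fan z xs) ≡ choose₂ (length xs)
length-fan z xs = trans (length-map _ (pairs xs)) (length-pairs xs)

∈-pairs⁻ : {A : Set} {xs : List A} {a b : A} → Unique xs → (a , b) ∈ₗ pairs xs → a ∈ₗ xs × b ∈ₗ xs × a ≢ b
∈-pairs⁻ {xs = x ∷ xs} (x∉ ∷ u) h with ∈-++⁻ (map (x ,_) xs) h
... | inj₁ k with ∈-map⁻ (x ,_) k
...   | b , b∈ , refl = here refl , there b∈ , All.lookup x∉ b∈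
∈-pairs⁻ {xs = x ∷ xs} (x∉ ∷ u) h | inj₂ k with ∈-pairs⁻ u k
...   | a∈ , b∈ , a≢b = there a∈ , there b∈ , a≢b

∈-fan⁻ : ∀ {n} {z : Fin n} {xs e} → Unique xs → e ∈ₗ fan z xs →
         ∃[ a ] ∃[ b ] (a ∈ₗ xs × b ∈ₗ xs × a ≢ b × e ≡ tri z a b)
∈-fan⁻ u h with ∈-map⁻ _ h
... | (a , b) , ab∈ , eq with ∈-pairs⁻ u ab∈
...   | a∈ , b∈ , a≢b = a , b , a∈ , b∈ , a≢b , eq

-- The twin pairs are listed as prs, the central vertices as centers; the star
-- at a center z consists of the edges joining z to two of its leaves.
record Decomposition {n : ℕ} (es : List (Subset n)) : Set where
  field
    core     : List (Subset n)
    core⊆    : core ⊆ es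
    uniqCore : Unique core
    prs      : List (Fin n × Fin n)
    centers  : List (Fin n)
    leaves   : Fin n → List (Fin n)

  vertices : List (Fin n)
  vertices = centers ++ map proj₁ prs ++ map proj₂ prs ++ concatMap leaves centers

  star : Fin n → List (Subset n)
  star z = filter (_∈ₗ? fan z (leaves z)) core

  field
    uniqVertices : Unique vertices
    uniqLeaves   : ∀ z → Unique (leaves z)
    classified   : ∀ {e} → e ∈ₗ core →
      (∃[ vw ] ∃[ z ] (vw ∈ₗ prs × z ∈ₗ centers × e ≡ tri (proj₁ vw) (proj₂ vw) z)) ⊎
      (∃[ z ] (z ∈ₗ centers × e ∈ₗ fan z (leaves z)))
    many-leaves  : ∀ z → leaves z ≡ [] ⊎ 8 ≤ length (leaves z)
    bound        : length es + 7 * length vertices ≤ length core + 7 * n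

-- Twins, centers and leaves of the core as lists

module CoreCounting {n : ℕ} {es : List (Subset n)} (g : Good es)
       (min8 : Good.MinDegree8 g) (noTri : ¬ Good.HasTriangle g) where
  open Good g
  open Core es size uniq free min8 noTri

  through? : ∀ u v → Dec (Through u v)
  through? u v = all? λ p → all? λ q → E? v p q →-dec ((p Fin.≟ u) ⊎-dec (q Fin.≟ u))

  leaf? : ∀ z v → Dec (Leaf z v)
  leaf? z v = nonCentral? v ×-dec ¬? (nonCentral? z) ×-dec through? z v

  twin? : ∀ v w → Dec (Twin v w)
  twin? v w = nonCentral? v ×-dec nonCentral? w ×-dec through? w v ×-dec through? v w

  -- Two such vertices would leave v a single edge. Uniqueness of the partner is what makes twin
  -- pairs and leaf sets disjoint.
  through-unique : ∀ {v u u′} → NonCentral v → Through u v → Through u′ v → u ≡ u′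
  through-unique {v} {u} {u′} (w , x , _ , _ , _ , e , _) thr thr′ with u Fin.≟ u′
  ... | yes eq = eq
  ... | no u≢u′ = ⊥-elim (few-edges e ((u , u′) ∷ []) cl)
    where
    cl : ∀ {p q} → E v p q → Any (λ ab → Two (proj₁ ab) (proj₂ ab) p q) ((u , u′) ∷ [])
    cl {p} {q} h with thr p q h | thr′ p q h
    ... | inj₁ refl | inj₁ eq = contradiction eq u≢u′
    ... | inj₁ eq | inj₂ eq′ = here (inj₁ (eq , eq′))
    ... | inj₂ eq | inj₁ eq′ = here (inj₂ (eq′ , eq))
    ... | inj₂ refl | inj₂ eq = contradiction eq u≢u′

  twin-sym : ∀ {v w} → Twin v w → Twin w v
  twin-sym (nv , nw , t , t′) = nw , nv , t′ , t

  centers : List (Fin n)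
  centers = filter (λ z → active? es z ×-dec ¬? (nonCentral? z)) (allFin n)

  leaves : Fin n → List (Fin n)
  leaves z = filter (leaf? z) (allFin n)

  orderedTwin? : Decidable (λ (vw : Fin n × Fin n) → proj₁ vw Fin.< proj₂ vw × Twin (proj₁ vw) (proj₂ vw))
  orderedTwin? (v , w) = (v Fin.<? w) ×-dec twin? v w

  prs : List (Fin n × Fin n)
  prs = filter orderedTwin? (cartesianProduct (allFin n) (allFin n))

  ∈-centers : ∀ {z p q} → E z p q → ¬ NonCentral z → z ∈ₗ centers
  ∈-centers h c = ∈-filter⁺ _ (∈-allFin _) (E⇒degree h , c)

  ∈-centers⁻ : ∀ {z} → z ∈ₗ centers → 1 ≤ degree es z × ¬ NonCentral z
  ∈-centers⁻ z∈ = proj₂ (∈-filter⁻ (λ z → active? es z ×-dec ¬? (nonCentral? z)) {xs = allFin n} z∈)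

  ∈-leaves : ∀ {z v} → Leaf z v → v ∈ₗ leaves z
  ∈-leaves {z} l = ∈-filter⁺ (leaf? z) (∈-allFin _) l

  ∈-leaves⁻ : ∀ {z v} → v ∈ₗ leaves z → Leaf z v
  ∈-leaves⁻ {z} v∈ = proj₂ (∈-filter⁻ (leaf? z) {xs = allFin n} v∈)

  ∈-prs⁻ : ∀ {v w} → (v , w) ∈ₗ prs → v Fin.< w × Twin v w
  ∈-prs⁻ h = proj₂ (∈-filter⁻ orderedTwin? {xs = cartesianProduct (allFin n) (allFin n)} h)

  ∈-prs : ∀ {v w} → v Fin.< w → Twin v w → (v , w) ∈ₗ prs
  ∈-prs lt tw = ∈-filter⁺ orderedTwin? (∈-cartesianProduct⁺ (∈-allFin _) (∈-allFin _)) (lt , tw)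

  twin-unique : ∀ {v w w′} → Twin v w → Twin v w′ → w ≡ w′
  twin-unique (nv , _ , t , _) (_ , _ , t′ , _) = through-unique nv t t′

  nonCentral-active : ∀ {v} → NonCentral v → 1 ≤ degree es v
  nonCentral-active (_ , _ , _ , _ , _ , e , _) = E⇒degree e

  firsts seconds : List (Fin n)
  firsts = map proj₁ prs
  seconds = map proj₂ prs

  ∈-firsts⁻ : ∀ {v} → v ∈ₗ firsts → ∃[ w ] (v Fin.< w × Twin v w)
  ∈-firsts⁻ h with ∈-map⁻ proj₁ h
  ... | (v , w) , vw∈ , refl = w , ∈-prs⁻ vw∈

  ∈-seconds⁻ : ∀ {w} → w ∈ₗ seconds → ∃[ v ] (v Fin.< w × Twin w v)
  ∈-seconds⁻ h with ∈-map⁻ proj₂ h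
  ... | (v , w) , vw∈ , refl = let lt , tw = ∈-prs⁻ vw∈ in v , lt , twin-sym tw

  ∈-allLeaves⁻ : ∀ {v} → v ∈ₗ concatMap leaves centers → ∃[ z ] Leaf z v
  ∈-allLeaves⁻ h with find (∈-concatMap⁻ leaves {xs = centers} h)
  ... | z , _ , v∈ = z , ∈-leaves⁻ v∈

  vertices : List (Fin n)
  vertices = centers ++ firsts ++ seconds ++ concatMap leaves centers

  uniqPrs : Unique prs
  uniqPrs = Uniqueₚ.filter⁺ orderedTwin? (Uniqueₚ.cartesianProduct⁺ (Uniqueₚ.allFin⁺ n) (Uniqueₚ.allFin⁺ n))

  uniqLeaves : ∀ z → Unique (leaves z)
  uniqLeaves z = Uniqueₚ.filter⁺ (leaf? z) (Uniqueₚ.allFin⁺ n)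

  uniqVertices : Unique vertices
  uniqVertices =
    Uniqueₚ.++⁺ uCenters (Uniqueₚ.++⁺ uFirsts (Uniqueₚ.++⁺ uSeconds uAll seconds-leaves) firsts-rest) centers-rest
    where
    uCenters : Unique centers
    uCenters = Uniqueₚ.filter⁺ _ (Uniqueₚ.allFin⁺ n)
    uFirsts : Unique firsts
    uFirsts = Unique-map proj₁ (λ { {v , w} {_ , w′} p q refl →
      cong (v ,_) (twin-unique (proj₂ (∈-prs⁻ p)) (proj₂ (∈-prs⁻ q))) }) uniqPrs
    uSeconds : Unique seconds
    uSeconds = Unique-map proj₂ (λ { {v , w} {v′ , _} p q refl →
      cong (_, w) (twin-unique (twin-sym (proj₂ (∈-prs⁻ p))) (twin-sym (proj₂ (∈-prs⁻ q)))) }) uniqPrs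
    uAll : Unique (concatMap leaves centers)
    uAll = Unique-concatMap leaves (λ _ → uniqLeaves _)
      (λ _ _ p q → through-unique (proj₁ (∈-leaves⁻ p)) (proj₂ (proj₂ (∈-leaves⁻ p))) (proj₂ (proj₂ (∈-leaves⁻ q)))) uCenters
    twin-not-leaf : ∀ {v w z} → Twin v w → ¬ Leaf z v
    twin-not-leaf (_ , nw , t , _) (nv , cz , t′) = cz (subst NonCentral (through-unique nv t t′) nw)
    seconds-leaves : ∀ {v} → ¬ (v ∈ₗ seconds × v ∈ₗ concatMap leaves centers)
    seconds-leaves (p , q) = twin-not-leaf (proj₂ (proj₂ (∈-seconds⁻ p))) (proj₂ (∈-allLeaves⁻ q))
    firsts-rest : ∀ {v} → ¬ (v ∈ₗ firsts × v ∈ₗ seconds ++ concatMap leaves centers)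
    firsts-rest (p , q) with ∈-firsts⁻ p | ∈-++⁻ seconds q
    ... | w , v<w , tw | inj₂ l = twin-not-leaf tw (proj₂ (∈-allLeaves⁻ l))
    ... | w , v<w , tw | inj₁ s with ∈-seconds⁻ s
    ...   | u , u<v , tw′ = Finₚ.<-irrefl refl (Finₚ.<-trans v<w (subst (Fin._< _) (twin-unique tw′ tw) u<v))
    centers-rest : ∀ {v} → ¬ (v ∈ₗ centers × v ∈ₗ firsts ++ seconds ++ concatMap leaves centers)
    centers-rest (p , q) = proj₂ (∈-centers⁻ p) (nc (∈-++⁻ firsts q))
      where
      nc : ∀ {v} → v ∈ₗ firsts ⊎ v ∈ₗ seconds ++ concatMap leaves centers → NonCentral v
      nc (inj₁ f) = proj₁ (proj₂ (proj₂ (∈-firsts⁻ f)))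
      nc (inj₂ r) with ∈-++⁻ seconds r
      ... | inj₁ s = proj₁ (proj₂ (proj₂ (∈-seconds⁻ s)))
      ... | inj₂ l = proj₁ (proj₂ (∈-allLeaves⁻ l))

  vertices-active : ∀ {v} → v ∈ₗ vertices → 1 ≤ degree es v
  vertices-active v∈ with ∈-++⁻ centers v∈
  ... | inj₁ c = proj₁ (∈-centers⁻ c)
  ... | inj₂ r with ∈-++⁻ firsts r
  ...   | inj₁ f = nonCentral-active (proj₁ (proj₂ (proj₂ (∈-firsts⁻ f))))
  ...   | inj₂ r′ with ∈-++⁻ seconds r′
  ...     | inj₁ s = nonCentral-active (proj₁ (proj₂ (proj₂ (∈-seconds⁻ s))))
  ...     | inj₂ l = nonCentral-active (proj₁ (proj₂ (∈-allLeaves⁻ l)))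

  classified : ∀ {e} → e ∈ₗ es →
    (∃[ vw ] ∃[ z ] (vw ∈ₗ prs × z ∈ₗ centers × e ≡ tri (proj₁ vw) (proj₂ vw) z)) ⊎
    (∃[ z ] (z ∈ₗ centers × e ∈ₗ fan z (leaves z)))
  classified e∈ with classify e∈
  ... | p , q , r , refl , inj₂ (l@(_ , c , _) , l′) =
    inj₂ (p , ∈-centers e∈ c , ∈-fan (∈-leaves l) (∈-leaves l′) (E-≢₂₃ e∈))
  ... | p , q , r , refl , inj₁ (tw , c) with Finₚ.<-cmp p q
  ...   | tri< p<q _ _ = inj₁ ((p , q) , r , ∈-prs p<q tw , ∈-centers (E-rotate (E-rotate e∈)) c , refl)
  ...   | tri≈ _ eq _ = contradiction eq (E-≢₁₂ e∈)
  ...   | tri> _ _ q<p = inj₁ ((q , p) , r , ∈-prs q<p (twin-sym tw) , ∈-centers (E-rotate (E-rotate e∈)) c , tri-swap₁₂ p q r)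

  leaf-edges : ∀ {z v e} → Leaf z v → e ∈ₗ es → v ∈ e → ∃[ r ] (Leaf z r × e ≡ tri v z r)
  leaf-edges {z} {v} l@(nv , cz , thr) e∈ v∈ with classify e∈
  ... | p , q , r , refl , inj₁ (tw , c) with ∈tri⁻ {a = p} {q} {r} v∈
  ...   | inj₁ refl = contradiction (subst NonCentral (through-unique nv (proj₁ (proj₂ (proj₂ tw))) thr) (proj₁ (proj₂ tw))) cz
  ...   | inj₂ (inj₁ refl) = contradiction (subst NonCentral (through-unique nv (proj₂ (proj₂ (proj₂ tw))) thr) (proj₁ tw)) cz
  ...   | inj₂ (inj₂ refl) = contradiction nv c
  leaf-edges {z} {v} l@(nv , cz , thr) e∈ v∈ | p , q , r , refl , inj₂ (l₁@(_ , cp , thr₁) , l₂@(_ , _ , thr₂))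
    with ∈tri⁻ {a = p} {q} {r} v∈
  ...   | inj₁ refl = contradiction nv cp
  ...   | inj₂ (inj₁ refl) with through-unique nv thr thr₁
  ...     | refl = r , l₂ , tri-swap₁₂ p q r
  leaf-edges {z} {v} l@(nv , cz , thr) e∈ v∈ | p , q , r , refl , inj₂ (l₁@(_ , cp , thr₁) , l₂@(_ , _ , thr₂))
    | inj₂ (inj₂ refl) with through-unique nv thr thr₂
  ...     | refl = q , l₁ , trans (tri-rotate p q r) (tri-rotate q r p)

  -- A leaf v of z has degree at least 8, and its edges vzr lead to distinct further leaves r of z.
  many-leaves : ∀ z → leaves z ≡ [] ⊎ 8 ≤ length (leaves z)
  many-leaves z with leaves z in eq
  ... | [] = inj₁ refl
  ... | v ∷ _ = inj₂ (subst (λ ls → 8 ≤ length ls) eq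
      (≤-trans (min8 v (nonCentral-active (proj₁ l)))
        (≤-trans (∈-Unique-length (Uniqueₚ.filter⁺ (v ∈?_) uniq) covered) (≤-reflexive (length-map (tri v z) (leaves z))))))
    where
    l : Leaf z v
    l = ∈-leaves⁻ (subst (v ∈ₗ_) (sym eq) (here refl))
    covered : ∀ {e} → e ∈ₗ filter (v ∈?_) es → e ∈ₗ map (tri v z) (leaves z)
    covered e∈ with ∈-filter⁻ (v ∈?_) {xs = es} e∈
    ... | e∈es , v∈e with leaf-edges l e∈es v∈e
    ...   | r , lr , refl = ∈-map⁺ (tri v z) (∈-leaves lr)

  vertices≤active : length vertices ≤ length (active es)
  vertices≤active = ∈-Unique-length uniqVertices (λ v∈ → ∈-filter⁺ (active? es) (∈-allFin _) (vertices-active v∈))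

length-unique-Fin : ∀ {n} {xs : List (Fin n)} → Unique xs → length xs ≤ n
length-unique-Fin {n} u = ≤-trans (∈-Unique-length u (λ {x} _ → ∈-allFin x)) (≤-reflexive (Listₚ.length-tabulate {n = n} id))

decompose : ∀ {n} {es : List (Subset n)} → Good es → Decomposition es
decompose {n} {es} g = record
  { core = core ; core⊆ = core⊆ ; uniqCore = Good.uniq good ; prs = prs ; centers = centers ; leaves = leaves
  ; uniqVertices = uniqVertices ; uniqLeaves = uniqLeaves ; classified = classified ; many-leaves = many-leaves
  ; bound = decomposition-bound {m = length es} {c = length core} {a = length (active core)} bound vertices≤active
      (length-unique-Fin (Uniqueₚ.filter⁺ (active? es) (Uniqueₚ.allFin⁺ n))) }
  where
  open CoreOf (reduce (length es) es ≤-refl g)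
  open CoreCounting good min8 noTri

-- Counting edges and vertices

max-upper : ∀ {A : Set} (f : A → ℕ) {xs : List A} {x} → x ∈ₗ xs → f x ≤ foldr _⊔_ 0 (map f xs)
max-upper f (here refl) = ℕₚ.m≤m⊔n _ _
max-upper f (there x∈) = ≤-trans (max-upper f x∈) (ℕₚ.m≤n⊔m _ _)

max-least : ∀ {A : Set} (f : A → ℕ) (xs : List A) {B} → (∀ x → f x ≤ B) → foldr _⊔_ 0 (map f xs) ≤ B
max-least f [] h = z≤n
max-least f (x ∷ xs) h = ℕₚ.⊔-lub (h x) (max-least f xs h)

scale-sums : ∀ {A : Set} p q (f g : A → ℕ) (xs : List A) → (∀ {x} → x ∈ₗ xs → p * f x ≤ q * g x) →
             p * sum (map f xs) ≤ q * sum (map g xs)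
scale-sums p q f g [] h = ≤-reflexive (trans (ℕₚ.*-zeroʳ p) (sym (ℕₚ.*-zeroʳ q)))
scale-sums p q f g (x ∷ xs) h = scale-sum p q (h (here refl)) (scale-sums p q f g xs (h ∘ there))

module Counts {n : ℕ} {es : List (Subset n)} (D : Decomposition es) where
  open Decomposition D

  s t L S : ℕ
  s = length prs
  t = length centers
  L = sum (map (length ∘ leaves) centers)
  S = sum (map (length ∘ star) centers)

  vertices-length : length vertices ≡ t + (s + (s + L))
  vertices-length = trans (length-++ centers) (cong (t +_) (trans (length-++ (map proj₁ prs))
    (cong₂ _+_ (length-map proj₁ prs) (trans (length-++ (map proj₂ prs))
      (cong₂ _+_ (length-map proj₂ prs) (length-concatMap leaves centers))))))

  private
    rest : ∃[ k ] length vertices + k ≡ n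
    rest = ℕₚ.m≤n⇒∃[o]m+o≡n (length-unique-Fin uniqVertices)

  -- All vertices outside the decomposition, those isolated from the outset included.
  k : ℕ
  k = proj₁ rest

  n-split : n ≡ 2 * s + t + L + k
  n-split = vertex-sum s t L k vertices-length (proj₂ rest)

  twinEdge : Fin n × Fin n → Fin n → Subset n
  twinEdge vw z = tri (proj₁ vw) (proj₂ vw) z

  core-length : length core ≤ s * t + S
  core-length = ≤-trans (∈-Unique-length uniqCore covered)
    (≤-reflexive (trans (length-++ (cartesianProductWith twinEdge prs centers))
      (cong₂ _+_ (length-cartesianProductWith twinEdge prs centers) (length-concatMap star centers))))
    where
    covered : ∀ {e} → e ∈ₗ core → e ∈ₗ cartesianProductWith twinEdge prs centers ++ concatMap star centers
    covered e∈ with classified e∈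
    ... | inj₁ (vw , z , vw∈ , z∈ , refl) = ∈-++⁺ˡ (∈-cartesianProductWith⁺ twinEdge vw∈ z∈)
    ... | inj₂ (z , z∈ , e∈fan) = ∈-++⁺ʳ (cartesianProductWith twinEdge prs centers)
      (∈-concatMap⁺ star (Any.map (λ { refl → ∈-filter⁺ (_∈ₗ? fan z (leaves z)) e∈ e∈fan }) z∈))

  size-bound : length es ≤ s * t + S + 7 * k
  size-bound = edges-bound {c = length core} {S = S} s t L k n-split vertices-length bound core-length

  star-core : ∀ {z e} → e ∈ₗ star z → e ∈ₗ core × e ∈ₗ fan z (leaves z)
  star-core {z} = ∈-filter⁻ (_∈ₗ? fan z (leaves z))

  star-unique : ∀ z → Unique (star z)
  star-unique z = Uniqueₚ.filter⁺ (_∈ₗ? fan z (leaves z)) uniqCore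

  star≤choose₂ : ∀ z → length (star z) ≤ choose₂ (length (leaves z))
  star≤choose₂ z = ≤-trans (∈-Unique-length (star-unique z) (proj₂ ∘ star-core)) (≤-reflexive (length-fan z (leaves z)))

  star≤degree : ∀ z → length (star z) ≤ degree es z
  star≤degree z = ∈-Unique-length (star-unique z) λ e∈ →
    let e∈core , e∈fan = star-core e∈ ; _ , _ , _ , _ , _ , eq = ∈-fan⁻ (uniqLeaves z) e∈fan
    in ∈-filter⁺ (z ∈?_) (Sublist.lookup core⊆ e∈core) (subst (z ∈_) (sym eq) ∈tri₁)

-- Quasi-bipartite graphs

∣⁅⁆∪∣ : ∀ {n} (a : Fin n) {p : Subset n} → a ∉ p → ∣ ⁅ a ⁆ ∪ p ∣ ≡ suc ∣ p ∣
∣⁅⁆∪∣ zero {true ∷ p} a∉ = contradiction Vec.here a∉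
∣⁅⁆∪∣ zero {false ∷ p} _ = cong (suc ∘ ∣_∣) (⊥∪ p)
∣⁅⁆∪∣ (suc a) {true ∷ p} a∉ = cong suc (∣⁅⁆∪∣ a (a∉ ∘ Vec.there))
∣⁅⁆∪∣ (suc a) {false ∷ p} a∉ = ∣⁅⁆∪∣ a (a∉ ∘ Vec.there)

tri-size : ∀ {n} {a b c : Fin n} → a ≢ b → a ≢ c → b ≢ c → ∣ tri a b c ∣ ≡ 3
tri-size {a = a} {b} {c} a≢b a≢c b≢c =
  trans (cong ∣_∣ (∪-assoc ⁅ a ⁆ ⁅ b ⁆ ⁅ c ⁆))
    (trans (∣⁅⁆∪∣ a (λ a∈ → [ a≢b ∘ x∈⁅y⁆⇒x≡y b , a≢c ∘ x∈⁅y⁆⇒x≡y c ]′ (x∈p∪q⁻ ⁅ b ⁆ ⁅ c ⁆ a∈)))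
      (cong suc (trans (∣⁅⁆∪∣ b (b≢c ∘ x∈⁅y⁆⇒x≡y c)) (cong suc (∣⁅x⁆∣≡1 c)))))

Unique-++⁻ : {A : Set} (xs : List A) {ys : List A} → Unique (xs ++ ys) →
             Unique xs × Unique ys × (∀ {v} → v ∈ₗ xs → v ∉ₗ ys)
Unique-++⁻ [] u = [] , u , λ ()
Unique-++⁻ (x ∷ xs) (x∉ ∷ u) with Unique-++⁻ xs u
... | ux , uy , disj = All.tabulate (λ y∈ → All.lookup x∉ (∈-++⁺ˡ y∈)) ∷ ux , uy ,
      λ { (here refl) y∈ → All.lookup x∉ (∈-++⁺ʳ xs y∈) refl ; (there v∈) → disj v∈ }

cut : {A : Set} (k : ℕ) (xs : List A) → k ≤ length xs → ∃[ ys ] ∃[ zs ] (xs ≡ ys ++ zs × length ys ≡ k)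
cut zero xs _ = [] , xs , refl , refl
cut (suc k) (x ∷ xs) (s≤s h) with cut k xs h
... | ys , zs , refl , refl = x ∷ ys , zs , refl , refl

module _ {n : ℕ} where

  good-take : ∀ m {es : List (Subset n)} → Good es → Good (take m es)
  good-take m {es} g = record
    { size = All.tabulate (λ e∈ → All.lookup size (sub e∈))
    ; uniq = Uniqueₚ.take⁺ m uniq
    ; free = free ∘ path-⊆ sub }
    where
    open Good g
    sub : ∀ {e} → e ∈ₗ take m es → e ∈ₗ es
    sub = Sublist.lookup (Sublistₚ.take-⊆ m es)

  graph : {es : List (Subset n)} → Good es → Graph3 n
  graph {es} g = record { edges = es ; size3 = Good.size g ; distinct = Good.uniq g }

  good-graph : (H : Graph3 n) → P33Free H → Good (edges H)
  good-graph H free = record { size = size3 H ; uniq = distinct H ; free = free }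

  Δ-≤ : (H : Graph3 n) {B : ℕ} → (∀ v → degree (edges H) v ≤ B) → Δ H ≤ B
  Δ-≤ H = max-least (deg H) (allFin n)

  degree≤Δ : (H : Graph3 n) → ∀ v → degree (edges H) v ≤ Δ H
  degree≤Δ H v = max-upper (deg H) (∈-allFin v)

  -- Any good graph with at least m edges can be cut down to m edges.
  extremal-≤ : ∀ {m B} {H : Graph3 n} → InG n m H → {es : List (Subset n)} → Good es →
               m ≤ length es → (∀ v → degree es v ≤ B) → Δ H ≤ B
  extremal-≤ {m} (_ , _ , minimal) {es} g m≤ bnd = ≤-trans
    (minimal (graph (good-take m g)) (Good.free (good-take m g))
      (trans (length-take m es) (ℕₚ.m≤n⇒m⊓n≡m m≤)))
    (Δ-≤ (graph (good-take m g)) (λ v → ≤-trans (degree-mono (Sublistₚ.take-⊆ m es) v) (bnd v)))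

module QuasiBipartiteGraph {n : ℕ} (prs : List (Fin n × Fin n)) (zs : List (Fin n))
       (uniq : Unique (map proj₁ prs ++ map proj₂ prs ++ zs)) where

  firsts seconds : List (Fin n)
  firsts = map proj₁ prs
  seconds = map proj₂ prs

  uniqFirsts : Unique firsts
  uniqFirsts = proj₁ (Unique-++⁻ firsts uniq)

  uniqSeconds : Unique seconds
  uniqSeconds = proj₁ (Unique-++⁻ seconds (proj₁ (proj₂ (Unique-++⁻ firsts uniq))))

  uniqZs : Unique zs
  uniqZs = proj₁ (proj₂ (Unique-++⁻ seconds (proj₁ (proj₂ (Unique-++⁻ firsts uniq)))))

  first≢second : ∀ {v} → v ∈ₗ firsts → v ∉ₗ seconds
  first≢second f s = proj₂ (proj₂ (Unique-++⁻ firsts uniq)) f (∈-++⁺ˡ s)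

  first≢z : ∀ {v} → v ∈ₗ firsts → v ∉ₗ zs
  first≢z f z = proj₂ (proj₂ (Unique-++⁻ firsts uniq)) f (∈-++⁺ʳ seconds z)

  second≢z : ∀ {v} → v ∈ₗ seconds → v ∉ₗ zs
  second≢z = proj₂ (proj₂ (Unique-++⁻ seconds (proj₁ (proj₂ (Unique-++⁻ firsts uniq)))))

  key-unique : {B C : Set} (f : B → C) {xs : List B} → Unique (map f xs) →
               ∀ {x y} → x ∈ₗ xs → y ∈ₗ xs → f x ≡ f y → x ≡ y
  key-unique f (_ ∷ _) (here refl) (here refl) _ = refl
  key-unique f (x∉ ∷ _) (here refl) (there y∈) eq = contradiction eq (All.lookup x∉ (∈-map⁺ f y∈))
  key-unique f (y∉ ∷ _) (there x∈) (here refl) eq = contradiction (sym eq) (All.lookup y∉ (∈-map⁺ f x∈))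
  key-unique f (_ ∷ u) (there x∈) (there y∈) eq = key-unique f u x∈ y∈ eq

  edge : (Fin n × Fin n) × Fin n → Subset n
  edge ((x , y) , z) = tri x y z

  es : List (Subset n)
  es = map edge (cartesianProduct prs zs)

  es⁻ : ∀ {e} → e ∈ₗ es → ∃[ x ] ∃[ y ] ∃[ z ] ((x , y) ∈ₗ prs × z ∈ₗ zs × e ≡ tri x y z)
  es⁻ e∈ with ∈-map⁻ edge e∈
  ... | ((x , y) , z) , h , refl with ∈-cartesianProduct⁻ prs zs h
  ...   | xy∈ , z∈ = x , y , z , xy∈ , z∈ , refl

  first∈ : ∀ {x y v a b c} → (x , y) ∈ₗ prs → (a , b) ∈ₗ prs → c ∈ₗ zs → v ≡ x → v ∈ tri a b c → v ≡ a × y ≡ b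
  first∈ {a = a} {b} {c} xy∈ ab∈ c∈ refl v∈ with ∈tri⁻ {a = a} {b} {c} v∈
  ... | inj₁ refl = refl , cong proj₂ (key-unique proj₁ uniqFirsts xy∈ ab∈ refl)
  ... | inj₂ (inj₁ refl) = contradiction (∈-map⁺ proj₂ ab∈) (first≢second (∈-map⁺ proj₁ xy∈))
  ... | inj₂ (inj₂ refl) = contradiction c∈ (first≢z (∈-map⁺ proj₁ xy∈))

  second∈ : ∀ {x y v a b c} → (x , y) ∈ₗ prs → (a , b) ∈ₗ prs → c ∈ₗ zs → v ≡ y → v ∈ tri a b c → v ≡ b × x ≡ a
  second∈ {a = a} {b} {c} xy∈ ab∈ c∈ refl v∈ with ∈tri⁻ {a = a} {b} {c} v∈
  ... | inj₁ refl = contradiction (∈-map⁺ proj₂ xy∈) (first≢second (∈-map⁺ proj₁ ab∈))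
  ... | inj₂ (inj₁ refl) = refl , cong proj₁ (key-unique proj₂ uniqSeconds xy∈ ab∈ refl)
  ... | inj₂ (inj₂ refl) = contradiction c∈ (second≢z (∈-map⁺ proj₂ xy∈))

  z∈ : ∀ {v z a b c} → z ∈ₗ zs → (a , b) ∈ₗ prs → v ≡ z → v ∈ tri a b c → v ≡ c
  z∈ {a = a} {b} {c} z∈ ab∈ refl v∈ with ∈tri⁻ {a = a} {b} {c} v∈
  ... | inj₁ refl = contradiction z∈ (first≢z (∈-map⁺ proj₁ ab∈))
  ... | inj₂ (inj₁ refl) = contradiction z∈ (second≢z (∈-map⁺ proj₂ ab∈))
  ... | inj₂ (inj₂ eq) = eq

  size : All (λ e → ∣ e ∣ ≡ 3) es
  size = All.tabulate three
    where
    three : ∀ {e} → e ∈ₗ es → ∣ e ∣ ≡ 3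
    three e∈ with es⁻ e∈
    ... | x , y , z , xy∈ , zz∈ , refl = tri-size {a = x} {y} {z}
      (λ { refl → first≢second (∈-map⁺ proj₁ xy∈) (∈-map⁺ proj₂ xy∈) })
      (λ { refl → first≢z (∈-map⁺ proj₁ xy∈) zz∈ })
      (λ { refl → second≢z (∈-map⁺ proj₂ xy∈) zz∈ })

  unique : Unique es
  unique = Unique-map edge inj (Uniqueₚ.cartesianProduct⁺ (Uniqueₚ.map⁻ uniqFirsts) uniqZs)
    where
    inj : ∀ {p q} → p ∈ₗ cartesianProduct prs zs → q ∈ₗ cartesianProduct prs zs → edge p ≡ edge q → p ≡ q
    inj {(x , y) , z} {(a , b) , c} p∈ q∈ eq with ∈-cartesianProduct⁻ prs zs p∈ | ∈-cartesianProduct⁻ prs zs q∈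
    ... | xy∈ , zz∈ | ab∈ , c∈ with first∈ xy∈ ab∈ c∈ refl (subst (x ∈_) eq ∈tri₁) | z∈ zz∈ ab∈ refl (subst (z ∈_) eq ∈tri₃)
    ...   | refl , refl | refl = refl

  -- An edge meeting {x, y, z} in x also contains the twin y.
  meet-in-z : ∀ {e x y z v} → e ∈ₗ es → (x , y) ∈ₗ prs → z ∈ₗ zs → v ∈ e → v ∈ tri x y z →
    (∀ {u} → u ∈ e → u ∈ tri x y z → u ≡ v) → v ≡ z
  meet-in-z {x = x} {y} {z} e∈ xy∈ zz∈ v∈e v∈ single with es⁻ e∈ | ∈tri⁻ {a = x} {y} {z} v∈
  ... | _ | inj₂ (inj₂ eq) = eq
  ... | a , b , c , ab∈ , c∈ , refl | inj₁ refl with first∈ xy∈ ab∈ c∈ refl v∈e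
  ...   | refl , refl = contradiction (subst (_∈ₗ seconds) (single ∈tri₂ ∈tri₂) (∈-map⁺ proj₂ xy∈)) (first≢second (∈-map⁺ proj₁ xy∈))
  meet-in-z {x = x} {y} {z} e∈ xy∈ zz∈ v∈e v∈ single | a , b , c , ab∈ , c∈ , refl | inj₂ (inj₁ refl)
    with second∈ xy∈ ab∈ c∈ refl v∈e
  ...   | refl , refl = contradiction (∈-map⁺ proj₂ xy∈) (first≢second (subst (_∈ₗ firsts) (single ∈tri₁ ∈tri₁) (∈-map⁺ proj₁ xy∈)))

  -- Both outer edges meet the middle one in its vertex from `zs`, so they cannot be disjoint.
  free : ¬ HasPath es
  free (e , f , g , e∈ , f∈ , g∈ , ef , fg , eg) with es⁻ f∈ | ∩-one⁻ {e = e} {f} ef | ∩-one⁻ {e = f} {g} fg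
  ... | x , y , z , xy∈ , zz∈ , refl | v , v∈e , v∈f , single | w , w∈f , w∈g , single′
    with meet-in-z e∈ xy∈ zz∈ v∈e v∈f single | meet-in-z g∈ xy∈ zz∈ w∈g w∈f (λ p q → single′ q p)
  ...   | refl | refl = ∩-zero⁻ {e = e} {g} eg v∈e w∈g

  good : Good es
  good = record { size = size ; uniq = unique ; free = free }

  es-length : length es ≡ length prs * length zs
  es-length = trans (length-map edge (cartesianProduct prs zs)) (length-cartesianProductWith _,_ prs zs)

  degree≤2n : ∀ v → degree es v ≤ 2 * n
  degree≤2n v = ≤-trans (∈-Unique-length (Uniqueₚ.filter⁺ (v ∈?_) unique) covered)
    (≤-trans (≤-reflexive (trans (length-++ byPair) (cong₂ _+_ (length-map _ prs) (length-map _ zs))))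
      (+-mono-≤ (≤-trans (≤-reflexive (sym (length-map proj₁ prs))) (length-unique-Fin uniqFirsts))
        (≤-trans (length-unique-Fin uniqZs) (m≤m+n n 0))))
    where
    byPair : List (Subset n)
    byPair = map (λ p → edge (p , v)) prs
    own : ∃[ q ] (∀ {x y} → (x , y) ∈ₗ prs → v ≡ x ⊎ v ≡ y → q ≡ (x , y))
    own with Any.any? (v Fin.≟_) firsts | Any.any? (v Fin.≟_) seconds
    ... | yes f | _ with ∈-map⁻ proj₁ f
    ...   | q , q∈ , refl = q , λ { xy∈ (inj₁ eq) → key-unique proj₁ uniqFirsts q∈ xy∈ eq
                                  ; xy∈ (inj₂ refl) → contradiction (∈-map⁺ proj₂ xy∈) (first≢second f) }
    own | no nf | yes s with ∈-map⁻ proj₂ s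
    ...   | q , q∈ , refl = q , λ { xy∈ (inj₁ refl) → contradiction (∈-map⁺ proj₁ xy∈) nf
                                  ; xy∈ (inj₂ eq) → key-unique proj₂ uniqSeconds q∈ xy∈ eq }
    -- An arbitrary value: v belongs to no pair.
    own | no nf | no ns = (v , v) , λ { xy∈ (inj₁ refl) → contradiction (∈-map⁺ proj₁ xy∈) nf
                                      ; xy∈ (inj₂ refl) → contradiction (∈-map⁺ proj₂ xy∈) ns }
    byZ : List (Subset n)
    byZ = map (λ z → edge (proj₁ own , z)) zs
    covered : ∀ {e} → e ∈ₗ filter (v ∈?_) es → e ∈ₗ byPair ++ byZ
    covered e∈ with ∈-filter⁻ (v ∈?_) {xs = es} e∈
    ... | e∈es , v∈e with es⁻ e∈es
    ...   | x , y , z , xy∈ , zz∈ , refl with ∈tri⁻ {a = x} {y} {z} v∈e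
    ...     | inj₂ (inj₂ refl) = ∈-++⁺ˡ (∈-map⁺ (λ p → edge (p , v)) xy∈)
    ...     | inj₁ eq = ∈-++⁺ʳ byPair (subst (λ q → edge (q , z) ∈ₗ byZ) (proj₂ own xy∈ (inj₁ eq)) (∈-map⁺ _ zz∈))
    ...     | inj₂ (inj₁ eq) = ∈-++⁺ʳ byPair (subst (λ q → edge (q , z) ∈ₗ byZ) (proj₂ own xy∈ (inj₂ eq)) (∈-map⁺ _ zz∈))

map-proj₁-zip : {A B : Set} (xs : List A) (ys : List B) → length xs ≡ length ys → map proj₁ (List.zip xs ys) ≡ xs
map-proj₁-zip [] [] _ = refl
map-proj₁-zip (x ∷ xs) (y ∷ ys) h = cong (x ∷_) (map-proj₁-zip xs ys (ℕₚ.suc-injective h))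

map-proj₂-zip : {A B : Set} (xs : List A) (ys : List B) → length xs ≡ length ys → map proj₂ (List.zip xs ys) ≡ ys
map-proj₂-zip [] [] _ = refl
map-proj₂-zip (x ∷ xs) (y ∷ ys) h = cong (y ∷_) (map-proj₂-zip xs ys (ℕₚ.suc-injective h))

length-allFin : ∀ n → length (allFin n) ≡ n
length-allFin n = Listₚ.length-tabulate {n = n} id

module _ {n : ℕ} where

  twin-blocks : ∀ s t → s + (s + t) ≤ n →
    ∃[ prs ] ∃[ zs ] (Unique (map proj₁ prs ++ map proj₂ prs ++ zs) × length prs ≡ s × length {A = Fin n} zs ≡ t)
  twin-blocks s t h with cut (s + (s + t)) (allFin n) (≤-trans h (≤-reflexive (sym (length-allFin n))))
  ... | as , _ , eq , len with cut s as (≤-trans (m≤m+n s (s + t)) (≤-reflexive (sym len)))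
  ...   | xs , bs , refl , refl with ℕₚ.+-cancelˡ-≡ (length xs) _ _ (trans (sym (length-++ xs)) len)
  ...     | len′ with cut (length xs) bs (≤-trans (m≤m+n (length xs) t) (≤-reflexive (sym len′)))
  ...       | ys , zs , refl , lys =
    List.zip xs ys , zs
    , subst Unique (cong₂ _++_ (sym eq₁) (cong (_++ zs) (sym (map-proj₂-zip xs ys (sym lys))))) u
    , trans (sym (length-map proj₁ (List.zip xs ys))) (cong length eq₁)
    , ℕₚ.+-cancelˡ-≡ (length xs) _ _ (trans (cong (_+ length zs) (sym lys)) (trans (sym (length-++ ys)) len′))
    where
    eq₁ : map proj₁ (List.zip xs ys) ≡ xs
    eq₁ = map-proj₁-zip xs ys (sym lys)
    u : Unique (xs ++ ys ++ zs)
    u = proj₁ (Unique-++⁻ (xs ++ ys ++ zs) (subst Unique eq (Uniqueₚ.allFin⁺ n)))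

  extremal-Δ≤2n : ∀ {m} {H : Graph3 n} → InG n m H → 40 * m ≤ 5 * (n * n) → Δ H ≤ 2 * n
  extremal-Δ≤2n {m} {H} inG h with balanced-split n m h
  ... | s , t , fits , m≤ with twin-blocks s t fits
  ...   | prs , zs , u , refl , refl =
    extremal-≤ {H = H} inG good (≤-trans m≤ (≤-reflexive (sym es-length))) degree≤2n
    where open QuasiBipartiteGraph prs zs u

  covers : {vs : List (Fin n)} → Unique vs → length vs ≡ n → ∀ v → v ∈ₗ vs
  covers {vs} u len v with Any.any? (v Fin.≟_) vs
  ... | yes v∈ = v∈
  ... | no v∉ = contradiction
    (length-unique-Fin (All.tabulate (λ w∈ eq → v∉ (subst (_∈ₗ vs) (sym eq) w∈)) ∷ u))
    (λ h → ℕₚ.1+n≰n (≤-trans h (≤-reflexive (sym len))))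

-- Quasi-bipartiteness just below n²/8

lookup-map-injective : {A B : Set} (f : A → B) {xs : List A} → Unique (map f xs) →
  ∀ i j → f (List.lookup xs i) ≡ f (List.lookup xs j) → i ≡ j
lookup-map-injective f {_ ∷ _} _ zero zero _ = refl
lookup-map-injective f {_ ∷ xs} (x∉ ∷ _) zero (suc j) eq = contradiction eq (All.lookup x∉ (∈-map⁺ f (∈-lookup {xs = xs} j)))
lookup-map-injective f {_ ∷ xs} (x∉ ∷ _) (suc i) zero eq = contradiction (sym eq) (All.lookup x∉ (∈-map⁺ f (∈-lookup {xs = xs} i)))
lookup-map-injective f {_ ∷ _} (_ ∷ u) (suc i) (suc j) eq = cong suc (lookup-map-injective f u i j eq)

length≡0⇒[] : {A : Set} {xs : List A} → length xs ≡ 0 → xs ≡ []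
length≡0⇒[] {xs = []} _ = refl

module TwinCover {n : ℕ} (H : Graph3 n) (D : Decomposition (edges H)) where
  open Decomposition D
  open Counts D

  quasiBipartite : L + k ≡ 0 → QuasiBipartite H
  quasiBipartite none = s , t , ⤖⇒↔ (mk⤖ (injective , surjective)) , All.tabulate every-edge
    where
    L≡0 : L ≡ 0
    L≡0 = ℕₚ.m+n≡0⇒m≡0 L none
    all-vertices : length vertices ≡ n
    all-vertices = full {s = s} {t} {L} {k} n-split vertices-length none
    -- With all n vertices present, `bound` says that the core has as many edges as H, and a sublist
    -- of full length is the whole list.
    core≡edges : core ≡ edges H
    core≡edges = Pointwise-≡⇒≡ (Hetero.toPointwise (ℕₚ.≤-antisym (Hetero.length-mono-≤ core⊆)
      (ℕₚ.+-cancelʳ-≤ (7 * n) _ _ (subst (λ v → length (edges H) + 7 * v ≤ length core + 7 * n) all-vertices bound))) core⊆)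
    no-leaves : concatMap leaves centers ≡ []
    no-leaves = length≡0⇒[] (trans (length-concatMap leaves centers) L≡0)
    firsts seconds : List (Fin n)
    firsts = map proj₁ prs
    seconds = map proj₂ prs
    f : Fin s ⊎ (Fin s ⊎ Fin t) → Fin n
    f (inj₁ i) = proj₁ (List.lookup prs i)
    f (inj₂ (inj₁ i)) = proj₂ (List.lookup prs i)
    f (inj₂ (inj₂ j)) = List.lookup centers j
    uC = Unique-++⁻ centers uniqVertices
    uF = Unique-++⁻ firsts (proj₁ (proj₂ uC))
    uS = Unique-++⁻ seconds (proj₁ (proj₂ uF))
    f₁∈ : ∀ i → f (inj₁ i) ∈ₗ firsts
    f₁∈ i = ∈-map⁺ proj₁ (∈-lookup {xs = prs} i)
    f₂∈ : ∀ i → f (inj₂ (inj₁ i)) ∈ₗ seconds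
    f₂∈ i = ∈-map⁺ proj₂ (∈-lookup {xs = prs} i)
    f₃∈ : ∀ j → f (inj₂ (inj₂ j)) ∈ₗ centers
    f₃∈ j = ∈-lookup {xs = centers} j
    first≢second : ∀ i j → f (inj₁ i) ≢ f (inj₂ (inj₁ j))
    first≢second i j eq = proj₂ (proj₂ uF) (f₁∈ i) (∈-++⁺ˡ (subst (_∈ₗ seconds) (sym eq) (f₂∈ j)))
    first≢center : ∀ i j → f (inj₁ i) ≢ f (inj₂ (inj₂ j))
    first≢center i j eq = proj₂ (proj₂ uC) (f₃∈ j) (∈-++⁺ˡ (subst (_∈ₗ firsts) eq (f₁∈ i)))
    second≢center : ∀ i j → f (inj₂ (inj₁ i)) ≢ f (inj₂ (inj₂ j))
    second≢center i j eq = proj₂ (proj₂ uC) (f₃∈ j) (∈-++⁺ʳ firsts (∈-++⁺ˡ (subst (_∈ₗ seconds) eq (f₂∈ i))))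
    injective : ∀ {x y} → f x ≡ f y → x ≡ y
    injective {inj₁ i} {inj₁ j} eq = cong inj₁ (lookup-map-injective proj₁ (proj₁ uF) i j eq)
    injective {inj₁ i} {inj₂ (inj₁ j)} eq = contradiction eq (first≢second i j)
    injective {inj₁ i} {inj₂ (inj₂ j)} eq = contradiction eq (first≢center i j)
    injective {inj₂ (inj₁ i)} {inj₁ j} eq = contradiction (sym eq) (first≢second j i)
    injective {inj₂ (inj₁ i)} {inj₂ (inj₁ j)} eq = cong (inj₂ ∘ inj₁) (lookup-map-injective proj₂ (proj₁ uS) i j eq)
    injective {inj₂ (inj₁ i)} {inj₂ (inj₂ j)} eq = contradiction eq (second≢center i j)
    injective {inj₂ (inj₂ i)} {inj₁ j} eq = contradiction (sym eq) (first≢center j i)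
    injective {inj₂ (inj₂ i)} {inj₂ (inj₁ j)} eq = contradiction (sym eq) (second≢center j i)
    injective {inj₂ (inj₂ i)} {inj₂ (inj₂ j)} eq = cong (inj₂ ∘ inj₂)
      (lookup-map-injective id (subst Unique (sym (Listₚ.map-id centers)) (proj₁ uC)) i j eq)
    preimage : ∀ v → ∃[ x ] f x ≡ v
    preimage v with ∈-++⁻ centers (covers uniqVertices all-vertices v)
    ... | inj₁ c = inj₂ (inj₂ (Any.index c)) , sym (lookup-index c)
    ... | inj₂ r with ∈-++⁻ firsts r
    ...   | inj₁ p with ∈-map⁻ proj₁ p
    ...     | _ , vw∈ , refl = inj₁ (Any.index vw∈) , cong proj₁ (sym (lookup-index vw∈))
    preimage v | inj₂ r | inj₂ r′ with ∈-++⁻ seconds r′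
    ... | inj₂ l = contradiction (subst (v ∈ₗ_) no-leaves l) λ ()
    ... | inj₁ p with ∈-map⁻ proj₂ p
    ...     | _ , vw∈ , refl = inj₂ (inj₁ (Any.index vw∈)) , cong proj₂ (sym (lookup-index vw∈))
    surjective : ∀ v → ∃[ x ] (∀ {z} → z ≡ x → f z ≡ v)
    surjective v = let x , eq = preimage v in x , λ { refl → eq }
    every-edge : ∀ {e} → e ∈ₗ edges H → ∃[ i ] ∃[ j ] e ≡ tri (f (inj₁ i)) (f (inj₂ (inj₁ i))) (f (inj₂ (inj₂ j)))
    every-edge {e} e∈ with classified (subst (e ∈ₗ_) (sym core≡edges) e∈)
    ... | inj₁ (vw , z , vw∈ , z∈ , refl) = Any.index vw∈ , Any.index z∈ ,
      cong₂ (λ p u → tri (proj₁ p) (proj₂ p) u) (lookup-index vw∈) (lookup-index z∈)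
    ... | inj₂ (z , z∈ , e∈fan) with ∈-fan⁻ (uniqLeaves z) e∈fan
    ...   | a , _ , a∈ , _ = contradiction
      (subst (a ∈ₗ_) no-leaves (∈-concatMap⁺ leaves (Any.map (λ { refl → a∈ }) z∈))) λ ()

near-maximum⇒quasiBipartite : ∀ n m → 1008 ≤ n → 5 * (n * n) ≤ 40 * m + 8 * n → 40 * m ≤ 5 * (n * n) →
  (H : Graph3 n) → InG n m H → QuasiBipartite H
near-maximum⇒quasiBipartite n m n≥ lower upper H inG@(free , refl , _) =
  TwinCover.quasiBipartite H D (twin-cover-deficit s t L k n-split (≤-trans (ℕₚ.m≤m+n 224 784) n≥) size-bound
    (scale-sums 32 n (length ∘ star) (length ∘ leaves) centers (λ {z} _ → sparse-star-ratio {n} {length (leaves z)} n≥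
      (≤-trans (star≤degree z) (≤-trans (degree≤Δ H z) (extremal-Δ≤2n {H = H} inG upper))) (star≤choose₂ z)))
    lower)
  where
  D : Decomposition (edges H)
  D = decompose (good-graph H free)
  open Decomposition D
  open Counts D

-- Star forests

pairs-unique : {A : Set} {xs : List A} → Unique xs → Unique (pairs xs)
pairs-unique [] = []
pairs-unique {xs = x ∷ xs} (x∉ ∷ u) = Uniqueₚ.++⁺ (Uniqueₚ.map⁺ (cong proj₂) u) (pairs-unique u)
  λ (p , q) → let _ , _ , eq = ∈-map⁻ (x ,_) p in
    All.lookup x∉ (proj₁ (∈-pairs⁻ u q)) (sym (cong proj₁ eq))

-- Prepares `fan-unique`: the pairs (a, b) and (b, a) would give the same edge.
pairs-asym : {A : Set} {xs : List A} → Unique xs → ∀ {a b} → (a , b) ∈ₗ pairs xs → (b , a) ∉ₗ pairs xs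
pairs-asym {xs = x ∷ xs} (x∉ ∷ u) {a} {b} p q with ∈-++⁻ (map (x ,_) xs) p | ∈-++⁻ (map (x ,_) xs) q
... | inj₂ p′ | inj₂ q′ = pairs-asym u p′ q′
... | inj₁ p′ | inj₁ q′ with ∈-map⁻ (x ,_) p′ | ∈-map⁻ (x ,_) q′
...   | _ , b∈ , refl | _ , _ , refl = All.lookup x∉ b∈ refl
pairs-asym {xs = x ∷ xs} (x∉ ∷ u) p q | inj₁ p′ | inj₂ q′ with ∈-map⁻ (x ,_) p′
...   | _ , _ , refl = All.lookup x∉ (proj₁ (proj₂ (∈-pairs⁻ u q′))) refl
pairs-asym {xs = x ∷ xs} (x∉ ∷ u) p q | inj₂ p′ | inj₁ q′ with ∈-map⁻ (x ,_) q′
...   | _ , _ , refl = All.lookup x∉ (proj₁ (proj₂ (∈-pairs⁻ u p′))) refl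

module _ {n : ℕ} where

  Meets : Subset n → Subset n → Set
  Meets e f = ∃[ v ] (v ∈ e × v ∈ f)

  -- The stars enter only through `transitive`: meeting is inherited by disjoint unions, and it
  -- rules out a loose path, whose outer edges meet the middle one but not each other. `support`
  -- keeps the unions disjoint.
  record StarForest (vs : List (Fin n)) (B : ℕ) (es : List (Subset n)) : Set where
    field
      size       : ∀ {e} → e ∈ₗ es → ∣ e ∣ ≡ 3
      uniq       : Unique es
      support    : ∀ {e v} → e ∈ₗ es → v ∈ e → v ∈ₗ vs
      transitive : ∀ {e f g} → e ∈ₗ es → f ∈ₗ es → g ∈ₗ es → Meets e f → Meets f g → Meets e g
      bounded    : ∀ v → degree es v ≤ B

  open StarForest

  forest-good : ∀ {vs B es} → StarForest vs B es → Good es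
  forest-good F = record
    { size = All.tabulate (size F)
    ; uniq = uniq F
    ; free = λ { (e , f , g , e∈ , f∈ , g∈ , ef , fg , eg) →
        let v , v∈e , v∈f , _ = ∩-one⁻ {e = e} {f} ef
            w , w∈f , w∈g , _ = ∩-one⁻ {e = f} {g} fg
            u , u∈e , u∈g = transitive F e∈ f∈ g∈ (v , v∈e , v∈f) (w , w∈f , w∈g)
        in ∩-zero⁻ {e = e} {g} eg u∈e u∈g } }

  degree-outside : ∀ {es : List (Subset n)} {v} → (∀ {e} → e ∈ₗ es → v ∉ e) → degree es v ≡ 0
  degree-outside {[]} h = refl
  degree-outside {e ∷ es} {v} h with v ∈? e
  ... | yes v∈ = contradiction v∈ (h (here refl))
  ... | no _ = degree-outside (h ∘ there)

  degree-++ : ∀ (es : List (Subset n)) {fs} v → degree (es ++ fs) v ≡ degree es v + degree fs v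
  degree-++ es {fs} v = trans (cong length (Listₚ.filter-++ (v ∈?_) es fs)) (length-++ (filter (v ∈?_) es))

  nonempty-edge : {e : Subset n} → ∣ e ∣ ≡ 3 → ∃[ v ] v ∈ e
  nonempty-edge {e} h with card-three {p = e} h
  ... | a , b , c , refl = a , ∈tri₁

  forest-++ : ∀ {vs ws B es fs} → StarForest vs B es → StarForest ws B fs → (∀ {v} → v ∈ₗ vs → v ∉ₗ ws) →
              StarForest (vs ++ ws) B (es ++ fs)
  forest-++ {vs} {ws} {B} {es} {fs} F G disj = record
    { size = λ e∈ → [ size F , size G ]′ (∈-++⁻ es e∈)
    ; uniq = Uniqueₚ.++⁺ (uniq F) (uniq G) (λ (p , q) → let v , v∈ = nonempty-edge (size F p) in apart p q v∈ v∈)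
    ; support = λ e∈ v∈ → [ (λ h → ∈-++⁺ˡ (support F h v∈)) , (λ h → ∈-++⁺ʳ vs (support G h v∈)) ]′ (∈-++⁻ es e∈)
    ; transitive = λ e∈ f∈ g∈ → trans′ (∈-++⁻ es e∈) (∈-++⁻ es f∈) (∈-++⁻ es g∈)
    ; bounded = bound }
    where
    apart : ∀ {e f v} → e ∈ₗ es → f ∈ₗ fs → v ∈ e → v ∈ f → ⊥
    apart p q v∈e v∈f = disj (support F p v∈e) (support G q v∈f)
    trans′ : ∀ {e f g} → e ∈ₗ es ⊎ e ∈ₗ fs → f ∈ₗ es ⊎ f ∈ₗ fs → g ∈ₗ es ⊎ g ∈ₗ fs → Meets e f → Meets f g → Meets e g
    trans′ (inj₁ p) (inj₁ q) (inj₁ r) h k = transitive F p q r h k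
    trans′ (inj₂ p) (inj₂ q) (inj₂ r) h k = transitive G p q r h k
    trans′ (inj₁ p) (inj₂ q) _ (_ , a , b) _ = ⊥-elim (apart p q a b)
    trans′ (inj₂ p) (inj₁ q) _ (_ , a , b) _ = ⊥-elim (apart q p b a)
    trans′ _ (inj₁ q) (inj₂ r) _ (_ , a , b) = ⊥-elim (apart q r a b)
    trans′ _ (inj₂ q) (inj₁ r) _ (_ , a , b) = ⊥-elim (apart r q b a)
    bound : ∀ v → degree (es ++ fs) v ≤ B
    bound v with Any.any? (v Fin.≟_) vs
    ... | yes v∈ = ≤-trans (≤-reflexive (trans (degree-++ es v) (trans (cong (degree es v +_)
        (degree-outside (λ e∈ v∈e → disj v∈ (support G e∈ v∈e)))) (ℕₚ.+-identityʳ _)))) (bounded F v)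
    ... | no v∉ = ≤-trans (≤-reflexive (trans (degree-++ es v) (cong (_+ degree fs v)
        (degree-outside (λ e∈ v∈e → v∉ (support F e∈ v∈e)))))) (bounded G v)

  fan-unique : {c : Fin n} {ls : List (Fin n)} → Unique (c ∷ ls) → Unique (fan c ls)
  fan-unique {c} {ls} (c∉ ∷ u) = Unique-map _ inj (pairs-unique u)
    where
    inj : ∀ {p q} → p ∈ₗ pairs ls → q ∈ₗ pairs ls →
          tri c (proj₁ p) (proj₂ p) ≡ tri c (proj₁ q) (proj₂ q) → p ≡ q
    inj {a , b} {a′ , b′} p q eq with ∈-pairs⁻ u p
    ... | a∈ , b∈ , a≢b with ∈tri⁻ {a = c} {a′} {b′} (subst (a ∈_) eq ∈tri₂) | ∈tri⁻ {a = c} {a′} {b′} (subst (b ∈_) eq ∈tri₃)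
    ...   | inj₁ refl | _ = contradiction refl (All.lookup c∉ a∈)
    ...   | _ | inj₁ refl = contradiction refl (All.lookup c∉ b∈)
    ...   | inj₂ (inj₁ refl) | inj₂ (inj₁ refl) = contradiction refl a≢b
    ...   | inj₂ (inj₁ refl) | inj₂ (inj₂ refl) = refl
    ...   | inj₂ (inj₂ refl) | inj₂ (inj₁ refl) = contradiction q (pairs-asym u p)
    ...   | inj₂ (inj₂ refl) | inj₂ (inj₂ refl) = contradiction refl a≢b

  star-forest : ∀ {c ls τ B} → Unique (c ∷ ls) → τ ≤ B → n ≤ B → StarForest (c ∷ ls) B (take τ (fan c ls))
  star-forest {c} {ls} {τ} {B} u@(c∉ ∷ uls) τ≤ n≤ = record
    { size = three ∘ fan-form ∘ sub
    ; uniq = Uniqueₚ.take⁺ τ (fan-unique u)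
    ; support = λ e∈ → supp (fan-form (sub e∈))
    ; transitive = λ e∈ _ g∈ _ _ → c , center (fan-form (sub e∈)) , center (fan-form (sub g∈))
    ; bounded = bound }
    where
    es = take τ (fan c ls)
    FanForm : Subset n → Set
    FanForm e = ∃[ a ] ∃[ b ] (a ∈ₗ ls × b ∈ₗ ls × a ≢ b × e ≡ tri c a b)
    sub : ∀ {e} → e ∈ₗ es → e ∈ₗ fan c ls
    sub = Sublist.lookup (Sublistₚ.take-⊆ τ (fan c ls))
    fan-form : ∀ {e} → e ∈ₗ fan c ls → FanForm e
    fan-form = ∈-fan⁻ uls
    three : ∀ {e} → FanForm e → ∣ e ∣ ≡ 3
    three (a , b , a∈ , b∈ , a≢b , refl) = tri-size {a = c} {a} {b} (All.lookup c∉ a∈) (All.lookup c∉ b∈) a≢b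
    supp : ∀ {e v} → FanForm e → v ∈ e → v ∈ₗ c ∷ ls
    supp (a , b , a∈ , b∈ , a≢b , refl) v∈ with ∈tri⁻ {a = c} {a} {b} v∈
    ... | inj₁ refl = here refl
    ... | inj₂ (inj₁ refl) = there a∈
    ... | inj₂ (inj₂ refl) = there b∈
    center : ∀ {e} → FanForm e → c ∈ e
    center (a , b , _ , _ , _ , refl) = ∈tri₁
    bound : ∀ v → degree es v ≤ B
    bound v with v Fin.≟ c
    ... | yes _ = ≤-trans (Listₚ.length-filter (v ∈?_) es)
        (≤-trans (≤-reflexive (length-take τ (fan c ls))) (≤-trans (ℕₚ.m⊓n≤m τ _) τ≤))
    -- A leaf is on at most one edge per other leaf; here n ≤ B enters.
    ... | no v≢c = ≤-trans (∈-Unique-length (Uniqueₚ.filter⁺ (v ∈?_) (Uniqueₚ.take⁺ τ (fan-unique u))) covered)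
        (≤-trans (≤-reflexive (length-map (tri c v) ls)) (≤-trans (length-unique-Fin uls) n≤))
      where
      covered : ∀ {e} → e ∈ₗ filter (v ∈?_) es → e ∈ₗ map (tri c v) ls
      covered e∈ with ∈-filter⁻ (v ∈?_) {xs = es} e∈
      ... | e∈es , v∈e with fan-form (sub e∈es)
      ...   | a , b , a∈ , b∈ , a≢b , refl with ∈tri⁻ {a = c} {a} {b} v∈e
      ...     | inj₁ eq = contradiction eq v≢c
      ...     | inj₂ (inj₁ refl) = ∈-map⁺ (tri c v) b∈
      ...     | inj₂ (inj₂ refl) = subst (_∈ₗ _) (tri-swap₂₃ c b a) (∈-map⁺ (tri c v) a∈)

  empty-forest : ∀ {vs B} → StarForest vs B []
  empty-forest = record { size = λ () ; uniq = [] ; support = λ () ; transitive = λ () ; bounded = λ _ → z≤n }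

  -- A specification (y , τ) asks for a star with y leaves and τ edges.
  forest : ∀ {B} (specs : List (ℕ × ℕ)) (vs : List (Fin n)) → Unique vs → n ≤ B →
    All (λ s → proj₂ s ≤ choose₂ (proj₁ s) × proj₂ s ≤ B) specs →
    sum (map (suc ∘ proj₁) specs) ≤ length vs →
    ∃[ es ] (StarForest vs B es × length es ≡ sum (map proj₂ specs))
  forest [] vs u n≤ _ _ = [] , empty-forest , refl
  forest ((y , τ) ∷ specs) vs u n≤ ((τ≤C , τ≤B) ∷ ok) fits with cut (suc y) vs (≤-trans (m≤m+n (suc y) _) fits)
  ... | c ∷ ls , ws , refl , len with Unique-++⁻ (c ∷ ls) u
  ...   | ucls , uws , disj with forest specs ws uws n≤ ok
          (ℕₚ.+-cancelˡ-≤ (suc y) _ _ (≤-trans fits (≤-reflexive (trans (length-++ (c ∷ ls)) (cong (_+ length ws) len)))))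
  ...     | fs , F , lfs = take τ (fan c ls) ++ fs , forest-++ (star-forest ucls τ≤B n≤) F disj ,
      trans (length-++ (take τ (fan c ls))) (cong₂ _+_ (trans (length-take τ (fan c ls))
        (ℕₚ.m≤n⇒m⊓n≡m (≤-trans τ≤C (≤-reflexive (sym (trans (length-fan c ls) (cong choose₂ (ℕₚ.suc-injective len)))))))) lfs)

  -- A forest with at least m edges and all degrees below Δ H could be cut down to m edges, against
  -- the minimality of Δ H.
  extremal-beats-forests : ∀ {m B} {H : Graph3 n} → InG n m H → B < Δ H → n ≤ B → (specs : List (ℕ × ℕ)) →
    All (λ s → proj₂ s ≤ choose₂ (proj₁ s) × proj₂ s ≤ B) specs →
    sum (map (suc ∘ proj₁) specs) ≤ n → sum (map proj₂ specs) < m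
  extremal-beats-forests {m} {B} {H} inG B<Δ n≤ specs ok fits
    with forest specs (allFin n) (Uniqueₚ.allFin⁺ n) n≤ ok (≤-trans fits (≤-reflexive (sym (length-allFin n))))
  ... | es , F , len = ≰⇒> λ m≤ → <⇒≱ B<Δ
    (extremal-≤ {H = H} inG (forest-good F) (≤-trans m≤ (≤-reflexive (sym len))) (bounded F))

-- Above n²/8

degrees-large : ∀ {n m} {H : Graph3 n} → Decomposition (edges H) → 56 ≤ n → ∥ H ∥ ≡ m → n * n < 8 * m → n * n ≤ 32 * Δ H
degrees-large {n} {H = H} D n≥ refl lower with n * n ℕ.≤? 32 * Δ H
... | yes h = h
... | no h = contradiction (quadratic-bound s t L k n-split n≥ size-bound
    (scale-sums 8 n (length ∘ star) (length ∘ leaves) centers (λ {z} _ →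
      dense-star-ratio {n} {length (leaves z)} (≰⇒> h) (≤-trans (star≤degree z) (degree≤Δ H z)) (star≤choose₂ z))))
    (<⇒≱ lower)
  where
  open Decomposition D
  open Counts D

-- Ordering the centers by their numbers of leaves

module _ {A : Set} (f : A → ℕ) where

  Descending : List A → Set
  Descending = AllPairs.AllPairs (λ x y → f y ≤ f x)

  insert : ∀ x {ws} → Descending ws → ∃[ vs ] (x ∷ ws ↭ vs × Descending vs)
  insert x {[]} [] = x ∷ [] , ↭-refl , [] ∷ []
  insert x {w ∷ ws} (p ∷ d) with f w ℕ.≤? f x
  ... | yes h = x ∷ w ∷ ws , ↭-refl , (h ∷ All.map (λ k → ≤-trans k h) p) ∷ p ∷ d
  ... | no h with insert x d
  ...   | vs , perm , d′ = w ∷ vs , ↭-trans (swap x w ↭-refl) (prep w perm) ,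
      Permₚ.All-resp-↭ perm (ℕₚ.≰⇒≥ h ∷ p) ∷ d′

  sort : ∀ xs → ∃[ ws ] (xs ↭ ws × Descending ws)
  sort [] = [] , ↭-refl , []
  sort (x ∷ xs) with sort xs
  ... | ws , perm , d with insert x d
  ...   | vs , perm′ , d′ = vs , ↭-trans (prep x perm) perm′ , d′

Unique-concatMap⁻ : {A B : Set} (f : A → List B) {xs : List A} → Unique (concatMap f xs) →
  ∀ {x y v} → x ∈ₗ xs → y ∈ₗ xs → v ∈ₗ f x → v ∈ₗ f y → x ≡ y
Unique-concatMap⁻ f {x ∷ xs} u (here refl) (here refl) _ _ = refl
Unique-concatMap⁻ f {x ∷ xs} u (here refl) (there y∈) v∈ v∈′ =
  contradiction (∈-concatMap⁺ f (Any.map (λ { refl → v∈′ }) y∈)) (proj₂ (proj₂ (Unique-++⁻ (f x) u)) v∈)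
Unique-concatMap⁻ f {x ∷ xs} u (there x∈) (here refl) v∈ v∈′ =
  contradiction (∈-concatMap⁺ f (Any.map (λ { refl → v∈ }) x∈)) (proj₂ (proj₂ (Unique-++⁻ (f x) u)) v∈′)
Unique-concatMap⁻ f {x ∷ xs} u (there x∈) (there y∈) v∈ v∈′ =
  Unique-concatMap⁻ f (proj₁ (proj₂ (Unique-++⁻ (f x) u))) x∈ y∈ v∈ v∈′

-- Comparison of the extremal graph with star forests

gain-bound : ∀ {n m B c W} {H : Graph3 n} → InG n m H → Δ H ≡ suc B → n ≤ B → choose₂ c ≤ B →
  ∀ {σ₁ σ₂ σ₃ σ₄ ℓ₁ ℓ₂ ℓ₃ ℓ₄} → σ₁ ≤ choose₂ ℓ₁ → σ₂ ≤ choose₂ ℓ₂ → σ₃ ≤ choose₂ ℓ₃ → σ₄ ≤ choose₂ ℓ₄ →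
  σ₁ ≤ suc B → σ₂ ≤ suc B → σ₃ ≤ suc B → σ₄ ≤ suc B →
  m ≤ σ₁ + σ₂ + σ₃ + σ₄ + W → GainBound n c ℓ₁ ℓ₂ ℓ₃ ℓ₄ W
gain-bound {H = H} inG ΔH n≤B cap {σ₁} {σ₂} {σ₃} {σ₄} {ℓ₁} {ℓ₂} {ℓ₃} {ℓ₄} s₁ s₂ s₃ s₄ t₁ t₂ t₃ t₄ total x₁ x₂ x₃ x₄ b₁ b₂ b₃ b₄ fits
  with enlarge {ℓ = ℓ₁} cap s₁ t₁ b₁ | enlarge {ℓ = ℓ₂} cap s₂ t₂ b₂ | enlarge {ℓ = ℓ₃} cap s₃ t₃ b₃ | enlarge {ℓ = ℓ₄} cap s₄ t₄ b₄
... | τ₁ , u₁ , v₁ , g₁ | τ₂ , u₂ , v₂ , g₂ | τ₃ , u₃ , v₃ , g₃ | τ₄ , u₄ , v₄ , g₄ =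
  total-gain {σ₁ = σ₁} {σ₂} {σ₃} {σ₄} {τ₁} {τ₂} {τ₃} {τ₄} {x₁ * ℓ₁ + choose₂ x₁} {x₂ * ℓ₂ + choose₂ x₂} {x₃ * ℓ₃ + choose₂ x₃}
    total g₁ g₂ g₃ g₄ (extremal-beats-forests {H = H} inG (≤-reflexive (sym ΔH)) n≤B
    ((ℓ₁ + x₁ , τ₁) ∷ (ℓ₂ + x₂ , τ₂) ∷ (ℓ₃ + x₃ , τ₃) ∷ (ℓ₄ + x₄ , τ₄) ∷ [])
    ((u₁ , v₁) ∷ (u₂ , v₂) ∷ (u₃ , v₃) ∷ (u₄ , v₄) ∷ [])
    (≤-trans (≤-reflexive (four-centers (ℓ₁ + x₁) (ℓ₂ + x₂) (ℓ₃ + x₃) (ℓ₄ + x₄))) fits))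

module NearStarsOf {n : ℕ} (H : Graph3 n) (D : Decomposition (edges H)) where
  open Decomposition D
  open Counts D

  private
    uC = Unique-++⁻ centers uniqVertices
    uF = Unique-++⁻ (map proj₁ prs) (proj₁ (proj₂ uC))
    uS = Unique-++⁻ (map proj₂ prs) (proj₁ (proj₂ uF))

  uniqCenters : Unique centers
  uniqCenters = proj₁ uC

  Owns : Fin n → Fin n → Set
  Owns z v = v ≡ z ⊎ v ∈ₗ leaves z

  owns? : ∀ z v → Dec (Owns z v)
  owns? z v = (v Fin.≟ z) ⊎-dec Any.any? (v Fin.≟_) (leaves z)

  center-not-leaf : ∀ {z v} → z ∈ₗ centers → v ∈ₗ leaves z → v ∉ₗ centers
  center-not-leaf z∈ v∈ v∈c = proj₂ (proj₂ uC) v∈c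
    (∈-++⁺ʳ (map proj₁ prs) (∈-++⁺ʳ (map proj₂ prs) (∈-concatMap⁺ leaves (Any.map (λ { refl → v∈ }) z∈))))

  owner-unique : ∀ {z z′ v} → z ∈ₗ centers → z′ ∈ₗ centers → Owns z v → Owns z′ v → z ≡ z′
  owner-unique _ _ (inj₁ refl) (inj₁ refl) = refl
  owner-unique z∈ z′∈ (inj₁ refl) (inj₂ v∈) = contradiction z∈ (center-not-leaf z′∈ v∈)
  owner-unique z∈ z′∈ (inj₂ v∈) (inj₁ refl) = contradiction z′∈ (center-not-leaf z∈ v∈)
  owner-unique z∈ z′∈ (inj₂ v∈) (inj₂ v∈′) =
    Unique-concatMap⁻ leaves (proj₁ (proj₂ uS)) z∈ z′∈ v∈ v∈′

  star-owned : ∀ {z e v} → e ∈ₗ star z → v ∈ e → Owns z v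
  star-owned {z} {e} {v} e∈ v∈ with ∈-fan⁻ (uniqLeaves z) (proj₂ (star-core e∈))
  ... | a , b , a∈ , b∈ , _ , refl with ∈tri⁻ {a = z} {a} {b} v∈
  ...   | inj₁ refl = inj₁ refl
  ...   | inj₂ (inj₁ refl) = inj₂ a∈
  ...   | inj₂ (inj₂ refl) = inj₂ b∈

  star-center : ∀ {z e} → e ∈ₗ star z → z ∈ e
  star-center {z} e∈ with ∈-fan⁻ (uniqLeaves z) (proj₂ (star-core e∈))
  ... | _ , _ , _ , _ , _ , refl = ∈tri₁

  near-stars : (cs : List (Fin n)) → Unique cs → (∀ {z} → z ∈ₗ cs → z ∈ₗ centers) → 1 ≤ length cs → length cs ≤ 4 →
    length (edges H) ≤ sum (map (length ∘ star) cs) + 144 → NearStars 144 H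
  near-stars cs uniq sub nonempty ≤4 total =
    kept , Sublist.⊆-trans (filter-⊆ inStar? core) core⊆ , ≤-trans total (ℕₚ.+-monoˡ-≤ 144 kept-length) ,
    length cs , ≤4 , List.lookup cs , color , All.tabulate colored
    where
    inStar? : (e : Subset n) → Dec (Any (λ z → e ∈ₗ star z) cs)
    inStar? e = Any.any? (λ z → e ∈ₗ? star z) cs
    kept : List (Subset n)
    kept = filter inStar? core
    disjoint : ∀ {z z′ e} → z ∈ₗ cs → z′ ∈ₗ cs → e ∈ₗ star z → e ∈ₗ star z′ → z ≡ z′
    disjoint z∈ z′∈ e∈ e∈′ = owner-unique (sub z∈) (sub z′∈) (inj₁ refl) (star-owned e∈′ (star-center e∈))
    kept-length : sum (map (length ∘ star) cs) ≤ length kept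
    kept-length = ≤-trans (≤-reflexive (sym (length-concatMap star cs)))
      (∈-Unique-length (Unique-concatMap star (λ {z} _ → star-unique z) disjoint uniq)
        (λ {e} e∈ → let any = ∈-concatMap⁻ star {xs = cs} e∈ ; z , _ , e∈z = find any
          in ∈-filter⁺ inStar? (proj₁ (star-core e∈z)) any))
    -- The color of vertices that belong to no selected star; no kept edge contains them.
    default : Fin (length cs)
    default = Fin.fromℕ< nonempty
    color : Fin n → Fin (length cs)
    color v with Any.any? (λ z → owns? z v) cs
    ... | yes any = Any.index any
    ... | no _ = default
    owner-color : ∀ {z v} (z∈ : z ∈ₗ cs) → Owns z v → color v ≡ Any.index z∈
    owner-color {z} {v} z∈ own with Any.any? (λ z → owns? z v) cs
    ... | no none = contradiction (Any.map (λ { refl → own }) z∈) none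
    ... | yes any = lookup-map-injective id (subst Unique (sym (Listₚ.map-id cs)) uniq) _ _
      (trans (owner-unique (sub (∈-lookup {xs = cs} (Any.index any))) (sub z∈) (lookup-index any) own) (lookup-index z∈))
    colored : ∀ {e} → e ∈ₗ kept → ∃[ i ] (List.lookup cs i ∈ e × ((v : Fin n) → v ∈ e → color v ≡ i))
    colored {e} e∈ with find (proj₂ (∈-filter⁻ inStar? {xs = core} e∈))
    ... | z , z∈ , e∈z = Any.index z∈ , subst (_∈ e) (lookup-index z∈) (star-center e∈z) ,
      λ v v∈ → owner-color z∈ (star-owned e∈z v∈)

module NearFourStars {n m : ℕ} (H : Graph3 n) (inG : InG n m H) (n≥ : 900 ≤ n) (lower : n * n < 8 * m)
       (D : Decomposition (edges H)) where
  open Decomposition D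
  open Counts D
  open NearStarsOf H D

  ℓ σ : Fin n → ℕ
  ℓ = length ∘ leaves
  σ = length ∘ star

  large : n * n ≤ 32 * Δ H
  large = degrees-large {H = H} D (≤-trans (ℕₚ.m≤m+n 56 844) n≥) (proj₁ (proj₂ inG)) lower

  -- Otherwise all stars are small and m ≤ n²/8. For the largest star this yields more than n/4
  -- leaves; with ℓ₁ = 0 it shows that there is a center at all.
  bounded-leaves : ∀ ℓ₁ → (∀ {z} → z ∈ₗ centers → ℓ z ≤ ℓ₁) → n + 5 ≤ 4 * ℓ₁
  bounded-leaves ℓ₁ h with 4 * ℓ₁ ℕ.≤? n + 4
  ... | no k = ≤-trans (≤-reflexive (ℕₚ.+-suc n 4)) (≰⇒> k)
  ... | yes k′ = contradiction (subst (λ x → 8 * x ≤ n * n) (proj₁ (proj₂ inG)) (quadratic-bound s t L k n-split (≤-trans (ℕₚ.m≤m+n 56 844) n≥) size-bound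
      (scale-sums 8 n σ ℓ centers (λ {z} z∈ → small-star-ratio {n} {ℓ z} {ℓ₁} k′ (h z∈) (star≤choose₂ z))))) (<⇒≱ lower)

  conclude : ∀ {B c} → Δ H ≡ suc B → n ≤ B → choose₂ c ≤ B → n ≤ 4 * c + 3 →
    ∀ ws → centers ↭ ws → Descending ℓ ws → NearStars 144 H
  conclude {B} {c} ΔH n≤B cap hc ws perm desc = cases ws perm desc
    where
    σ≤ : ∀ z → σ z ≤ suc B
    σ≤ z = ≤-trans (star≤degree z) (≤-trans (degree≤Δ H z) (≤-reflexive ΔH))
    leaves-total : ∀ {ws} → centers ↭ ws → L ≡ sum (map ℓ ws)
    leaves-total perm = sum-↭ (Permₚ.map⁺ ℓ perm)
    split : ∀ {ws} → centers ↭ ws → n ≡ 2 * s + length ws + sum (map ℓ ws) + k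
    split perm = trans n-split (cong₂ (λ x y → 2 * s + x + y + k) (Permₚ.↭-length perm) (leaves-total perm))
    total : ∀ {ws} → centers ↭ ws → length (edges H) ≤ s * length ws + sum (map σ ws) + 7 * k
    total perm = ≤-trans size-bound (≤-reflexive (cong₂ (λ x y → s * x + y + 7 * k) (Permₚ.↭-length perm) (sum-↭ (Permₚ.map⁺ σ perm))))
    first-max : ∀ {z ws} → centers ↭ z ∷ ws → Descending ℓ (z ∷ ws) → n + 5 ≤ 4 * ℓ z
    first-max {z} perm (p ∷ _) = bounded-leaves (ℓ z) λ y∈ → All.lookup {P = λ y → ℓ y ≤ ℓ z} (≤-refl ∷ p) (Permₚ.∈-resp-↭ perm y∈)
    unique : ∀ {ws} → centers ↭ ws → Unique ws
    unique perm = PermSₚ.Unique-resp-↭ (≡.setoid (Fin n)) (Perm.↭⇒↭ₛ perm) uniqCenters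
    c≥ : 224 ≤ c
    c≥ = capacity-224 {n} n≥ hc
    gains : ∀ {W} σ₁ σ₂ σ₃ σ₄ {ℓ₁ ℓ₂ ℓ₃ ℓ₄} → σ₁ ≤ choose₂ ℓ₁ → σ₂ ≤ choose₂ ℓ₂ → σ₃ ≤ choose₂ ℓ₃ → σ₄ ≤ choose₂ ℓ₄ →
      σ₁ ≤ suc B → σ₂ ≤ suc B → σ₃ ≤ suc B → σ₄ ≤ suc B →
      length (edges H) ≤ σ₁ + σ₂ + σ₃ + σ₄ + W → GainBound n c ℓ₁ ℓ₂ ℓ₃ ℓ₄ W
    gains {W} σ₁ σ₂ σ₃ σ₄ s₁ s₂ s₃ s₄ t₁ t₂ t₃ t₄ tot = gain-bound {H = H} inG ΔH n≤B cap s₁ s₂ s₃ s₄ t₁ t₂ t₃ t₄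
      (subst (λ m → m ≤ σ₁ + σ₂ + σ₃ + σ₄ + W) (proj₁ (proj₂ inG)) tot)
    cases : ∀ ws → centers ↭ ws → Descending ℓ ws → NearStars 144 H
    cases [] perm _ = contradiction (bounded-leaves 0 (λ z∈ → case Permₚ.∈-resp-↭ perm z∈ of λ ()))
      (λ h → case ≤-trans (ℕₚ.m≤n+m 5 n) h of λ ())
    cases ws@(z₁ ∷ []) perm d = near-stars ws (unique perm) (Permₚ.∈-resp-↭ (↭-sym perm)) (s≤s z≤n) (s≤s z≤n)
      (near₁ tot (three-stars s 0 k {ℓ₁ = ℓ z₁} {0} {0} c≥ hc (first-max perm d) (outside-vertices₁ s k (split perm))
        (gains (σ z₁) 0 0 0 {ℓ z₁} {0} {0} {0} (star≤choose₂ z₁) z≤n z≤n z≤n (σ≤ z₁) z≤n z≤n z≤n tot)))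
      where
      tot : length (edges H) ≤ σ z₁ + 0 + 0 + 0 + (s * (0 + 4) + 7 * k)
      tot = outside-edges₁ s k (total perm)
    cases ws@(z₁ ∷ z₂ ∷ []) perm d = near-stars ws (unique perm) (Permₚ.∈-resp-↭ (↭-sym perm)) (s≤s z≤n) (s≤s (s≤s z≤n))
      (near₂ {σ₁ = σ z₁} tot (three-stars s 0 k {ℓ₁ = ℓ z₁} {ℓ z₂} {0} c≥ hc (first-max perm d) (outside-vertices₂ s k {ℓ₁ = ℓ z₁} (split perm))
        (gains (σ z₁) (σ z₂) 0 0 {ℓ z₁} {ℓ z₂} {0} {0} (star≤choose₂ z₁) (star≤choose₂ z₂) z≤n z≤n (σ≤ z₁) (σ≤ z₂) z≤n z≤n tot)))
      where
      tot : length (edges H) ≤ σ z₁ + σ z₂ + 0 + 0 + (s * (0 + 4) + 7 * k)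
      tot = outside-edges₂ s k {σ₁ = σ z₁} (total perm)
    cases ws@(z₁ ∷ z₂ ∷ z₃ ∷ []) perm d = near-stars ws (unique perm) (Permₚ.∈-resp-↭ (↭-sym perm)) (s≤s z≤n) (s≤s (s≤s (s≤s z≤n)))
      (near₃ {σ₁ = σ z₁} {σ z₂} tot (three-stars s 0 k {ℓ₁ = ℓ z₁} {ℓ z₂} {ℓ z₃} c≥ hc (first-max perm d)
        (outside-vertices₃ s k {ℓ₁ = ℓ z₁} {ℓ z₂} (split perm))
        (gains (σ z₁) (σ z₂) (σ z₃) 0 {ℓ z₁} {ℓ z₂} {ℓ z₃} {0} (star≤choose₂ z₁) (star≤choose₂ z₂) (star≤choose₂ z₃) z≤n
          (σ≤ z₁) (σ≤ z₂) (σ≤ z₃) z≤n tot)))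
      where
      tot : length (edges H) ≤ σ z₁ + σ z₂ + σ z₃ + 0 + (s * (0 + 4) + 7 * k)
      tot = outside-edges₃ s k {σ₁ = σ z₁} {σ z₂} (total perm)
    cases (z₁ ∷ z₂ ∷ z₃ ∷ z₄ ∷ rest) perm d@((_ ∷ _ ∷ z₄≤z₁ ∷ _) ∷ (_ ∷ z₄≤z₂ ∷ _) ∷ (z₄≤z₃ ∷ _) ∷ rest≤z₄ ∷ _) =
      near-stars cs (Uniqueₚ.take⁺ 4 (unique perm)) (λ z∈ → Permₚ.∈-resp-↭ (↭-sym perm) (∈-++⁺ˡ z∈)) (s≤s z≤n) ≤-refl (by-fourth (many-leaves z₄))
      where
      cs : List (Fin n)
      cs = z₁ ∷ z₂ ∷ z₃ ∷ z₄ ∷ []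
      r R Lr : ℕ
      r = length rest
      R = sum (map σ rest)
      Lr = sum (map ℓ rest)
      by-fourth : leaves z₄ ≡ [] ⊎ 8 ≤ ℓ z₄ → length (edges H) ≤ sum (map σ cs) + 144
      -- As the leaf numbers descend, all later stars are empty too, so the case of three stars
      -- applies; the centers beyond the fourth only count in W.
      by-fourth (inj₁ none) = near₄ {σ₁ = σ z₁} {σ z₂} {σ z₃} tot (three-stars s r k {ℓ₁ = ℓ z₁} {ℓ z₂} {ℓ z₃} c≥ hc (first-max perm d)
        (outside-vertices₄′ s r k {ℓ₁ = ℓ z₁} {ℓ z₂} {ℓ z₃} {ℓ z₄} (split perm))
        (gains (σ z₁) (σ z₂) (σ z₃) (σ z₄) {ℓ z₁} {ℓ z₂} {ℓ z₃} {0} (star≤choose₂ z₁) (star≤choose₂ z₂) (star≤choose₂ z₃)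
          (subst (λ x → σ z₄ ≤ choose₂ x) ℓ₄≡0 (star≤choose₂ z₄)) (σ≤ z₁) (σ≤ z₂) (σ≤ z₃) (σ≤ z₄) tot))
        where
        ℓ₄≡0 : ℓ z₄ ≡ 0
        ℓ₄≡0 = cong length none
        R≤0 : R ≤ 0
        R≤0 = ≤-trans (≤-reflexive (sym (ℕₚ.+-identityʳ R))) (scale-sums 1 0 σ ℓ rest λ {z} z∈ →
          ≤-trans (≤-reflexive (ℕₚ.+-identityʳ (σ z))) (≤-trans (star≤choose₂ z)
            (choose₂-mono {ℓ z} {0} (≤-trans (All.lookup rest≤z₄ z∈) (≤-reflexive ℓ₄≡0)))))
        tot : length (edges H) ≤ σ z₁ + σ z₂ + σ z₃ + σ z₄ + (s * (r + 4) + 7 * k)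
        tot = outside-edges₄′ s r k {σ₁ = σ z₁} {σ z₂} {σ z₃} {σ z₄} {R} (total perm) R≤0
      by-fourth (inj₂ some) = near₄ {σ₁ = σ z₁} {σ z₂} {σ z₃} tot (four-stars s r Lr k {ℓ₁ = ℓ z₁} {ℓ z₂} {ℓ z₃} {q} {R}
        (subst (_≤ ℓ z₁) eq z₄≤z₁) (subst (_≤ ℓ z₂) eq z₄≤z₂) (subst (_≤ ℓ z₃) eq z₄≤z₃) hc
        (subst (λ x → ℓ z₁ + ℓ z₂ + ℓ z₃ + x + 4 + (2 * s + r + Lr + k) ≤ n) eq
          (outside-vertices₄ s r k {ℓ₁ = ℓ z₁} {ℓ z₂} {ℓ z₃} {ℓ z₄} (split perm)))
        (scale-sums 2 (7 + q) σ ℓ rest λ {z} z∈ →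
          capped-star-ratio {7 + q} {ℓ z} (≤-trans (All.lookup rest≤z₄ z∈) (≤-reflexive eq)) (star≤choose₂ z))
        (gains (σ z₁) (σ z₂) (σ z₃) (σ z₄) {ℓ z₁} {ℓ z₂} {ℓ z₃} {8 + q} (star≤choose₂ z₁) (star≤choose₂ z₂) (star≤choose₂ z₃)
          (subst (λ x → σ z₄ ≤ choose₂ x) eq (star≤choose₂ z₄)) (σ≤ z₁) (σ≤ z₂) (σ≤ z₃) (σ≤ z₄) tot))
        where
        q : ℕ
        q = ℓ z₄ ∸ 8
        eq : ℓ z₄ ≡ 8 + q
        eq = sym (ℕₚ.m+[n∸m]≡n some)
        tot : length (edges H) ≤ σ z₁ + σ z₂ + σ z₃ + σ z₄ + (s * (r + 4) + R + 7 * k)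
        tot = outside-edges₄ s r k {σ₁ = σ z₁} {σ z₂} {σ z₃} {σ z₄} {R} (total perm)

  near : NearStars 144 H
  near = go (Δ H) refl
    where
    go : ∀ D′ → Δ H ≡ D′ → NearStars 144 H
    go zero eq = contradiction (≤-trans (ℕₚ.*-mono-≤ n≥ n≥) (≤-trans large (≤-reflexive (cong (32 *_) eq)))) λ ()
    go (suc B) eq with capacity B | sort ℓ centers
    ... | c , low , high | ws , perm , d = conclude {B} {c} eq
      (below-degree {n} n≥ (subst (λ x → n * n ≤ 32 * x) eq large)) low
      (capacity-large {n} {suc B} {c} large′ high) ws perm d
      where
      large′ : n * n ≤ 32 * suc B
      large′ = subst (λ x → n * n ≤ 32 * x) eq large

theorem9 : (∃[ n₂ ] ((n m : ℕ) → n₂ ≤ n →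
    5 * (n * n) ≤ 40 * m + 8 * n → 40 * m ≤ 5 * (n * n) →
    (H : Graph3 n) → InG n m H → QuasiBipartite H))
    × (∃[ ñ₂ ] ((n m : ℕ) → ñ₂ ≤ n →
    n * n < 8 * m → m ≤ (n ∸ 1) C 2 →
    (H : Graph3 n) → InG n m H →
    (n * n ≤ 32 * Δ H) × NearStars 144 H))
theorem9 = (1008 , near-maximum⇒quasiBipartite) , 900 , above-maximum
  where
  above-maximum : ∀ n m → 900 ≤ n → n * n < 8 * m → m ≤ (n ∸ 1) C 2 →
    (H : Graph3 n) → InG n m H → (n * n ≤ 32 * Δ H) × NearStars 144 H
  above-maximum n m n≥ lower _ H inG = large , near
    where open NearFourStars H inG n≥ lower (decompose (good-graph H (proj₁ inG)))
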